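{- Let $W$ be the Weyl group of type $C$ (with root system of type $C_n$) and let $k$ be an odd positive integer. Then $x_k=M_{W,k}=H_{W,k}$; that is, for each $w\in W$ the coefficient of $w$ in $x_k$ equals $M_{W,k}(w)$ and equals $H_{W,k}(w)$.
   Context: Definition of $x_k$ (Cellini). Let $W$ be the Weyl group of an irreducible crystallographic root system of rank $r$ with simple roots $\Pi=\{\alpha_1,\dots,\alpha_r\}$, highest root $\theta$, and coroot lattice $Y$; put $\alpha_0=-\theta$ and $\tilde\Pi=\Pi\cup\{\alpha_0\}$. Let $Cdes(w)$ be the set of elements of $\tilde\Pi$ mapped to negative roots by $w$. For a positive integer $k$ and $I\subseteq\tilde\Pi$, let $a_{k,I}$ be the number of $t\in Y$ such that $\langle\alpha_i,t\rangle=0$ for all $\alpha_i\in I\cap\Pi$, $\langle\alpha_i,t\rangle>0$ for all $\alpha_i\in\Pi-I$, and moreover $\langle\theta,t\rangle=k$ if $\alpha_0\in I$, while $\langle\theta,t\rangle<k$ if $\alpha_0\notin I$. Then $x_k=\sum_{w\in W}\Big(\frac1{k^r}\sum_{I\subseteq\tilde\Pi-Cdes(w)}a_{k,I}\Big)w$. For $W$ of rank $n$ acting on its $n$-dimensional reflection representation $V$: $Des(w)=\{\alpha\in\Pi: w(\alpha)\text{ negative}\}$. On subsets of $\Pi$ put $J\sim K$ iff $w(J)=K$ for some $w\in W$; $\lambda$ denotes a class, $\lambda(K)$ the class of $K$, $|\lambda|$ its number of elements, $\|\lambda\|=|J|$ for $J\in\lambda$. Definition of $M_{W,x}$ ($x\neq0$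 real): for $J\subseteq\Pi$ let $X_J=\{w: Des(w)\cap J=\emptyset\}$, $x_J=\sum_{w\in X_J}w$ (not to be confused with $x_k$). For $K\subseteq J$ let $\mu_K^J=\frac{|\{w\in X_J:w(K)\subseteq\Pi\}|}{|\lambda(K)|}$, and $\mu_K^J=0$ if $K\not\subseteq J$; let $(\beta_K^J)$ be the inverse of the matrix $(\mu_K^J)$ (rows $J$, columns $K$); $e_\lambda=\frac1{|\lambda|}\sum_{J\in\lambda}\sum_{K\subseteq J}\beta_K^Jx_K$; $M_{W,x}=\sum_\lambda e_\lambda/x^{\|\lambda\|}$, and $M_{W,x}(w)$ is the coefficient of $w$. Definition of $H_{W,x}$: let $L$ be the set of intersections of root hyperplanes (including $V$), ordered by reverse inclusion, with Möbius function $\mu$; $L^X=\{Y\in L:Y\ge X\}$, $\chi(L^X,x)=\sum_{Y\ge X}\mu(X,Y)x^{\dim Y}$. $W_K$ is the parabolic subgroup generated by reflections in the roots of $K\subseteq\Pi$, $Fix(W_K)$ its fixed space, $N_W(W_K)$ its normalizer. $H_{W,x}(w)=\sum_{K\subseteq\Pi-Des(w)}\frac{|W_K|\chi(L^{Fix(W_K)},x)}{x^n|N_W(W_K)||\lambda(K)|}$. -}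

module Defs where

open import Algebra.Bundles using (CommutativeRing)
open import Data.Bool as Bool using (true; false; if_then_else_)
open import Data.Fin as Fin using (Fin; zero; suc)
import Data.Fin.Properties as Finₚ
open import Data.Fin.Induction using (spo-wellFounded)
open import Data.Fin.Subset as Subset using (Subset; inside; outside; _⊆_; _⊂_; _∩_; ∁; Empty; ∣_∣)
open import Data.Fin.Subset.Induction using (⊂-wellFounded)
open import Data.Fin.Subset.Properties as Subsetₚ using (_⊆?_; _⊂?_)
import Data.Integer as ℤ
import Data.Integer.Properties as ℤₚ
open import Data.List as List using (List; []; _∷_; _++_; allFin; cartesianProduct; cartesianProductWith; concatMap; deduplicate; filter; length; upTo)
import Data.List.Properties as Listₚ
open import Data.List.Membership.Propositional using (_∈_; lose; find)
import Data.List.Membership.DecPropositional as DecMembership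
open import Data.List.Membership.Propositional.Properties
open import Data.List.Relation.Unary.All as All using (All; []; _∷_)
import Data.List.Relation.Unary.All.Properties as Allₚ
open import Data.List.Relation.Unary.Any as Any using (here; there)
open import Data.List.Relation.Unary.Unique.Propositional using (Unique; []; _∷_)
import Data.List.Relation.Unary.Unique.Propositional.Properties as Uniqueₚ
open import Data.Nat as ℕ using (ℕ; zero; suc)
import Data.Nat.Properties as ℕₚ
open import Data.Product using (∃; _×_; _,_; proj₁; proj₂)
open import Data.Rational using (ℚ; 0ℚ; 1ℚ; ½; _+_; _*_; _-_; -_; _≤_; _<_; _/_; 1/_; ≢-nonZero; toℚᵘ)
import Data.Rational.Properties as ℚₚ
import Data.Rational.Unnormalised as ℚᵘ
open ℚᵘ using (mkℚᵘ; *≡*; *≤*)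
import Data.Rational.Unnormalised.Properties as ℚᵘₚ
open import Data.Rational.Solver using (module +-*-Solver)
open import Data.Sign as Sign using (Sign)
import Data.Sign.Properties as Signₚ
open import Data.Sum using (_⊎_; inj₁; inj₂; [_,_]′)
open import Data.Vec as Vec using (Vec; []; _∷_; lookup; tabulate; replicate; zipWith)
import Data.Vec.Properties as Vecₚ
open import Function using (_∘_; _⇔_; mk⇔)
open import Induction.WellFounded using (WellFounded; module All; module FixPoint)
open import Level using (0ℓ)
open import Relation.Binary.Definitions using (DecidableEquality)
open import Relation.Binary.PropositionalEquality
open import Relation.Nullary using (¬_; Dec; yes; no; does; contradiction; contradiction-irr)
open import Relation.Nullary.Decidable as Dec using (¬?; _×-dec_; _⊎-dec_; _→-dec_; map′)
open import Relation.Unary using (Pred; Decidable)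

open import Algebra.Properties.Semiring.Exp (CommutativeRing.semiring ℚₚ.+-*-commutativeRing)
  using (_^_)
open +-*-Solver using (solve; _:=_; _:+_; _:*_; _:-_; :-_; con)

private
  variable
    A B : Set
    n : ℕ

fromℕ : ℕ → ℚ
fromℕ m = ℤ.+ m / 1

infixl 7 _÷₀_

-- Total division, with p ÷₀ 0 = 0; below, every divisor is nonzero for x ≠ 0.
_÷₀_ : ℚ → ℚ → ℚ
p ÷₀ q with q ℚₚ.≟ 0ℚ
... | yes _  = 0ℚ
... | no q≢0 = p * (1/ q) {{≢-nonZero q≢0}}

∑ : List A → (A → ℚ) → ℚ
∑ []       f = 0ℚ
∑ (a ∷ as) f = f a + ∑ as f

infix 2 ∑
syntax ∑ as (λ a → q) = ∑[ a ∈ as ] q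

[_]? : {P : Set} → Dec P → ℚ
[ p? ]? = if does p? then 1ℚ else 0ℚ

count : {P : Pred A 0ℓ} → Decidable P → List A → ℕ
count P? as = length (filter P? as)

allVec : List A → ∀ n → List (Vec A n)
allVec as zero    = [] ∷ []
allVec as (suc n) = cartesianProductWith _∷_ as (allVec as n)

subsets : ∀ n → List (Subset n)
subsets = allVec (inside ∷ outside ∷ [])

sublists : List A → List (List A)
sublists []       = [] ∷ []
sublists (a ∷ as) = List.map (a ∷_) (sublists as) ++ sublists as

-- Roots and coroots are rational, so intersections of root hyperplanes have the
-- same inclusions and dimensions over ℚ as over ℝ.
V : ℕ → Set
V = Vec ℚ

infixl 6 _+ᵥ_ _-ᵥ_
infixr 7 _·_

0ᵥ : V n
0ᵥ = replicate _ 0ℚ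

_+ᵥ_ _-ᵥ_ : V n → V n → V n
_+ᵥ_ = zipWith _+_
_-ᵥ_ = zipWith _-_

_·_ : ℚ → V n → V n
c · v = Vec.map (c *_) v

-ᵥ_ : V n → V n
-ᵥ v = Vec.map -_ v

⟨_,_⟩ : V n → V n → ℚ
⟨ []    , []    ⟩ = 0ℚ
⟨ x ∷ u , y ∷ v ⟩ = x * y + ⟨ u , v ⟩

e : Fin n → V n
e zero    = 1ℚ ∷ 0ᵥ
e (suc i) = 0ℚ ∷ e i

infix 4 _≟ᵥ_ _≟w_ _∼_ _∼?_ _∈X_ _∈X?_ _∈ₛ_ _∈ₛ?_ _⊆ₛ_ _⊆ₛ?_ _≐_ _≐?_ _∈W⟨_⟩?

_≟ᵥ_ : DecidableEquality (V n)
_≟ᵥ_ = Vecₚ.≡-dec ℚₚ._≟_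

module _ {n : ℕ} where
  open DecMembership (_≟ᵥ_ {n}) public using (_∈?_)

2ℚ : ℚ
2ℚ = ℤ.+ 2 / 1

Φ⁺ : ∀ n → List (V n)
Φ⁺ n = List.map (λ i → 2ℚ · e i) (allFin n)
    ++ concatMap (λ (i , j) → e i -ᵥ e j ∷ e i +ᵥ e j ∷ [])
         (filter (λ (i , j) → i Finₚ.<? j) (cartesianProduct (allFin n) (allFin n)))

-- e₁ - e₂ , … , eₙ₋₁ - eₙ , 2eₙ
simple : Fin n → V n
simple {suc zero}    zero    = 2ℚ ∷ []
simple {suc (suc n)} zero    = 1ℚ ∷ - 1ℚ ∷ 0ᵥ
simple {suc (suc n)} (suc i) = 0ℚ ∷ simple i

θ : V n
θ {zero}  = []
θ {suc n} = 2ℚ ∷ 0ᵥ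

-- A subset I of Π ∪ {α₀} is a Subset (suc n): zero stands for α₀ = - θ and
-- suc i for simple i.
extended : Fin (suc n) → V n
extended zero    = -ᵥ θ
extended (suc i) = simple i

Negative : V n → Set
Negative v = (-ᵥ v) ∈ Φ⁺ _

negative? : Decidable (Negative {n})
negative? v = (-ᵥ v) ∈? Φ⁺ _

coroot : V n → V n
coroot α = (2ℚ ÷₀ ⟨ α , α ⟩) · α

reflect : V n → V n → V n
reflect α v = v -ᵥ ⟨ v , coroot α ⟩ · α

-- The Weyl group of Cₙ is the group of signed permutations of the coordinates.
-- The element with fields π and ε is the linear map v ↦ (εᵢ v_{π i})ᵢ.
record W (n : ℕ) : Set where
  constructor signedPerm
  field
    perm       : Vec (Fin n) n
    sign       : Vec Sign n
    .injective : ∀ i j → lookup perm i ≡ lookup perm j → i ≡ j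

open W

signed : Sign → ℚ → ℚ
signed Sign.+ q = q
signed Sign.- q = - q

act : W n → V n → V n
act w v = tabulate λ i → signed (lookup (sign w) i) (lookup v (lookup (perm w) i))

ε : W n
ε {n} = record
  { perm      = Vec.allFin n
  ; sign      = replicate n Sign.+
  ; injective = λ i j eq → trans (sym (Vecₚ.lookup-allFin i)) (trans eq (Vecₚ.lookup-allFin j))
  }

infixl 7 _∙_

_∙_ : W n → W n → W n
signedPerm π s inj ∙ signedPerm π′ s′ inj′ = record
  { perm      = tabulate λ i → lookup π′ (lookup π i)
  ; sign      = tabulate λ i → lookup s i Sign.* lookup s′ (lookup π i)
  ; injective = λ i j eq → inj i j (inj′ _ _
      (trans (sym (Vecₚ.lookup∘tabulate _ i)) (trans eq (Vecₚ.lookup∘tabulate _ j))))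
  }

_≟w_ : DecidableEquality (W n)
signedPerm π s _ ≟w signedPerm π′ s′ _ =
  map′ (λ { (refl , refl) → refl }) (λ { refl → refl , refl })
    (Vecₚ.≡-dec Finₚ._≟_ π π′ ×-dec Vecₚ.≡-dec Signₚ._≟_ s s′)

injective? : (π : Vec (Fin n) n) → Dec (∀ i j → lookup π i ≡ lookup π j → i ≡ j)
injective? π = Finₚ.all? λ i → Finₚ.all? λ j → (lookup π i Finₚ.≟ lookup π j) →-dec (i Finₚ.≟ j)

withSigns : Vec (Fin n) n → List (W n)
withSigns {n} π with injective? π
... | yes inj = List.map (λ s → signedPerm π s inj) (allVec (Sign.+ ∷ Sign.- ∷ []) n)
... | no _    = []

elements : ∀ n → List (W n)
elements n = concatMap withSigns (allVec (allFin n) n)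

∈-allVec : {as : List A} → (∀ a → a ∈ as) → (v : Vec A n) → v ∈ allVec as n
∈-allVec all []      = here refl
∈-allVec all (a ∷ v) = ∈-cartesianProductWith⁺ _∷_ (all a) (∈-allVec all v)

∈-subsets : (I : Subset n) → I ∈ subsets n
∈-subsets = ∈-allVec λ { true → here refl ; false → there (here refl) }

∈-withSigns : (w : W n) → w ∈ withSigns (perm w)
∈-withSigns (signedPerm π s inj) with injective? π
... | yes _ = ∈-map⁺ (λ s → signedPerm π s inj) (∈-allVec (λ { Sign.+ → here refl ; Sign.- → there (here refl) }) s)
... | no ¬inj = contradiction-irr inj ¬inj

∈-elements : (w : W n) → w ∈ elements n
∈-elements w = ∈-concatMap⁺ withSigns (lose (∈-allVec ∈-allFin (perm w)) (∈-withSigns w))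

act-ε : (v : V n) → act ε v ≡ v
act-ε v = begin
  act ε v                  ≡⟨ Vecₚ.tabulate-cong (λ i → cong₂ signed (Vecₚ.lookup-replicate i Sign.+)
                                                         (cong (lookup v) (Vecₚ.lookup-allFin i))) ⟩
  tabulate (lookup v)      ≡⟨ Vecₚ.tabulate∘lookup v ⟩
  v                        ∎
  where open ≡-Reasoning

act-∙ : (w u : W n) (v : V n) → act (w ∙ u) v ≡ act w (act u v)
act-∙ w u v = Vecₚ.tabulate-cong λ i → begin
  signed (lookup (sign (w ∙ u)) i) (lookup v (lookup (perm (w ∙ u)) i))
    ≡⟨ cong₂ signed (Vecₚ.lookup∘tabulate _ i) (cong (lookup v) (Vecₚ.lookup∘tabulate _ i)) ⟩
  signed (lookup (sign w) i Sign.* lookup (sign u) (lookup (perm w) i))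
         (lookup v (lookup (perm u) (lookup (perm w) i)))
    ≡⟨ signed-* (lookup (sign w) i) _ _ ⟩
  signed (lookup (sign w) i) (signed (lookup (sign u) (lookup (perm w) i))
         (lookup v (lookup (perm u) (lookup (perm w) i))))
    ≡⟨ cong (signed (lookup (sign w) i)) (Vecₚ.lookup∘tabulate _ (lookup (perm w) i)) ⟨
  signed (lookup (sign w) i) (lookup (act u v) (lookup (perm w) i)) ∎
  where
  open ≡-Reasoning
  signed-* : ∀ s t q → signed (s Sign.* t) q ≡ signed s (signed t q)
  signed-* Sign.+ t      q = refl
  signed-* Sign.- Sign.+ q = refl
  signed-* Sign.- Sign.- q = solve 1 (λ q → q := :- (:- q)) refl q

∀W? : {P : Pred (W n) 0ℓ} → Decidable P → Dec (∀ w → P w)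
∀W? P? = map′ (λ all w → All.lookup all (∈-elements w)) (λ p → All.tabulate λ {w} _ → p w)
  (All.all? P? (elements _))

∃W? : {P : Pred (W n) 0ℓ} → Decidable P → Dec (∃ P)
∃W? P? = map′ (λ any → let w , _ , p = find any in w , p) (λ (w , p) → lose (∈-elements w) p)
  (Any.any? P? (elements _))

Des : W n → Subset n
Des w = tabulate λ i → does (negative? (act w (simple i)))

Cdes : W n → Subset (suc n)
Cdes w = tabulate λ i → does (negative? (act w (extended i)))

data Y {n : ℕ} : V n → Set where
  0∈Y     : Y 0ᵥ
  +coroot : ∀ {α t} → α ∈ Φ⁺ n → Y t → Y (t +ᵥ coroot α)
  -coroot : ∀ {α t} → α ∈ Φ⁺ n → Y t → Y (t -ᵥ coroot α)

Face : ℕ → Subset (suc n) → V n → Set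
Face k I t = (∀ i → suc i Subset.∈ I → ⟨ simple i , t ⟩ ≡ 0ℚ)
           × (∀ i → suc i Subset.∉ I → 0ℚ < ⟨ simple i , t ⟩)
           × (zero Subset.∈ I → ⟨ θ , t ⟩ ≡ fromℕ k)
           × (zero Subset.∉ I → ⟨ θ , t ⟩ < fromℕ k)

face? : ∀ k (I : Subset (suc n)) → Decidable (Face k I)
face? k I t =
        Finₚ.all? (λ i → (suc i Subsetₚ.∈? I) →-dec (⟨ simple i , t ⟩ ℚₚ.≟ 0ℚ))
  ×-dec Finₚ.all? (λ i → ¬? (suc i Subsetₚ.∈? I) →-dec (0ℚ ℚₚ.<? ⟨ simple i , t ⟩))
  ×-dec ((zero Subsetₚ.∈? I) →-dec (⟨ θ , t ⟩ ℚₚ.≟ fromℕ k))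
  ×-dec (¬? (zero Subsetₚ.∈? I) →-dec (⟨ θ , t ⟩ ℚₚ.<? fromℕ k))

-- The integral points of the cube [0,k]ⁿ.  See points-Y, points-complete and
-- points-unique below: these are distinct points of Y, and every t ∈ Y lying in
-- some Face k I is among them.
points : ∀ n → ℕ → List (V n)
points n k = List.map (Vec.map fromℕ) (allVec (upTo (suc k)) n)

a : ℕ → Subset (suc n) → ℕ
a k I = count (face? k I) (points _ k)

x[_] : ℕ → W n → ℚ
x[_] {n} k w = (1ℚ ÷₀ fromℕ k ^ n)
             * (∑[ I ∈ filter (_⊆? ∁ (Cdes w)) (subsets (suc n)) ] fromℕ (a k I))

SendsTo : W n → Subset n → Subset n → Set
SendsTo w J K = (∀ i → i Subset.∈ J → ∃ λ j → j Subset.∈ K × act w (simple i) ≡ simple j)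
              × (∀ j → j Subset.∈ K → ∃ λ i → i Subset.∈ J × act w (simple i) ≡ simple j)

sendsTo? : (w : W n) (J K : Subset n) → Dec (SendsTo w J K)
sendsTo? w J K =
        Finₚ.all? (λ i → (i Subsetₚ.∈? J) →-dec
          Finₚ.any? λ j → (j Subsetₚ.∈? K) ×-dec (act w (simple i) ≟ᵥ simple j))
  ×-dec Finₚ.all? (λ j → (j Subsetₚ.∈? K) →-dec
          Finₚ.any? λ i → (i Subsetₚ.∈? J) ×-dec (act w (simple i) ≟ᵥ simple j))

_∼_ : Subset n → Subset n → Set
J ∼ K = ∃ λ w → SendsTo w J K

_∼?_ : (J K : Subset n) → Dec (J ∼ K)
J ∼? K = ∃W? λ w → sendsTo? w J K

λ-class : Subset n → List (Subset n)
λ-class J = filter (J ∼?_) (subsets _)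

-- One representative of each class.
classes : ∀ n → List (Subset n)
classes n = deduplicate _∼?_ (subsets n)

_∈X_ : W n → Subset n → Set
w ∈X J = Empty (Des w ∩ J)

_∈X?_ : (w : W n) (J : Subset n) → Dec (w ∈X J)
w ∈X? J = ¬? (Subsetₚ.nonempty? (Des w ∩ J))

IntoΠ : Subset n → W n → Set
IntoΠ K w = ∀ i → i Subset.∈ K → ∃ λ j → act w (simple i) ≡ simple j

intoΠ? : (K : Subset n) → Decidable (IntoΠ K)
intoΠ? K w = Finₚ.all? λ i → (i Subsetₚ.∈? K) →-dec Finₚ.any? λ j → act w (simple i) ≟ᵥ simple j

μ : Subset n → Subset n → ℚ
μ {n} J K with K ⊆? J
... | yes _ = fromℕ (count (λ w → (w ∈X? J) ×-dec intoΠ? K w) (elements n))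
            ÷₀ fromℕ (length (λ-class K))
... | no _  = 0ℚ

β-term : (J L : Subset n) → (L ⊂ J → ℚ) → Dec (L ⊂ J) → ℚ
β-term J L b (yes L⊂J) = μ J L * b L⊂J
β-term J L b (no _)    = 0ℚ

β-step : (K J : Subset n) → (∀ {L} → L ⊂ J → ℚ) → ℚ
β-step {n} K J b =
  ([ Vecₚ.≡-dec Bool._≟_ J K ]? - (∑[ L ∈ subsets n ] β-term J L b (L ⊂? J))) ÷₀ μ J J

-- The inverse of the triangular matrix μ, by forward substitution; see μ-β.
β : Subset n → Subset n → ℚ
β J K = All.wfRec ⊂-wellFounded 0ℓ (λ _ → ℚ) (β-step K) J

x⟨_⟩ : Subset n → W n → ℚ
x⟨ J ⟩ w = [ w ∈X? J ]?

-- The element e_λ for the class λ of J₀.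
idempotent : Subset n → W n → ℚ
idempotent {n} J₀ w = (1ℚ ÷₀ fromℕ (length (λ-class J₀)))
  * (∑[ J ∈ λ-class J₀ ] (∑[ K ∈ filter (_⊆? J) (subsets n) ] β J K * x⟨ K ⟩ w))

M : ℚ → W n → ℚ
M {n} x w = ∑[ J ∈ classes n ] idempotent J w ÷₀ x ^ ∣ J ∣

Subspace : ℕ → Set
Subspace n = List (V n)

_∈ₛ_ : V n → Subspace n → Set
v ∈ₛ U = All (λ f → ⟨ f , v ⟩ ≡ 0ℚ) U

_∈ₛ?_ : (v : V n) (U : Subspace n) → Dec (v ∈ₛ U)
v ∈ₛ? U = All.all? (λ f → ⟨ f , v ⟩ ℚₚ.≟ 0ℚ) U

comb : ∀ {d} → Vec ℚ d → Vec (V n) d → V n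
comb []       []       = 0ᵥ
comb (c ∷ cs) (b ∷ bs) = c · b +ᵥ comb cs bs

record Basis (U : Subspace n) : Set where
  field
    {size}      : ℕ
    vectors     : Vec (V n) size
    lies-in     : ∀ c → comb c vectors ∈ₛ U
    spanning    : ∀ v → v ∈ₛ U → ∃ λ c → comb c vectors ≡ v
    independent : ∀ c → comb c vectors ≡ 0ᵥ → c ≡ replicate size 0ℚ

⟨⟩-0 : (f : V n) → ⟨ f , 0ᵥ ⟩ ≡ 0ℚ
⟨⟩-0 []      = refl
⟨⟩-0 (x ∷ f) = trans (cong₂ _+_ (ℚₚ.*-zeroʳ x) (⟨⟩-0 f)) (ℚₚ.+-identityˡ 0ℚ)

⟨⟩-+ : (f u v : V n) → ⟨ f , u +ᵥ v ⟩ ≡ ⟨ f , u ⟩ + ⟨ f , v ⟩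
⟨⟩-+ []      []      []      = refl
⟨⟩-+ (x ∷ f) (y ∷ u) (z ∷ v) = trans (cong (x * (y + z) +_) (⟨⟩-+ f u v))
  (solve 5 (λ x y z p q → x :* (y :+ z) :+ (p :+ q) := (x :* y :+ p) :+ (x :* z :+ q))
    refl x y z ⟨ f , u ⟩ ⟨ f , v ⟩)

⟨⟩-· : (f : V n) (c : ℚ) (v : V n) → ⟨ f , c · v ⟩ ≡ c * ⟨ f , v ⟩
⟨⟩-· []      c []      = sym (ℚₚ.*-zeroʳ c)
⟨⟩-· (x ∷ f) c (y ∷ v) = trans (cong (x * (c * y) +_) (⟨⟩-· f c v))
  (solve 4 (λ x c y p → x :* (c :* y) :+ c :* p := c :* (x :* y :+ p)) refl x c y ⟨ f , v ⟩)

0·+0 : (c : ℚ) (v : V n) → c ≡ 0ℚ → c · v +ᵥ 0ᵥ ≡ 0ᵥ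
0·+0 c []      eq = refl
0·+0 c (x ∷ v) eq = cong₂ _∷_ (trans (ℚₚ.+-identityʳ _) (trans (cong (_* x) eq) (ℚₚ.*-zeroˡ x)))
  (0·+0 c v eq)

comb-0 : ∀ {d} (bs : Vec (V n) d) → comb (replicate d 0ℚ) bs ≡ 0ᵥ
comb-0 []       = refl
comb-0 (b ∷ bs) = trans (cong (0ℚ · b +ᵥ_) (comb-0 bs)) (0·+0 0ℚ b refl)

+ᵥ-identityˡ : (v : V n) → 0ᵥ +ᵥ v ≡ v
+ᵥ-identityˡ = Vecₚ.zipWith-identityˡ ℚₚ.+-identityˡ

⟨⟩-comb : ∀ {d} (f b : V n) c (cs : Vec ℚ d) bs →
          ⟨ f , comb (c ∷ cs) (b ∷ bs) ⟩ ≡ c * ⟨ f , b ⟩ + ⟨ f , comb cs bs ⟩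
⟨⟩-comb f b c cs bs = trans (⟨⟩-+ f (c · b) (comb cs bs)) (cong (_+ _) (⟨⟩-· f c b))

eliminate : ∀ {d} → V n → V n → ℚ → Vec (V n) d → Vec (V n) d
eliminate f b r = Vec.map λ b′ → b′ -ᵥ (⟨ f , b′ ⟩ * r) · b

comb-eliminate : ∀ {d} (f b : V n) (r : ℚ) (cs : Vec ℚ d) (bs : Vec (V n) d) →
  comb cs (eliminate f b r bs) ≡ comb ((- (⟨ f , comb cs bs ⟩ * r)) ∷ cs) (b ∷ bs)
comb-eliminate f b r []       []        =
  sym (0·+0 _ b (trans (cong (λ q → - (q * r)) (⟨⟩-0 f)) (cong -_ (ℚₚ.*-zeroˡ r))))
comb-eliminate f b r (c ∷ cs) (b′ ∷ bs) = begin
  c · (b′ -ᵥ (p * r) · b) +ᵥ comb cs (eliminate f b r bs)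
    ≡⟨ cong (c · (b′ -ᵥ (p * r) · b) +ᵥ_) (comb-eliminate f b r cs bs) ⟩
  c · (b′ -ᵥ (p * r) · b) +ᵥ ((- (φ * r)) · b +ᵥ comb cs bs)
    ≡⟨ rearrange b b′ (comb cs bs) ⟩
  (- ((c * p + φ) * r)) · b +ᵥ (c · b′ +ᵥ comb cs bs)
    ≡⟨ cong (λ q → (- (q * r)) · b +ᵥ (c · b′ +ᵥ comb cs bs)) (⟨⟩-comb f b′ c cs bs) ⟨
  (- (⟨ f , comb (c ∷ cs) (b′ ∷ bs) ⟩ * r)) · b +ᵥ comb (c ∷ cs) (b′ ∷ bs) ∎
  where
  open ≡-Reasoning
  p φ : ℚ
  p = ⟨ f , b′ ⟩
  φ = ⟨ f , comb cs bs ⟩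
  rearrange : ∀ {m} (b b′ v : V m) → c · (b′ -ᵥ (p * r) · b) +ᵥ ((- (φ * r)) · b +ᵥ v)
                                   ≡ (- ((c * p + φ) * r)) · b +ᵥ (c · b′ +ᵥ v)
  rearrange []      []       []      = refl
  rearrange (x ∷ b) (y ∷ b′) (z ∷ v) = cong₂ _∷_
    (solve 7 (λ c p r φ x y z →
        c :* (y :- (p :* r) :* x) :+ ((:- (φ :* r)) :* x :+ z)
          := (:- ((c :* p :+ φ) :* r)) :* x :+ (c :* y :+ z))
      refl c p r φ x y z)
    (rearrange b b′ v)

cut : ∀ {d} → V n → Vec (V n) d → ∃ (Vec (V n))
cut f [] = 0 , []
cut f (b ∷ bs) with ⟨ f , b ⟩ ℚₚ.≟ 0ℚ
... | yes _ = suc (proj₁ (cut f bs)) , b ∷ proj₂ (cut f bs)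
... | no  p = _ , eliminate f b ((1/ ⟨ f , b ⟩) {{≢-nonZero p}}) bs

inverse : ∀ q (q≢0 : q ≢ 0ℚ) → q * (1/ q) {{≢-nonZero q≢0}} ≡ 1ℚ
inverse q q≢0 = ℚₚ.*-inverseʳ q {{≢-nonZero q≢0}}

0c : ∀ c q → q ≡ 0ℚ → c * q ≡ 0ℚ
0c c q eq = trans (cong (c *_) eq) (ℚₚ.*-zeroʳ c)

cut-killed : ∀ {d} (f : V n) (bs : Vec (V n) d) cs → ⟨ f , comb cs (proj₂ (cut f bs)) ⟩ ≡ 0ℚ
cut-killed f []       []       = ⟨⟩-0 f
cut-killed f (b ∷ bs) cs       with ⟨ f , b ⟩ ℚₚ.≟ 0ℚ
cut-killed f (b ∷ bs) (c ∷ cs) | yes p =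
  trans (⟨⟩-comb f b c cs _) (cong₂ _+_ (0c c _ p) (cut-killed f bs cs))
cut-killed f (b ∷ bs) cs       | no p = begin
  ⟨ f , comb cs (eliminate f b r bs) ⟩       ≡⟨ cong ⟨ f ,_⟩ (comb-eliminate f b r cs bs) ⟩
  ⟨ f , comb (- (φ * r) ∷ cs) (b ∷ bs) ⟩     ≡⟨ ⟨⟩-comb f b (- (φ * r)) cs bs ⟩
  - (φ * r) * q + φ                          ≡⟨ solve 3 (λ φ r q → (:- (φ :* r)) :* q :+ φ
                                                   := φ :* (con 1ℚ :- q :* r)) refl φ r q ⟩
  φ * (1ℚ - q * r)                           ≡⟨ cong (λ s → φ * (1ℚ - s)) (inverse q p) ⟩
  φ * (1ℚ - 1ℚ)                              ≡⟨ ℚₚ.*-zeroʳ φ ⟩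
  0ℚ                                         ∎
  where
  open ≡-Reasoning
  q r φ : ℚ
  q = ⟨ f , b ⟩
  r = (1/ q) {{≢-nonZero p}}
  φ = ⟨ f , comb cs bs ⟩

cut-⊆ : ∀ {d} (f : V n) (bs : Vec (V n) d) cs →
        ∃ λ cs′ → comb cs′ bs ≡ comb cs (proj₂ (cut f bs))
cut-⊆ f []       []       = [] , refl
cut-⊆ f (b ∷ bs) cs       with ⟨ f , b ⟩ ℚₚ.≟ 0ℚ
cut-⊆ f (b ∷ bs) (c ∷ cs) | yes _ = let cs′ , eq = cut-⊆ f bs cs in c ∷ cs′ , cong (c · b +ᵥ_) eq
cut-⊆ f (b ∷ bs) cs       | no p  =
  let r = (1/ ⟨ f , b ⟩) {{≢-nonZero p}}
  in - (⟨ f , comb cs bs ⟩ * r) ∷ cs , sym (comb-eliminate f b r cs bs)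

cut-⊇ : ∀ {d} (f : V n) (bs : Vec (V n) d) cs → ⟨ f , comb cs bs ⟩ ≡ 0ℚ →
        ∃ λ cs′ → comb cs′ (proj₂ (cut f bs)) ≡ comb cs bs
cut-⊇ f []       []       _  = [] , refl
cut-⊇ f (b ∷ bs) (c ∷ cs) eq with ⟨ f , b ⟩ ℚₚ.≟ 0ℚ
... | yes p =
  let cs′ , eq′ = cut-⊇ f bs cs (begin
        ⟨ f , comb cs bs ⟩                       ≡⟨ ℚₚ.+-identityˡ _ ⟨
        0ℚ + ⟨ f , comb cs bs ⟩                  ≡⟨ cong (_+ _) (0c c _ p) ⟨
        c * ⟨ f , b ⟩ + ⟨ f , comb cs bs ⟩       ≡⟨ ⟨⟩-comb f b c cs bs ⟨
        ⟨ f , comb (c ∷ cs) (b ∷ bs) ⟩           ≡⟨ eq ⟩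
        0ℚ                                       ∎)
  in c ∷ cs′ , cong (c · b +ᵥ_) eq′
  where open ≡-Reasoning
... | no p = cs , trans (comb-eliminate f b r cs bs) (cong (λ s → s · b +ᵥ comb cs bs) (begin
    - (φ * r)                       ≡⟨ solve 4 (λ c q r φ → :- (φ :* r)
                                          := c :* (q :* r) :- (c :* q :+ φ) :* r) refl c q r φ ⟩
    c * (q * r) - (c * q + φ) * r   ≡⟨ cong₂ (λ s t → c * s - t * r) (inverse q p)
                                          (trans (sym (⟨⟩-comb f b c cs bs)) eq) ⟩
    c * 1ℚ - 0ℚ * r                 ≡⟨ solve 2 (λ c r → c :* con 1ℚ :- con 0ℚ :* r := c) refl c r ⟩
    c                               ∎))
  where
  open ≡-Reasoning
  q r φ : ℚ
  q = ⟨ f , b ⟩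
  r = (1/ q) {{≢-nonZero p}}
  φ = ⟨ f , comb cs bs ⟩

Independent : ∀ {d} → Vec (V n) d → Set
Independent bs = ∀ c → comb c bs ≡ 0ᵥ → c ≡ replicate _ 0ℚ

cut-independent : ∀ {d} (f : V n) (bs : Vec (V n) d) → Independent bs → Independent (proj₂ (cut f bs))
cut-independent f []       ind []       _  = refl
cut-independent f (b ∷ bs) ind cs       eq with ⟨ f , b ⟩ ℚₚ.≟ 0ℚ
cut-independent f (b ∷ bs) ind (c ∷ cs) eq | yes _ =
  cong₂ _∷_ c≡0 (cut-independent f bs ind′ cs (trans (sym eq′) comb≡0))
  where
  ind′ : Independent bs
  ind′ c eq = Vecₚ.∷-injectiveʳ (ind (0ℚ ∷ c) (trans (cong (0ℚ · b +ᵥ_) eq) (0·+0 0ℚ b refl)))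
  cs′ : Vec ℚ _
  cs′ = proj₁ (cut-⊆ f bs cs)
  eq′ : comb cs′ bs ≡ comb cs (proj₂ (cut f bs))
  eq′ = proj₂ (cut-⊆ f bs cs)
  all≡0 : c ∷ cs′ ≡ replicate _ 0ℚ
  all≡0 = ind (c ∷ cs′) (trans (cong (c · b +ᵥ_) eq′) eq)
  c≡0 : c ≡ 0ℚ
  c≡0 = Vecₚ.∷-injectiveˡ all≡0
  comb≡0 : comb cs′ bs ≡ 0ᵥ
  comb≡0 = trans (cong (λ c → comb c bs) (Vecₚ.∷-injectiveʳ all≡0)) (comb-0 bs)
cut-independent f (b ∷ bs) ind cs       eq | no p =
  let r = (1/ ⟨ f , b ⟩) {{≢-nonZero p}}
  in Vecₚ.∷-injectiveʳ (ind (- (⟨ f , comb cs bs ⟩ * r) ∷ cs) (trans (sym (comb-eliminate f b r cs bs)) eq))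

comb-tabulate : ∀ {d} (g : Fin d → V n) cs → comb cs (tabulate λ i → 0ℚ ∷ g i) ≡ 0ℚ ∷ comb cs (tabulate g)
comb-tabulate g []       = refl
comb-tabulate g (c ∷ cs) = trans (cong (c · (0ℚ ∷ g zero) +ᵥ_) (comb-tabulate (λ i → g (suc i)) cs))
  (cong (_∷ comb (c ∷ cs) (tabulate g)) (trans (ℚₚ.+-identityʳ (c * 0ℚ)) (ℚₚ.*-zeroʳ c)))

comb-e : (c : V n) → comb c (tabulate e) ≡ c
comb-e []       = refl
comb-e (c ∷ cs) = trans (cong (c · e zero +ᵥ_) (trans (comb-tabulate e cs) (cong (0ℚ ∷_) (comb-e cs))))
  (cong₂ _∷_ (solve 1 (λ c → c :* con 1ℚ :+ con 0ℚ := c) refl c) (c0+ cs))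
  where
  c0+ : ∀ {m} (v : V m) → c · 0ᵥ +ᵥ v ≡ v
  c0+ []      = refl
  c0+ (x ∷ v) = cong₂ _∷_ (solve 2 (λ c x → c :* con 0ℚ :+ x := x) refl c x) (c0+ v)

basis : (U : Subspace n) → Basis U
basis []      = record
  { vectors     = tabulate e
  ; lies-in     = λ _ → []
  ; spanning    = λ v _ → v , comb-e v
  ; independent = λ c eq → trans (sym (comb-e c)) eq
  }
basis (f ∷ U) = record
  { vectors     = proj₂ (cut f vectors)
  ; lies-in     = λ c → let c′ , eq = cut-⊆ f vectors c in
                  cut-killed f vectors c ∷ subst (_∈ₛ U) eq (lies-in c′)
  ; spanning    = λ { v (fv ∷ v∈U) → let c , eq = spanning v v∈U
                                         c′ , eq′ = cut-⊇ f vectors c (trans (cong ⟨ f ,_⟩ eq) fv)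
                                     in c′ , trans eq′ eq }
  ; independent = cut-independent f vectors independent
  }
  where open Basis (basis U)

dim : Subspace n → ℕ
dim U = Basis.size (basis U)

_⊆ₛ_ : Subspace n → Subspace n → Set
U ⊆ₛ U′ = ∀ v → v ∈ₛ U → v ∈ₛ U′

_⊆ₛ?_ : (U U′ : Subspace n) → Dec (U ⊆ₛ U′)
U ⊆ₛ? U′ = map′ to from (Finₚ.all? λ i → lookup vectors i ∈ₛ? U′)
  where
  open Basis (basis U)

  comb-∈ : ∀ {d} (c : Vec ℚ d) bs → (∀ i → lookup bs i ∈ₛ U′) → comb c bs ∈ₛ U′
  comb-∈ []       []       _  = All.universal ⟨⟩-0 U′
  comb-∈ (c ∷ cs) (b ∷ bs) bs∈ = All.zipWith
    (λ {f} (p , q) → trans (⟨⟩-comb f b c cs bs) (cong₂ _+_ (0c c _ p) q))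
    (bs∈ zero , comb-∈ cs bs (λ i → bs∈ (suc i)))

  to : (∀ i → lookup vectors i ∈ₛ U′) → U ⊆ₛ U′
  to vs∈ v v∈U = let c , eq = spanning v v∈U in subst (_∈ₛ U′) eq (comb-∈ c vectors vs∈)

  unit : ∀ {d} (bs : Vec (V _) d) i → ∃ λ c → comb c bs ≡ lookup bs i
  unit (b ∷ bs) zero    = 1ℚ ∷ replicate _ 0ℚ ,
    trans (cong (1ℚ · b +ᵥ_) (comb-0 bs)) (1·+0 b)
    where
    1·+0 : ∀ {m} (v : V m) → 1ℚ · v +ᵥ 0ᵥ ≡ v
    1·+0 []      = refl
    1·+0 (x ∷ v) = cong₂ _∷_ (solve 1 (λ x → con 1ℚ :* x :+ con 0ℚ := x) refl x) (1·+0 v)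
  unit (b ∷ bs) (suc i) = let c , eq = unit bs i in 0ℚ ∷ c , trans (cong (0ℚ · b +ᵥ_) eq) (0·+ b _)
    where
    0·+ : ∀ {m} (u v : V m) → 0ℚ · u +ᵥ v ≡ v
    0·+ []      []      = refl
    0·+ (x ∷ u) (y ∷ v) = cong₂ _∷_ (solve 2 (λ x y → con 0ℚ :* x :+ y := y) refl x y) (0·+ u v)

  from : U ⊆ₛ U′ → ∀ i → lookup vectors i ∈ₛ U′
  from U⊆U′ i = let c , eq = unit vectors i in subst (_∈ₛ U′) eq (U⊆U′ _ (lies-in c))

_≐_ : Subspace n → Subspace n → Set
U ≐ U′ = U ⊆ₛ U′ × U′ ⊆ₛ U

_≐?_ : (U U′ : Subspace n) → Dec (U ≐ U′)
U ≐? U′ = (U ⊆ₛ? U′) ×-dec (U′ ⊆ₛ? U)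

-- A list of roots is the system of equations of the intersection of the
-- corresponding hyperplanes; the empty list is V.
L : ∀ n → List (Subspace n)
L n = deduplicate _≐?_ (sublists (Φ⁺ n))

module Lattice (n : ℕ) where

  Flat : Set
  Flat = Fin (length (L n))

  space : Flat → Subspace n
  space = List.lookup (L n)

  infix 4 _≤ₗ_ _≺_

  _≤ₗ_ : Subspace n → Subspace n → Set
  X ≤ₗ X′ = X′ ⊆ₛ X

  _≤ₗ?_ : (X X′ : Subspace n) → Dec (X ≤ₗ X′)
  X ≤ₗ? X′ = X′ ⊆ₛ? X

  _≺_ : Flat → Flat → Set
  z ≺ y = space z ≤ₗ space y × ¬ (space y ≤ₗ space z)

  _≺?_ : (z y : Flat) → Dec (z ≺ y)
  z ≺? y = (space z ≤ₗ? space y) ×-dec ¬? (space y ≤ₗ? space z)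

  ≺-wellFounded : WellFounded _≺_
  ≺-wellFounded = spo-wellFounded record
    { isEquivalence = isEquivalence
    ; irrefl        = λ { refl (p , ¬p) → ¬p p }
    ; trans         = λ (p , ¬p) (q , ¬q) → (λ v → p v ∘ q v) , λ r → ¬q (λ v → r v ∘ p v)
    ; <-resp-≈      = (λ { refl p → p }) , (λ { refl p → p })
    }

  möbius-term : (X : Subspace n) {z y : Flat} → (z ≺ y → ℚ) → Dec (X ≤ₗ space z × z ≺ y) → ℚ
  möbius-term X m (yes (_ , z≺y)) = m z≺y
  möbius-term X m (no _)          = 0ℚ

  möbius-step : (X : Subspace n) (y : Flat) → (∀ {z} → z ≺ y → ℚ) → ℚ
  möbius-step X y m = [ X ≐? space y ]?
    - (∑[ z ∈ allFin _ ] möbius-term X {z} m ((X ≤ₗ? space z) ×-dec (z ≺? y)))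

  möbius : Subspace n → Flat → ℚ
  möbius X = All.wfRec ≺-wellFounded 0ℓ (λ _ → ℚ) (möbius-step X)

  -- X need only be equal as a subspace (_≐_) to a member of L n.
  χ : Subspace n → ℚ → ℚ
  χ X x = ∑[ y ∈ filter (λ y → X ≤ₗ? space y) (allFin _) ] möbius X y * x ^ dim (space y)

IsReflection : V n → W n → Set
IsReflection α s = ∀ j → act s (e j) ≡ reflect α (e j)

isReflection? : (α : V n) → Decidable (IsReflection α)
isReflection? α s = Finₚ.all? λ j → act s (e j) ≟ᵥ reflect α (e j)

infix 4 _∈W⟨_⟩

data _∈W⟨_⟩ {n : ℕ} : W n → Subset n → Set where
  ε∈ : ∀ {K} → ε ∈W⟨ K ⟩
  s∙ : ∀ {K i s u} → i Subset.∈ K → IsReflection (simple i) s → u ∈W⟨ K ⟩ → s ∙ u ∈W⟨ K ⟩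

module Counting {A : Set} {P Q : Pred A 0ℓ} (P? : Decidable P) (Q? : Decidable Q)
                (P⊆Q : ∀ {a} → P a → Q a) where

  count-≤ : ∀ as → count P? as ℕ.≤ count Q? as
  count-≤ []       = ℕ.z≤n
  count-≤ (a ∷ as) with P? a | Q? a
  ... | yes _ | yes _ = ℕ.s≤s (count-≤ as)
  ... | yes p | no ¬q = contradiction (P⊆Q p) ¬q
  ... | no _  | yes _ = ℕₚ.m≤n⇒m≤1+n (count-≤ as)
  ... | no _  | no _  = count-≤ as

  count-< : ∀ {a as} → a ∈ as → Q a → ¬ P a → count P? as ℕ.< count Q? as
  count-< {a} {_ ∷ as} (here refl) q ¬p with P? a | Q? a
  ... | yes p | _     = contradiction p ¬p
  ... | no _  | yes _ = ℕ.s≤s (count-≤ as)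
  ... | no _  | no ¬q = contradiction q ¬q
  count-< {a} {b ∷ as} (there a∈) q ¬p with P? b | Q? b
  ... | yes _ | yes _ = ℕ.s≤s (count-< a∈ q ¬p)
  ... | yes p | no ¬q = contradiction (P⊆Q p) ¬q
  ... | no _  | yes _ = ℕₚ.m≤n⇒m≤1+n (count-< a∈ q ¬p)
  ... | no _  | no _  = count-< a∈ q ¬p

-- Reachability in a finite graph is decidable: the sets of vertices reachable
-- from a₀ in at most m steps grow strictly until they stabilise.
module Reachability {A : Set} (as : List A) (∈-as : ∀ a → a ∈ as) (_≟_ : DecidableEquality A)
                    {R : A → A → Set} (R? : ∀ a b → Dec (R a b)) (a₀ : A) where

  Within : ℕ → Pred A 0ℓ
  Within zero    b = b ≡ a₀
  Within (suc m) b = Within m b ⊎ ∃ λ a → Within m a × R a b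

  within? : ∀ m → Decidable (Within m)
  within? zero    b = b ≟ a₀
  within? (suc m) b = within? m b ⊎-dec
    map′ (λ any → let a , _ , p = find any in a , p) (λ (a , p) → lose (∈-as a) p)
         (Any.any? (λ a → within? m a ×-dec R? a b) as)

  Stable : ℕ → Set
  Stable m = ∀ b → Within (suc m) b → Within m b

  grow : ∀ m → Stable m ⊎ m ℕ.≤ count (within? m) as
  grow zero    = inj₂ ℕ.z≤n
  grow (suc m) with All.all? (λ b → within? (suc m) b →-dec within? m b) as
  ... | yes stable = inj₁ λ
    { b (inj₁ p)           → p
    ; b (inj₂ (a , p , r)) → inj₂ (a , All.lookup stable (∈-as a) p , r) }
  ... | no ¬stable with grow m
  ...   | inj₁ stable = contradiction (All.tabulate λ {b} _ → stable b) ¬stable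
  ...   | inj₂ m≤     with find (Allₚ.¬All⇒Any¬ (λ b → within? (suc m) b →-dec within? m b) as ¬stable)
  ...     | b , b∈ , ¬imp with within? (suc m) b
  ...       | yes q = inj₂ (ℕₚ.≤-trans (ℕ.s≤s m≤)
                (Counting.count-< (within? m) (within? (suc m)) inj₁ b∈ q λ p → ¬imp λ _ → p))
  ...       | no ¬q = contradiction (λ q → contradiction q ¬q) ¬imp

  bound : ℕ
  bound = suc (length as)

  stable : Stable bound
  stable with grow bound
  ... | inj₁ s = s
  ... | inj₂ m≤ = contradiction (ℕₚ.≤-trans m≤ (Listₚ.length-filter (within? bound) as)) ℕₚ.1+n≰n

  start : ∀ m → Within m a₀
  start zero    = refl
  start (suc m) = inj₁ (start m)

_∈W⟨_⟩? : (w : W n) (K : Subset n) → Dec (w ∈W⟨ K ⟩)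
_∈W⟨_⟩? {n} w K = map′ (from bound) to (within? bound w)
  where
  Edge : W n → W n → Set
  Edge u v = ∃ λ s → (∃ λ i → i Subset.∈ K × IsReflection (simple i) s) × v ≡ s ∙ u

  edge? : ∀ u v → Dec (Edge u v)
  edge? u v = ∃W? λ s →
    Finₚ.any? (λ i → (i Subsetₚ.∈? K) ×-dec isReflection? (simple i) s) ×-dec (v ≟w (s ∙ u))

  open Reachability (elements n) ∈-elements _≟w_ edge? ε

  from : ∀ m {v} → Within m v → v ∈W⟨ K ⟩
  from zero    refl                                           = ε∈
  from (suc m) (inj₁ p)                                       = from m p
  from (suc m) (inj₂ (_ , p , s , (_ , i∈K , refl-s) , refl)) = s∙ {s = s} i∈K refl-s (from m p)

  to : ∀ {v} → v ∈W⟨ K ⟩ → Within bound v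
  to ε∈                        = start bound
  to (s∙ {s = s} i∈K refl-s p) = stable _ (inj₂ (_ , to p , s , (_ , i∈K , refl-s) , refl))

parabolic : Subset n → List (W n)
parabolic K = filter _∈W⟨ K ⟩? (elements _)

-- The i-th row of the equation act u v = v.
fixedRow : W n → Fin n → V n
fixedRow u i = Vec.map (signed (lookup (sign u) i)) (e (lookup (perm u) i)) -ᵥ e i

Fix : Subset n → Subspace n
Fix {n} K = concatMap (λ u → List.map (fixedRow u) (allFin n)) (parabolic K)

-- w u w⁻¹ = v, written as v w = w u.
Normalises : Subset n → W n → Set
Normalises K w = ∀ u v → v ∙ w ≡ w ∙ u → (u ∈W⟨ K ⟩ → v ∈W⟨ K ⟩) × (v ∈W⟨ K ⟩ → u ∈W⟨ K ⟩)

normalises? : (K : Subset n) → Decidable (Normalises K)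
normalises? K w = ∀W? λ u → ∀W? λ v → ((v ∙ w) ≟w (w ∙ u)) →-dec
  ((u ∈W⟨ K ⟩? →-dec v ∈W⟨ K ⟩?) ×-dec (v ∈W⟨ K ⟩? →-dec u ∈W⟨ K ⟩?))

normaliser : Subset n → List (W n)
normaliser K = filter (normalises? K) (elements _)

H : ℚ → W n → ℚ
H {n} x w = ∑[ K ∈ filter (_⊆? ∁ (Des w)) (subsets n) ]
     (fromℕ (length (parabolic K)) * Lattice.χ n (Fix K) x)
  ÷₀ (x ^ n * fromℕ (length (normaliser K)) * fromℕ (length (λ-class K)))

⟨e,⟩ : (i : Fin n) (v : V n) → ⟨ e i , v ⟩ ≡ lookup v i
⟨e,⟩ zero    (x ∷ v) = trans (cong (1ℚ * x +_) (⟨0,⟩ v)) (trans (ℚₚ.+-identityʳ _) (ℚₚ.*-identityˡ x))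
  where
  ⟨0,⟩ : ∀ {m} (v : V m) → ⟨ 0ᵥ , v ⟩ ≡ 0ℚ
  ⟨0,⟩ []      = refl
  ⟨0,⟩ (x ∷ v) = cong₂ _+_ (ℚₚ.*-zeroˡ x) (⟨0,⟩ v)
⟨e,⟩ (suc i) (x ∷ v) = trans (cong (_+ ⟨ e i , v ⟩) (ℚₚ.*-zeroˡ x)) (trans (ℚₚ.+-identityˡ _) (⟨e,⟩ i v))

⟨-⟩ˡ : (f g v : V n) → ⟨ f -ᵥ g , v ⟩ ≡ ⟨ f , v ⟩ - ⟨ g , v ⟩
⟨-⟩ˡ []      []      []      = refl
⟨-⟩ˡ (x ∷ f) (y ∷ g) (z ∷ v) = trans (cong ((x - y) * z +_) (⟨-⟩ˡ f g v))
  (solve 5 (λ x y z p q → (x :- y) :* z :+ (p :- q) := (x :* z :+ p) :- (y :* z :+ q))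
    refl x y z ⟨ f , v ⟩ ⟨ g , v ⟩)

⟨signed⟩ˡ : (s : Sign) (f v : V n) → ⟨ Vec.map (signed s) f , v ⟩ ≡ signed s ⟨ f , v ⟩
⟨signed⟩ˡ Sign.+ f v = cong ⟨_, v ⟩ (Vecₚ.map-id f)
⟨signed⟩ˡ Sign.- []      []      = refl
⟨signed⟩ˡ Sign.- (x ∷ f) (y ∷ v) = trans (cong (- x * y +_) (⟨signed⟩ˡ Sign.- f v))
  (solve 3 (λ x y p → (:- x) :* y :+ (:- p) := :- (x :* y :+ p)) refl x y ⟨ f , v ⟩)

⟨fixedRow,⟩ : (u : W n) (i : Fin n) (v : V n) → ⟨ fixedRow u i , v ⟩ ≡ lookup (act u v) i - lookup v i
⟨fixedRow,⟩ u i v = trans (⟨-⟩ˡ (Vec.map (signed (lookup (sign u) i)) (e (lookup (perm u) i))) (e i) v) (cong₂ _-_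
  (trans (⟨signed⟩ˡ (lookup (sign u) i) (e (lookup (perm u) i)) v)
    (trans (cong (signed (lookup (sign u) i)) (⟨e,⟩ (lookup (perm u) i) v)) (sym (Vecₚ.lookup∘tabulate _ i))))
  (⟨e,⟩ i v))

lookup-ext : {u v : Vec A n} → (∀ i → lookup u i ≡ lookup v i) → u ≡ v
lookup-ext {u = u} {v} eq =
  trans (sym (Vecₚ.tabulate∘lookup u)) (trans (Vecₚ.tabulate-cong eq) (Vecₚ.tabulate∘lookup v))

p-q≡0⇒p≡q : ∀ p q → p - q ≡ 0ℚ → p ≡ q
p-q≡0⇒p≡q p q eq = trans (solve 2 (λ p q → p := (p :- q) :+ q) refl p q)
  (trans (cong (_+ q) eq) (ℚₚ.+-identityˡ q))

∈-Fix : (K : Subset n) (v : V n) → v ∈ₛ Fix K ⇔ (∀ u → u ∈W⟨ K ⟩ → act u v ≡ v)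
∈-Fix {n} K v = mk⇔ to from
  where
  to : v ∈ₛ Fix K → ∀ u → u ∈W⟨ K ⟩ → act u v ≡ v
  to v∈ u u∈ = lookup-ext λ i → p-q≡0⇒p≡q _ _ (trans (sym (⟨fixedRow,⟩ u i v))
    (All.lookup v∈ (∈-concatMap⁺ _ (lose (∈-filter⁺ _∈W⟨ K ⟩? (∈-elements u) u∈)
      (∈-map⁺ (fixedRow u) (∈-allFin i))))))

  from : (∀ u → u ∈W⟨ K ⟩ → act u v ≡ v) → v ∈ₛ Fix K
  from fix = All.tabulate λ f∈ →
    let u , u∈ , f∈u = find (∈-concatMap⁻ (λ u → List.map (fixedRow u) (allFin n)) f∈)
        i , _ , f≡   = ∈-map⁻ (fixedRow u) f∈u
        _ , u∈K      = ∈-filter⁻ _∈W⟨ K ⟩? {xs = elements n} u∈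
    in trans (cong ⟨_, v ⟩ f≡) (trans (⟨fixedRow,⟩ u i v)
         (trans (cong (λ w → lookup w i - lookup v i) (fix u u∈K)) (ℚₚ.+-inverseʳ (lookup v i))))

∑-cong : (as : List A) {f g : A → ℚ} → (∀ a → f a ≡ g a) → ∑ as f ≡ ∑ as g
∑-cong []       eq = refl
∑-cong (a ∷ as) eq = cong₂ _+_ (eq a) (∑-cong as eq)

module _ (n : ℕ) where
  open Lattice n

  -- μ(X,X) = 1 and μ(X,Y) = - Σ_{X ≤ Z < Y} μ(X,Z) for X < Y.
  möbius-rec : ∀ X y → möbius X y ≡ [ X ≐? space y ]?
    - (∑[ z ∈ allFin _ ] möbius-term X {z} (λ _ → möbius X z) ((X ≤ₗ? space z) ×-dec (z ≺? y)))
  möbius-rec X y = FixPoint.unfold-wfRec ≺-wellFounded (λ _ → ℚ) (möbius-step X) ext {y}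
    where
    ext : ∀ y {m m′ : ∀ {z} → z ≺ y → ℚ} → (∀ {z} (z≺y : z ≺ y) → m z≺y ≡ m′ z≺y) →
          möbius-step X y m ≡ möbius-step X y m′
    ext y {m} {m′} eq = cong (λ s → [ X ≐? space y ]? - s) (∑-cong (allFin _)
        λ z → term z ((X ≤ₗ? space z) ×-dec (z ≺? y)))
      where
      term : ∀ z (p? : Dec (X ≤ₗ space z × z ≺ y)) → möbius-term X {z} m p? ≡ möbius-term X {z} m′ p?
      term z (yes (_ , z≺y)) = eq z≺y
      term z (no _)          = refl

-- The sign of the first nonzero coordinate separates Φ⁺ from - Φ⁺.
data LexPos : V n → Set where
  head : ∀ {x} {v : V n} → 0ℚ < x → LexPos (x ∷ v)
  tail : ∀ {x} {v : V n} → x ≡ 0ℚ → LexPos v → LexPos (x ∷ v)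

0<1 : 0ℚ < 1ℚ
0<1 = ℚₚ.positive⁻¹ 1ℚ

0<2 : 0ℚ < 2ℚ
0<2 = ℚₚ.positive⁻¹ 2ℚ

lexPos-neg : {v : V n} → LexPos v → ¬ LexPos (-ᵥ v)
lexPos-neg (head 0<x)     (head 0<-x)   = ℚₚ.<-asym 0<-x (ℚₚ.neg-antimono-< 0<x)
lexPos-neg (head 0<x)     (tail -x≡0 _) = ℚₚ.<⇒≢ 0<x (sym (ℚₚ.neg-injective -x≡0))
lexPos-neg (tail refl _)  (head 0<0)    = ℚₚ.<-irrefl refl 0<0
lexPos-neg (tail _ p)     (tail _ q)    = lexPos-neg p q

data PositiveRoot {n : ℕ} : V n → Set where
  long  : ∀ i → PositiveRoot (2ℚ · e i)
  minus : ∀ {i j} → i Fin.< j → PositiveRoot (e i -ᵥ e j)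
  plus  : ∀ {i j} → i Fin.< j → PositiveRoot (e i +ᵥ e j)

Φ⁺-cases : {v : V n} → v ∈ Φ⁺ n → PositiveRoot v
Φ⁺-cases {n} v∈ = [ longCase , shortCase ]′ (∈-++⁻ (List.map (λ i → 2ℚ · e i) (allFin n)) v∈)
  where
  longCase : ∀ {v} → v ∈ List.map (λ i → 2ℚ · e i) (allFin n) → PositiveRoot v
  longCase v∈ with i , _ , refl ← ∈-map⁻ (λ i → 2ℚ · e i) v∈ = long i

  shortCase : ∀ {v} → v ∈ concatMap (λ (i , j) → e i -ᵥ e j ∷ e i +ᵥ e j ∷ [])
                (filter (λ (i , j) → i Finₚ.<? j) (cartesianProduct (allFin n) (allFin n))) →
              PositiveRoot v
  shortCase v∈ with (i , j) , ij∈ , v∈ij ← find (∈-concatMap⁻ (λ (i , j) → e i -ᵥ e j ∷ e i +ᵥ e j ∷ [])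
                               {xs = filter (λ (i , j) → i Finₚ.<? j)
                                 (cartesianProduct (allFin n) (allFin n))} v∈)
    with ∈-filter⁻ (λ (i , j) → i Finₚ.<? j) {xs = cartesianProduct (allFin n) (allFin n)} ij∈ | v∈ij
  ... | _ , i<j | here refl         = minus i<j
  ... | _ , i<j | there (here refl) = plus i<j

Φ⁺-long : (i : Fin n) → 2ℚ · e i ∈ Φ⁺ n
Φ⁺-long i = ∈-++⁺ˡ (∈-map⁺ (λ i → 2ℚ · e i) (∈-allFin i))

lexPos-long : (i : Fin n) → LexPos (2ℚ · e i)
lexPos-long zero    = head 0<2
lexPos-long (suc i) = tail refl (lexPos-long i)

lexPos-minus : (i j : Fin n) → i Fin.< j → LexPos (e i -ᵥ e j)
lexPos-minus zero    (suc j) _           = head 0<1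
lexPos-minus (suc i) (suc j) (ℕ.s≤s i<j) = tail refl (lexPos-minus i j i<j)

lexPos-plus : (i j : Fin n) → i Fin.< j → LexPos (e i +ᵥ e j)
lexPos-plus zero    (suc j) _           = head 0<1
lexPos-plus (suc i) (suc j) (ℕ.s≤s i<j) = tail refl (lexPos-plus i j i<j)

lexPos-Φ⁺ : {v : V n} → PositiveRoot v → LexPos v
lexPos-Φ⁺ (long i)    = lexPos-long i
lexPos-Φ⁺ (minus i<j) = lexPos-minus _ _ i<j
lexPos-Φ⁺ (plus i<j)  = lexPos-plus _ _ i<j

lexPos-simple : (i : Fin n) → LexPos (simple i)
lexPos-simple {suc zero}    zero    = head 0<2
lexPos-simple {suc (suc n)} zero    = head 0<1
lexPos-simple {suc (suc n)} (suc i) = tail refl (lexPos-simple i)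

ε∈X : (J : Subset n) → ε ∈X J
ε∈X J (i , i∈) = go (negative? (act ε (simple i))) refl
  where
  i∈Des : lookup (Des ε) i ≡ inside
  i∈Des = Vecₚ.[]=⇒lookup (proj₁ (Subsetₚ.x∈p∩q⁻ (Des ε) J i∈))
  go : (d : Dec (Negative (act ε (simple i)))) → d ≡ negative? (act ε (simple i)) → _
  go (yes neg) _ = lexPos-neg (lexPos-simple i)
    (lexPos-Φ⁺ (Φ⁺-cases (subst Negative (act-ε (simple i)) neg)))
  go (no _) eq with trans (cong does eq) (trans (sym (Vecₚ.lookup∘tabulate _ i)) i∈Des)
  ... | ()

ε-intoΠ : (K : Subset n) → IntoΠ K ε
ε-intoΠ K i _ = i , act-ε (simple i)

∼-refl : (J : Subset n) → J ∼ J
∼-refl J = ε , (λ i i∈ → i , i∈ , act-ε (simple i)) , (λ j j∈ → j , j∈ , act-ε (simple j))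

fromℕ-length≢0 : {x : A} {xs : List A} → x ∈ xs → fromℕ (length xs) ≢ 0ℚ
fromℕ-length≢0 {xs = x ∷ xs} _ eq =
  ℚₚ.<⇒≢ (ℚₚ.positive⁻¹ _ {{ℚₚ.normalize-pos (suc (length xs)) 1}}) (sym eq)

÷₀-* : ∀ p q → q ≢ 0ℚ → q * (p ÷₀ q) ≡ p
÷₀-* p q q≢0 with q ℚₚ.≟ 0ℚ
... | yes q≡0 = contradiction q≡0 q≢0
... | no ≢0   = trans (solve 3 (λ p q r → q :* (p :* r) := p :* (q :* r)) refl p q _)
                  (trans (cong (p *_) (inverse q ≢0)) (ℚₚ.*-identityʳ p))

μ-diagonal≢0 : (J : Subset n) → μ J J ≢ 0ℚ
μ-diagonal≢0 {n} J with J ⊆? J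
... | no ¬J⊆J = contradiction (λ {x} (p : x Subset.∈ J) → p) ¬J⊆J
... | yes _ = λ eq → fromℕ-length≢0
  (∈-filter⁺ (λ w → (w ∈X? J) ×-dec intoΠ? J w) (∈-elements ε) (ε∈X J , ε-intoΠ J))
  (begin
    N                 ≡⟨ ÷₀-* N D (fromℕ-length≢0 (∈-filter⁺ (J ∼?_) (∈-subsets J) (∼-refl J))) ⟨
    D * (N ÷₀ D)      ≡⟨ cong (D *_) eq ⟩
    D * 0ℚ            ≡⟨ ℚₚ.*-zeroʳ D ⟩
    0ℚ                ∎)
  where
  open ≡-Reasoning
  N D : ℚ
  N = fromℕ (count (λ w → (w ∈X? J) ×-dec intoΠ? J w) (elements n))
  D = fromℕ (length (λ-class J))

μ-⊈ : (J K : Subset n) → ¬ (K ⊆ J) → μ J K ≡ 0ℚ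
μ-⊈ J K K⊈J with K ⊆? J
... | yes K⊆J = contradiction (λ {x} → K⊆J {x}) K⊈J
... | no _    = refl

unique-allVec : {as : List A} → Unique as → ∀ n → Unique (allVec as n)
unique-allVec u zero    = [] ∷ []
unique-allVec u (suc n) = Uniqueₚ.cartesianProductWith⁺ _∷_ Vecₚ.∷-injective u (unique-allVec u n)

unique-subsets : Unique (subsets n)
unique-subsets = unique-allVec (((λ ()) ∷ []) ∷ [] ∷ []) _

∑-+ : (as : List A) (f g : A → ℚ) → ∑ as (λ a → f a + g a) ≡ ∑ as f + ∑ as g
∑-+ []       f g = refl
∑-+ (a ∷ as) f g = trans (cong (f a + g a +_) (∑-+ as f g))
  (solve 4 (λ x y p q → (x :+ y) :+ (p :+ q) := (x :+ p) :+ (y :+ q)) refl (f a) (g a) (∑ as f) (∑ as g))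

∑-zero : (as : List A) (f : A → ℚ) → (∀ {a} → a ∈ as → f a ≡ 0ℚ) → ∑ as f ≡ 0ℚ
∑-zero []       f eq = refl
∑-zero (a ∷ as) f eq = cong₂ _+_ (eq (here refl)) (∑-zero as f (λ a∈ → eq (there a∈)))

∑-single : {as : List A} {b : A} (f : A → ℚ) → Unique as → b ∈ as →
           (∀ a → a ≢ b → f a ≡ 0ℚ) → ∑ as f ≡ f b
∑-single {as = _ ∷ as} f (b∉ ∷ _) (here refl) eq =
  trans (cong (f _ +_) (∑-zero as f λ a∈ → eq _ λ { refl → All.lookup b∉ a∈ refl })) (ℚₚ.+-identityʳ _)
∑-single {as = a ∷ as} f (a∉ ∷ u) (there b∈) eq =
  trans (cong₂ _+_ (eq a λ { refl → All.lookup a∉ b∈ refl }) (∑-single f u b∈ eq)) (ℚₚ.+-identityˡ _)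

β-rec : (J K : Subset n) → β J K ≡ β-step K J (λ {L} _ → β L K)
β-rec {n} J K = FixPoint.unfold-wfRec ⊂-wellFounded (λ _ → ℚ) (β-step K) ext {J}
  where
  ext : ∀ J {r r′ : ∀ {L} → L ⊂ J → ℚ} → (∀ {L} (L⊂J : L ⊂ J) → r L⊂J ≡ r′ L⊂J) →
        β-step K J r ≡ β-step K J r′
  ext J {r} {r′} eq =
    cong (λ s → ([ Vecₚ.≡-dec Bool._≟_ J K ]? - s) ÷₀ μ J J)
         (∑-cong (subsets n) λ L → term L (L ⊂? J))
    where
    term : ∀ L (p? : Dec (L ⊂ J)) → β-term J L r p? ≡ β-term J L r′ p?
    term L (yes L⊂J) = cong (μ J L *_) (eq L⊂J)
    term L (no _)    = refl

μ-β : (J K : Subset n) → (∑[ L ∈ subsets n ] μ J L * β L K) ≡ [ Vecₚ.≡-dec Bool._≟_ J K ]?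
μ-β {n} J K = begin
  ∑ (subsets n) f                        ≡⟨ ∑-cong (subsets n) (λ L → split L (L ⊂? J) (L ≟ J)) ⟩
  ∑ (subsets n) (λ L → g L + h L (L ≟ J)) ≡⟨ ∑-+ (subsets n) g (λ L → h L (L ≟ J)) ⟩
  ∑ (subsets n) g + ∑ (subsets n) (λ L → h L (L ≟ J))
    ≡⟨ cong (∑ (subsets n) g +_) (trans (∑-single _ unique-subsets (∈-subsets J) (λ L → h≢ L (L ≟ J))) (h≡ (J ≟ J))) ⟩
  ∑ (subsets n) g + μ J J * β J K
    ≡⟨ cong (∑ (subsets n) g +_) (trans (cong (μ J J *_) (β-rec J K)) (÷₀-* _ (μ J J) (μ-diagonal≢0 J))) ⟩
  ∑ (subsets n) g + (δ - ∑ (subsets n) g) ≡⟨ solve 2 (λ s d → s :+ (d :- s) := d) refl (∑ (subsets n) g) δ ⟩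
  δ ∎
  where
  open ≡-Reasoning
  _≟_ : DecidableEquality (Subset n)
  _≟_ = Vecₚ.≡-dec Bool._≟_
  δ : ℚ
  δ = [ J ≟ K ]?
  f g : Subset n → ℚ
  f L = μ J L * β L K
  g L = β-term J L (λ _ → β L K) (L ⊂? J)
  h : ∀ L → Dec (L ≡ J) → ℚ
  h L (yes _) = f L
  h L (no _)  = 0ℚ
  h≡ : (d : Dec (J ≡ J)) → h J d ≡ f J
  h≡ (yes _) = refl
  h≡ (no ¬p) = contradiction refl ¬p
  h≢ : ∀ L (d : Dec (L ≡ J)) → L ≢ J → h L d ≡ 0ℚ
  h≢ L (yes p) ¬p = contradiction p ¬p
  h≢ L (no _)  _  = refl
  split : ∀ L (p? : Dec (L ⊂ J)) (d : Dec (L ≡ J)) → f L ≡ β-term J L (λ _ → β L K) p? + h L d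
  split L (yes (_ , x , x∈J , x∉L)) (yes refl) = contradiction x∈J x∉L
  split L (yes _)                   (no _)     = sym (ℚₚ.+-identityʳ (f L))
  split L (no _)                    (yes _)    = sym (ℚₚ.+-identityˡ (f L))
  split L (no L⊄J)                  (no L≢J)   =
    trans (cong (_* β L K) (μ-⊈ J L λ L⊆J → L≢J (Subsetₚ.⊆-antisym L⊆J (J⊆L L⊆J)))) (ℚₚ.*-zeroˡ (β L K))
    where
    J⊆L : L ⊆ J → J ⊆ L
    J⊆L L⊆J {x} x∈J with x Subsetₚ.∈? L
    ... | yes x∈L = x∈L
    ... | no x∉L  = contradiction ((λ {y} → L⊆J {y}) , x , x∈J , x∉L) L⊄J

lookup-e-≡ : (i : Fin n) → lookup (e i) i ≡ 1ℚ
lookup-e-≡ zero    = refl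
lookup-e-≡ (suc i) = lookup-e-≡ i

lookup-e-≢ : (i j : Fin n) → i ≢ j → lookup (e i) j ≡ 0ℚ
lookup-e-≢ zero    zero    i≢j = contradiction refl i≢j
lookup-e-≢ zero    (suc j) _   = Vecₚ.lookup-replicate j 0ℚ
lookup-e-≢ (suc i) zero    _   = refl
lookup-e-≢ (suc i) (suc j) i≢j = lookup-e-≢ i j (i≢j ∘ cong suc)

⟨+⟩ˡ : (f g v : V n) → ⟨ f +ᵥ g , v ⟩ ≡ ⟨ f , v ⟩ + ⟨ g , v ⟩
⟨+⟩ˡ []      []      []      = refl
⟨+⟩ˡ (x ∷ f) (y ∷ g) (z ∷ v) = trans (cong ((x + y) * z +_) (⟨+⟩ˡ f g v))
  (solve 5 (λ x y z p q → (x :+ y) :* z :+ (p :+ q) := (x :* z :+ p) :+ (y :* z :+ q))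
    refl x y z ⟨ f , v ⟩ ⟨ g , v ⟩)

⟨·⟩ˡ : (c : ℚ) (f v : V n) → ⟨ c · f , v ⟩ ≡ c * ⟨ f , v ⟩
⟨·⟩ˡ c []      []      = sym (ℚₚ.*-zeroʳ c)
⟨·⟩ˡ c (x ∷ f) (y ∷ v) = trans (cong (c * x * y +_) (⟨·⟩ˡ c f v))
  (solve 4 (λ c x y p → c :* x :* y :+ c :* p := c :* (x :* y :+ p)) refl c x y ⟨ f , v ⟩)

1· : (v : V n) → 1ℚ · v ≡ v
1· []      = refl
1· (x ∷ v) = cong₂ _∷_ (ℚₚ.*-identityˡ x) (1· v)

½·2· : (v : V n) → ½ · 2ℚ · v ≡ v
½·2· []      = refl
½·2· (x ∷ v) = cong₂ _∷_
  (trans (sym (ℚₚ.*-assoc ½ 2ℚ x)) (ℚₚ.*-identityˡ x)) (½·2· v)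

coroot-long : (i : Fin n) → coroot (2ℚ · e i) ≡ e i
coroot-long i = trans (cong (λ q → (2ℚ ÷₀ q) · 2ℚ · e i) (begin
  ⟨ 2ℚ · e i , 2ℚ · e i ⟩     ≡⟨ ⟨·⟩ˡ 2ℚ (e i) (2ℚ · e i) ⟩
  2ℚ * ⟨ e i , 2ℚ · e i ⟩     ≡⟨ cong (2ℚ *_) (⟨⟩-· (e i) 2ℚ (e i)) ⟩
  2ℚ * (2ℚ * ⟨ e i , e i ⟩)   ≡⟨ cong (λ q → 2ℚ * (2ℚ * q)) (trans (⟨e,⟩ i (e i)) (lookup-e-≡ i)) ⟩
  2ℚ * (2ℚ * 1ℚ)              ∎)) (½·2· (e i))
  where open ≡-Reasoning

module _ {i j : Fin n} (i<j : i Fin.< j) where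
  open ≡-Reasoning

  i≢j : i ≢ j
  i≢j refl = ℕₚ.<-irrefl refl i<j

  coroot-minus : coroot (e i -ᵥ e j) ≡ e i -ᵥ e j
  coroot-minus = trans (cong (λ q → (2ℚ ÷₀ q) · (e i -ᵥ e j)) (begin
    ⟨ e i -ᵥ e j , e i -ᵥ e j ⟩                      ≡⟨ ⟨-⟩ˡ (e i) (e j) _ ⟩
    ⟨ e i , e i -ᵥ e j ⟩ - ⟨ e j , e i -ᵥ e j ⟩      ≡⟨ cong₂ _-_ (⟨e,⟩ i _) (⟨e,⟩ j _) ⟩
    lookup (e i -ᵥ e j) i - lookup (e i -ᵥ e j) j    ≡⟨ cong₂ _-_ (Vecₚ.lookup-zipWith _-_ i (e i) (e j))
                                                                  (Vecₚ.lookup-zipWith _-_ j (e i) (e j)) ⟩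
    (lookup (e i) i - lookup (e j) i) - (lookup (e i) j - lookup (e j) j)
      ≡⟨ cong₂ _-_ (cong₂ _-_ (lookup-e-≡ i) (lookup-e-≢ j i (i≢j ∘ sym)))
                   (cong₂ _-_ (lookup-e-≢ i j i≢j) (lookup-e-≡ j)) ⟩
    (1ℚ - 0ℚ) - (0ℚ - 1ℚ)                            ∎)) (1· _)

  coroot-plus : coroot (e i +ᵥ e j) ≡ e i +ᵥ e j
  coroot-plus = trans (cong (λ q → (2ℚ ÷₀ q) · (e i +ᵥ e j)) (begin
    ⟨ e i +ᵥ e j , e i +ᵥ e j ⟩                      ≡⟨ ⟨+⟩ˡ (e i) (e j) _ ⟩
    ⟨ e i , e i +ᵥ e j ⟩ + ⟨ e j , e i +ᵥ e j ⟩      ≡⟨ cong₂ _+_ (⟨e,⟩ i _) (⟨e,⟩ j _) ⟩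
    lookup (e i +ᵥ e j) i + lookup (e i +ᵥ e j) j    ≡⟨ cong₂ _+_ (Vecₚ.lookup-zipWith _+_ i (e i) (e j))
                                                                  (Vecₚ.lookup-zipWith _+_ j (e i) (e j)) ⟩
    (lookup (e i) i + lookup (e j) i) + (lookup (e i) j + lookup (e j) j)
      ≡⟨ cong₂ _+_ (cong₂ _+_ (lookup-e-≡ i) (lookup-e-≢ j i (i≢j ∘ sym)))
                   (cong₂ _+_ (lookup-e-≢ i j i≢j) (lookup-e-≡ j)) ⟩
    (1ℚ + 0ℚ) + (0ℚ + 1ℚ)                            ∎)) (1· _)

IsInt : ℚ → Set
IsInt q = ∃ λ z → q ≡ z / 1

fromℤ-+ : ∀ y z → y / 1 + z / 1 ≡ (y ℤ.+ z) / 1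
fromℤ-+ y z = ℚₚ.toℚᵘ-injective (begin
  toℚᵘ (y / 1 + z / 1)           ≈⟨ ℚₚ.toℚᵘ-homo-+ (y / 1) (z / 1) ⟩
  toℚᵘ (y / 1) ℚᵘ.+ toℚᵘ (z / 1) ≈⟨ ℚᵘₚ.+-cong (ℚₚ.toℚᵘ-fromℚᵘ (mkℚᵘ y 0)) (ℚₚ.toℚᵘ-fromℚᵘ (mkℚᵘ z 0)) ⟩
  mkℚᵘ y 0 ℚᵘ.+ mkℚᵘ z 0         ≈⟨ *≡* (cong (ℤ._* ℤ.+ 1) (cong₂ ℤ._+_ (ℤₚ.*-identityʳ y) (ℤₚ.*-identityʳ z))) ⟩
  mkℚᵘ (y ℤ.+ z) 0               ≈⟨ ℚₚ.toℚᵘ-fromℚᵘ (mkℚᵘ (y ℤ.+ z) 0) ⟨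
  toℚᵘ ((y ℤ.+ z) / 1)           ∎)
  where open ℚᵘₚ.≃-Reasoning

fromℤ-neg : ∀ z → - (z / 1) ≡ (ℤ.- z) / 1
fromℤ-neg (ℤ.+ zero)  = refl
fromℤ-neg (ℤ.+ suc m) = refl
fromℤ-neg ℤ.-[1+ m ]  = solve 1 (λ q → :- (:- q) := q) refl _

int-+ : ∀ {p q} → IsInt p → IsInt q → IsInt (p + q)
int-+ (y , refl) (z , refl) = y ℤ.+ z , fromℤ-+ y z

int-neg : ∀ {q} → IsInt q → IsInt (- q)
int-neg (z , refl) = ℤ.- z , fromℤ-neg z

Integral : V n → Set
Integral v = ∀ i → IsInt (lookup v i)

integral-e : (i : Fin n) → Integral (e i)
integral-e i j with i Finₚ.≟ j
... | yes refl = ℤ.+ 1 , lookup-e-≡ i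
... | no i≢j   = ℤ.+ 0 , lookup-e-≢ i j i≢j

integral-+ : {u v : V n} → Integral u → Integral v → Integral (u +ᵥ v)
integral-+ {u = u} {v} p q i = subst IsInt (sym (Vecₚ.lookup-zipWith _+_ i u v)) (int-+ (p i) (q i))

integral-sub : {u v : V n} → Integral u → Integral v → Integral (u -ᵥ v)
integral-sub {u = u} {v} p q i = subst IsInt (sym (Vecₚ.lookup-zipWith _-_ i u v)) (int-+ (p i) (int-neg (q i)))

integral-coroot : {α : V n} → PositiveRoot α → Integral (coroot α)
integral-coroot (long i)              = subst Integral (sym (coroot-long i)) (integral-e i)
integral-coroot (minus {i} {j} i<j) = subst Integral (sym (coroot-minus i<j))
  (integral-sub {u = e i} {v = e j} (integral-e i) (integral-e j))
integral-coroot (plus {i} {j} i<j)  = subst Integral (sym (coroot-plus i<j))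
  (integral-+ {u = e i} {v = e j} (integral-e i) (integral-e j))

Y-integral : {t : V n} → Y t → Integral t
Y-integral 0∈Y i                          = ℤ.+ 0 , Vecₚ.lookup-replicate i 0ℚ
Y-integral (+coroot {α} {t} α∈ t∈) i =
  integral-+ {u = t} {v = coroot α} (Y-integral t∈) (integral-coroot (Φ⁺-cases α∈)) i
Y-integral (-coroot {α} {t} α∈ t∈) i =
  integral-sub {u = t} {v = coroot α} (Y-integral t∈) (integral-coroot (Φ⁺-cases α∈)) i

-- Every vector of naturals is a sum of basis vectors e i.
generate : (P : V n → Set) → P 0ᵥ → (∀ i {v} → P v → P (v +ᵥ e i)) →
           ∀ ms → P (Vec.map fromℕ ms)
generate P p0 pe []            = p0
generate P p0 pe (m ∷ ms) = go m
  where
  P-tail : P (0ℚ ∷ Vec.map fromℕ ms)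
  P-tail = generate (λ v → P (0ℚ ∷ v)) p0 (λ i → pe (suc i)) ms
  go : ∀ m → P (fromℕ m ∷ Vec.map fromℕ ms)
  go zero    = P-tail
  go (suc m) = subst P (cong₂ _∷_
    (trans (fromℤ-+ (ℤ.+ m) (ℤ.+ 1)) (cong (_/ 1) (cong ℤ.+_ (ℕₚ.+-comm m 1))))
    (Vecₚ.zipWith-identityʳ ℚₚ.+-identityʳ _)) (pe zero (go m))

points-Y : ∀ k {t : V n} → t ∈ points n k → Y t
points-Y {n} k t∈ with ms , _ , refl ← ∈-map⁻ (Vec.map fromℕ) {xs = allVec (upTo (suc k)) n} t∈ =
  generate Y 0∈Y (λ i {v} v∈ → subst (λ u → Y (v +ᵥ u)) (coroot-long i) (+coroot (Φ⁺-long i) v∈)) ms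

fromℕ-injective : ∀ {m m′} → fromℕ m ≡ fromℕ m′ → m ≡ m′
fromℕ-injective {m} {m′} eq with ℚₚ./-injective-≃ (mkℚᵘ (ℤ.+ m) 0) (mkℚᵘ (ℤ.+ m′) 0) eq
... | *≡* eq′ = ℤₚ.+-injective (trans (sym (ℤₚ.*-identityʳ _)) (trans eq′ (ℤₚ.*-identityʳ _)))

map-fromℕ-injective : {u v : Vec ℕ n} → Vec.map fromℕ u ≡ Vec.map fromℕ v → u ≡ v
map-fromℕ-injective {u = []}    {[]}    _  = refl
map-fromℕ-injective {u = _ ∷ _} {_ ∷ _} eq = cong₂ _∷_
  (fromℕ-injective (Vecₚ.∷-injectiveˡ eq)) (map-fromℕ-injective (Vecₚ.∷-injectiveʳ eq))

points-unique : ∀ n k → Unique (points n k)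
points-unique n k = Uniqueₚ.map⁺ map-fromℕ-injective (unique-allVec (Uniqueₚ.upTo⁺ (suc k)) n)

⟨0,⟩ : (v : V n) → ⟨ 0ᵥ , v ⟩ ≡ 0ℚ
⟨0,⟩ []      = refl
⟨0,⟩ (x ∷ v) = cong₂ _+_ (ℚₚ.*-zeroˡ x) (⟨0,⟩ v)

halve : ∀ {x} → 0ℚ ≤ 2ℚ * x → 0ℚ ≤ x
halve {x} p = ℚₚ.*-cancelˡ-≤-pos 2ℚ (subst (_≤ 2ℚ * x) (sym (ℚₚ.*-zeroʳ 2ℚ)) p)

Dominant : V n → Set
Dominant t = ∀ i → 0ℚ ≤ ⟨ simple i , t ⟩

dominant-tail : ∀ {x y} {t : V n} → Dominant (x ∷ y ∷ t) → Dominant (y ∷ t)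
dominant-tail {x = x} {y} {t} dom i = subst (0ℚ ≤_)
  (trans (cong (_+ ⟨ simple i , y ∷ t ⟩) (ℚₚ.*-zeroˡ x)) (ℚₚ.+-identityˡ _)) (dom (suc i))

decreasing : ∀ {x y} {t : V n} → Dominant (x ∷ y ∷ t) → y ≤ x
decreasing {x = x} {y} {t} dom = begin
  y                                       ≡⟨ ℚₚ.+-identityʳ y ⟨
  y + 0ℚ                                  ≤⟨ ℚₚ.+-monoʳ-≤ y (dom zero) ⟩
  y + (1ℚ * x + (- 1ℚ * y + ⟨ 0ᵥ , t ⟩))  ≡⟨ cong (λ z → y + (1ℚ * x + (- 1ℚ * y + z))) (⟨0,⟩ t) ⟩
  y + (1ℚ * x + (- 1ℚ * y + 0ℚ))          ≡⟨ solve 2 (λ x y → y :+ (con 1ℚ :* x :+ (con (- 1ℚ) :* y :+ con 0ℚ)) := x) refl x y ⟩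
  x                                       ∎
  where open ℚₚ.≤-Reasoning

bounds : ∀ {x} (t : V n) → Dominant (x ∷ t) → 0ℚ ≤ x × (∀ i → 0ℚ ≤ lookup (x ∷ t) i × lookup (x ∷ t) i ≤ x)
bounds {x = x} []      dom = 0≤x , λ { zero → 0≤x , ℚₚ.≤-refl }
  where
  0≤x : 0ℚ ≤ x
  0≤x = halve (subst (0ℚ ≤_) (ℚₚ.+-identityʳ (2ℚ * x)) (dom zero))
bounds {x = x} (y ∷ t) dom with 0≤y , rest ← bounds t (dominant-tail {x = x} dom) =
  0≤x , λ { zero    → 0≤x , ℚₚ.≤-refl
          ; (suc i) → let p , q = rest i in p , ℚₚ.≤-trans q y≤x }
  where
  y≤x : y ≤ x
  y≤x = decreasing dom
  0≤x : 0ℚ ≤ x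
  0≤x = ℚₚ.≤-trans 0≤y y≤x

θ-bound : ∀ {x b} (t : V n) → 0ℚ ≤ x → ⟨ θ , x ∷ t ⟩ ≤ b → x ≤ b
θ-bound {x = x} {b} t 0≤x p = begin
  x                        ≡⟨ ℚₚ.+-identityˡ x ⟨
  0ℚ + x                   ≤⟨ ℚₚ.+-monoˡ-≤ x 0≤x ⟩
  x + x                    ≡⟨ solve 1 (λ x → x :+ x := con 2ℚ :* x :+ con 0ℚ) refl x ⟩
  2ℚ * x + 0ℚ              ≡⟨ cong (2ℚ * x +_) (⟨0,⟩ t) ⟨
  ⟨ θ , x ∷ t ⟩            ≤⟨ p ⟩
  b                        ∎
  where open ℚₚ.≤-Reasoning

cancel-≤ : ∀ {y z} → y / 1 ≤ z / 1 → y ℤ.≤ z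
cancel-≤ {y} {z} p with ℚᵘₚ.≤-trans (ℚᵘₚ.≤-reflexive (ℚᵘₚ.≃-sym (ℚₚ.toℚᵘ-fromℚᵘ (mkℚᵘ y 0))))
                     (ℚᵘₚ.≤-trans (ℚₚ.toℚᵘ-mono-≤ p) (ℚᵘₚ.≤-reflexive (ℚₚ.toℚᵘ-fromℚᵘ (mkℚᵘ z 0))))
... | *≤* q = subst₂ ℤ._≤_ (ℤₚ.*-identityʳ y) (ℤₚ.*-identityʳ z) q

small : ∀ {k q} → IsInt q → 0ℚ ≤ q → q ≤ fromℕ k → ∃ λ m → m ∈ upTo (suc k) × q ≡ fromℕ m
small (ℤ.+ m , refl)      _   q≤k = m , ∈-upTo⁺ (ℕ.s≤s (ℤₚ.drop‿+≤+ (cancel-≤ q≤k))) , refl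
small (ℤ.-[1+ m ] , refl) 0≤q _   with cancel-≤ {ℤ.+ 0} {ℤ.-[1+ m ]} 0≤q
... | ()

∈-cube : ∀ {k} (t : V n) → (∀ i → ∃ λ m → m ∈ upTo (suc k) × lookup t i ≡ fromℕ m) → t ∈ points n k
∈-cube {n} {k} t small = let ms , ms∈ , eq = go t small in subst (_∈ points n k) (sym eq) (∈-map⁺ (Vec.map fromℕ) ms∈)
  where
  go : ∀ {n} (t : V n) → (∀ i → ∃ λ m → m ∈ upTo (suc k) × lookup t i ≡ fromℕ m) →
       ∃ λ ms → ms ∈ allVec (upTo (suc k)) n × t ≡ Vec.map fromℕ ms
  go []      _     = [] , here refl , refl
  go (x ∷ t) small =
    let m , m∈ , eq = small zero
        ms , ms∈ , eqs = go t (λ i → small (suc i))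
    in m ∷ ms , ∈-cartesianProductWith⁺ _∷_ m∈ ms∈ , cong₂ _∷_ eq eqs

points-complete : ∀ k (I : Subset (suc n)) {t} → Y t → Face k I t → t ∈ points n k
points-complete k I {[]}    _  _                         = here refl
points-complete k I {x ∷ t} t∈ (on , off , on₀ , off₀) =
  ∈-cube (x ∷ t) λ i → let p , q = proj₂ bnd i in small (Y-integral t∈ i) p (ℚₚ.≤-trans q x≤k)
  where
  dom : Dominant (x ∷ t)
  dom i with suc i Subsetₚ.∈? I
  ... | yes i∈ = ℚₚ.≤-reflexive (sym (on i i∈))
  ... | no i∉  = ℚₚ.<⇒≤ (off i i∉)
  bnd : 0ℚ ≤ x × (∀ i → 0ℚ ≤ lookup (x ∷ t) i × lookup (x ∷ t) i ≤ x)
  bnd = bounds t dom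
  θ≤k : ⟨ θ , x ∷ t ⟩ ≤ fromℕ k
  θ≤k with zero Subsetₚ.∈? I
  ... | yes 0∈ = ℚₚ.≤-reflexive (on₀ 0∈)
  ... | no 0∉  = ℚₚ.<⇒≤ (off₀ 0∉)
  x≤k : x ≤ fromℕ k
  x≤k = θ-bound t (proj₁ bnd) θ≤k

-- Write k = 2m + 1 and let the cube be {-m, …, m}ⁿ. All three coefficients of w
-- equal k⁻ⁿ Σ c(K), summed over the K ⊆ Π - Des(w), where c(K) is the number of
-- dominant points of the cube on which exactly the simple roots in K vanish;
-- c(K) depends only on n - |K|.
--
-- For x_k, a_{k,I} = c(I) if α₀ ∉ I, and a_{k,I} = 0 otherwise since k is odd.
--
-- For H, a flat U has k^dim U points in the cube, so by Möbius inversion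
-- χ(L^Fix(W_K), k) counts the points t of the cube with stabiliser W_K. Counting
-- the pairs (t, w) with w t dominant in two ways, by t and by the zero set of w t,
-- gives |W_K| χ(L^Fix(W_K), k) = |N(W_K)| |λ(K)| c(K).
--
-- For M, inverting (μ_K^J) reduces the claim to
-- k^(n-|K|) = Σ_{L ⊇ K} c(L) |{w ∈ X_L : w(K) ⊆ Π}| for all K. The face of the
-- dominant chamber on which K vanishes is a dominant chamber of type C with
-- p = n - |K| coordinates, and {w : w(K) ⊆ Π} is in bijection with the Weyl group
-- of type C_p, compatibly with descents. So one may assume K = ∅, where the right
-- hand side counts the points t = u d of the cube by their dominant representative
-- d and the element u of minimal length which takes d to t.

{-# OPTIONS --safe #-}
module Submission where

open import Defs
open import Algebra.Bundles using (CommutativeRing)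
open import Data.Bool as Bool using (true; false; if_then_else_)
open import Data.Empty using (⊥)
open import Data.Fin as Fin using (Fin; zero; suc; toℕ; punchIn; punchOut)
import Data.Fin.Properties as Finₚ
open import Data.Fin.Subset as Subset using (Subset; inside; outside; _⊆_; _⊂_; ∁; ∣_∣)
open import Data.Fin.Subset.Induction using (⊂-wellFounded)
open import Data.Fin.Subset.Properties as Subsetₚ using (_⊆?_; _⊂?_)
import Data.Integer as ℤ
open import Data.List as List using (List; []; _∷_; _++_; allFin; cartesianProductWith; deduplicate; filter; length; upTo)
import Data.List.Properties as Listₚ
open import Data.List.Membership.Propositional using (_∈_; lose; find)
open import Data.List.Membership.Propositional.Properties
open import Data.List.Relation.Unary.All as All using (All; []; _∷_)
import Data.List.Relation.Unary.All.Properties as Allₚ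
open import Data.List.Relation.Unary.AllPairs as AllPairs using (AllPairs)
import Data.List.Relation.Unary.AllPairs.Properties as AllPairsₚ
open import Data.List.Relation.Unary.Any as Any using (here; there)
import Data.List.Relation.Unary.Any.Properties as Anyₚ
open import Data.List.Relation.Unary.Unique.Propositional using (Unique; []; _∷_)
import Data.List.Relation.Unary.Unique.Propositional.Properties as Uniqueₚ
open import Data.Nat as ℕ using (ℕ; zero; suc; NonZero)
open import Data.Nat.Divisibility using (_∣_; divides)
import Data.Nat.Properties as ℕₚ
open import Data.Nat.Tactic.RingSolver using (solve-∀)
open import Data.Product using (∃; _×_; _,_; proj₁; proj₂)
open import Data.Rational using (ℚ; 0ℚ; 1ℚ; ½; _+_; _*_; _-_; -_; _≤_; _<_; 1/_; ≢-nonZero; positive; nonNegative)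
import Data.Rational.Properties as ℚₚ
open import Data.Rational.Solver using (module +-*-Solver)
open import Data.Sign as Sign using (Sign)
import Data.Sign.Properties as Signₚ
open import Data.Sum using (_⊎_; inj₁; inj₂; [_,_]′)
open import Data.Vec as Vec using (Vec; []; _∷_; lookup; tabulate; replicate)
import Data.Vec.Properties as Vecₚ
open import Function using (_∘_; _⇔_; mk⇔; Equivalence)
open import Induction.WellFounded using (Acc; acc)
open import Level using (0ℓ)
open import Relation.Binary.Bundles using (DecTotalOrder)
open import Relation.Binary.Definitions using (DecidableEquality; tri<; tri≈; tri>)
open import Relation.Binary.PropositionalEquality
open import Relation.Nullary using (¬_; Dec; yes; no; does; contradiction; contradiction-irr)
open import Relation.Nullary.Decidable as Dec using (¬?; _×-dec_; _⊎-dec_; _→-dec_)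
open import Relation.Unary using (Pred; Decidable)

open import Data.List.Extrema (DecTotalOrder.totalOrder ℚₚ.≤-decTotalOrder) using (argmax; argmax-sel; f[xs]≤f[argmax])
open import Algebra.Properties.Semiring.Exp (CommutativeRing.semiring ℚₚ.+-*-commutativeRing)
  using (_^_)
open Equivalence using () renaming (to to ⇒; from to ⇐)
open ℚₚ using (*-assoc; *-comm; *-identityʳ; *-identityˡ; *-zeroʳ; *-zeroˡ; +-identityʳ; +-identityˡ; +-inverseʳ; +-mono-≤; +-monoˡ-≤; <-asym; <-≤-trans; <⇒≢; <⇒≤; neg-antimono-≤; ≤-reflexive; ≮⇒≥)
open +-*-Solver using (solve; _:=_; _:+_; _:*_; _:-_; :-_; con)

-- The combinatorics of the Weyl group is carried by one vector, `η`, the sum of the positive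
-- coroots. A root is positive exactly if it pairs positively with `η`, the pairing is twice its
-- height, and `act w η` determines `w`; so descents, inversions and simplicity of a root are read
-- off from numbers. The minimal length representatives of the overview appear as lexicographic
-- dominance: `w` takes t + ϵη into the dominant chamber for small ϵ > 0. Such a `w` exists by
-- maximising over the finite group, and it is unique because its inversions are then the positive
-- roots which are negative at t.
--
-- Type C enters through roots being differences of two of the functionals ± vᵢ. On a flat or on the
-- span of a face each vᵢ is zero or a signed coordinate, so a root restricts to zero or to a
-- positive multiple of a root of type C of possibly lower rank. The multiple can differ from 1,
-- hence only signs and zeros are compared between ranks.

private
  variable
    A B : Set
    n : ℕ

-- Finite sums

∑-cong∈ : (as : List A) {f g : A → ℚ} → (∀ {a} → a ∈ as → f a ≡ g a) → ∑ as f ≡ ∑ as g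
∑-cong∈ []       eq = refl
∑-cong∈ (a ∷ as) eq = cong₂ _+_ (eq (here refl)) (∑-cong∈ as (λ a∈ → eq (there a∈)))

∑-*ˡ : (c : ℚ) (as : List A) (f : A → ℚ) → ∑ as (λ a → c * f a) ≡ c * ∑ as f
∑-*ˡ c []       f = sym (*-zeroʳ c)
∑-*ˡ c (a ∷ as) f = trans (cong (c * f a +_) (∑-*ˡ c as f)) (sym (ℚₚ.*-distribˡ-+ c (f a) (∑ as f)))

∑-*ʳ : (c : ℚ) (as : List A) (f : A → ℚ) → ∑ as (λ a → f a * c) ≡ ∑ as f * c
∑-*ʳ c as f = trans (∑-cong as (λ a → *-comm (f a) c)) (trans (∑-*ˡ c as f) (*-comm c (∑ as f)))

∑-swap : (as : List A) (bs : List B) (f : A → B → ℚ) →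
         ∑ as (λ a → ∑ bs (f a)) ≡ ∑ bs (λ b → ∑ as (λ a → f a b))
∑-swap []       bs f = sym (∑-zero bs _ (λ _ → refl))
∑-swap (a ∷ as) bs f = trans (cong (∑ bs (f a) +_) (∑-swap as bs f))
  (sym (∑-+ bs (f a) (λ b → ∑ as (λ a → f a b))))

∑-map : (h : A → B) (as : List A) (f : B → ℚ) → ∑ (List.map h as) f ≡ ∑ as (f ∘ h)
∑-map h []       f = refl
∑-map h (a ∷ as) f = cong (f (h a) +_) (∑-map h as f)

∑-++ : (as bs : List A) (f : A → ℚ) → ∑ (as ++ bs) f ≡ ∑ as f + ∑ bs f
∑-++ []       bs f = sym (+-identityˡ (∑ bs f))
∑-++ (a ∷ as) bs f = trans (cong (f a +_) (∑-++ as bs f)) (sym (ℚₚ.+-assoc (f a) (∑ as f) (∑ bs f)))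

[]?-yes : {P : Set} (p? : Dec P) → P → [ p? ]? ≡ 1ℚ
[]?-yes (yes _) _ = refl
[]?-yes (no ¬p) p = contradiction p ¬p

[]?-no : {P : Set} (p? : Dec P) → ¬ P → [ p? ]? ≡ 0ℚ
[]?-no (yes p) ¬p = contradiction p ¬p
[]?-no (no _)  _  = refl

[]?-cong : {P Q : Set} (p? : Dec P) (q? : Dec Q) → (P → Q) → (Q → P) → [ p? ]? ≡ [ q? ]?
[]?-cong (yes p) q? to from = sym ([]?-yes q? (to p))
[]?-cong (no ¬p) q? to from = sym ([]?-no q? (¬p ∘ from))

[]?-× : {P Q : Set} (p? : Dec P) (q? : Dec Q) → [ p? ×-dec q? ]? ≡ [ p? ]? * [ q? ]?
[]?-× (yes _) (yes _) = refl
[]?-× (yes _) (no _)  = refl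
[]?-× (no _)  q?      = sym (*-zeroˡ [ q? ]?)

[]?-*-cong : {P : Set} (p? : Dec P) {x y : ℚ} → (P → x ≡ y) → [ p? ]? * x ≡ [ p? ]? * y
[]?-*-cong (yes p) eq = cong (1ℚ *_) (eq p)
[]?-*-cong (no _) {x} {y} eq = trans (*-zeroˡ x) (sym (*-zeroˡ y))

∑-filter : {P : Pred A 0ℓ} (P? : Decidable P) (as : List A) (f : A → ℚ) →
           ∑ (filter P? as) f ≡ ∑ as (λ a → [ P? a ]? * f a)
∑-filter P? []       f = refl
∑-filter P? (a ∷ as) f with P? a
... | yes _ = cong₂ _+_ (sym (*-identityˡ (f a))) (∑-filter P? as f)
... | no _  = trans (∑-filter P? as f) (sym (trans (cong (_+ _) (*-zeroˡ (f a))) (+-identityˡ _)))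

fromℕ-+ : ∀ a b → fromℕ (a ℕ.+ b) ≡ fromℕ a + fromℕ b
fromℕ-+ a b = sym (fromℤ-+ (ℤ.+ a) (ℤ.+ b))

fromℕ-length : (as : List A) → fromℕ (length as) ≡ ∑ as (λ _ → 1ℚ)
fromℕ-length []       = refl
fromℕ-length (a ∷ as) = trans (fromℕ-+ 1 (length as)) (cong (1ℚ +_) (fromℕ-length as))

count-∑ : {P : Pred A 0ℓ} (P? : Decidable P) (as : List A) →
          fromℕ (count P? as) ≡ ∑ as (λ a → [ P? a ]?)
count-∑ P? as = trans (fromℕ-length (filter P? as)) (trans (∑-filter P? as (λ _ → 1ℚ))
  (∑-cong as λ a → *-identityʳ [ P? a ]?))

∑-single∈ : {as : List A} {b : A} (f : A → ℚ) → Unique as → b ∈ as →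
            (∀ {a} → a ∈ as → a ≢ b → f a ≡ 0ℚ) → ∑ as f ≡ f b
∑-single∈ {as = _ ∷ as} f (b∉ ∷ _) (here refl) eq =
  trans (cong (f _ +_) (∑-zero as f λ a∈ → eq (there a∈) λ { refl → All.lookup b∉ a∈ refl })) (+-identityʳ _)
∑-single∈ {as = a ∷ as} f (a∉ ∷ u) (there b∈) eq =
  trans (cong₂ _+_ (eq (here refl) λ { refl → All.lookup a∉ b∈ refl })
                   (∑-single∈ f u b∈ (λ a∈ → eq (there a∈)))) (+-identityˡ _)

∑-indicator : {as : List A} {b : A} {P : Pred A 0ℓ} (P? : Decidable P) (f : A → ℚ) → Unique as → b ∈ as →
              P b → (∀ {a} → a ∈ as → P a → a ≡ b) → ∑ as (λ a → [ P? a ]? * f a) ≡ f b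
∑-indicator {b = b} P? f u b∈ p unique = trans
  (∑-single∈ _ u b∈ λ {a} a∈ a≢b → trans (cong (_* f a) ([]?-no (P? a) (a≢b ∘ unique a∈))) (*-zeroˡ (f a)))
  (trans (cong (_* f b) ([]?-yes (P? b) p)) (*-identityˡ (f b)))

∑-indicator₁ : {as : List A} {b : A} {P : Pred A 0ℓ} (P? : Decidable P) → Unique as → b ∈ as →
               P b → (∀ {a} → a ∈ as → P a → a ≡ b) → ∑ as (λ a → [ P? a ]?) ≡ 1ℚ
∑-indicator₁ {as = as} P? u b∈ p unique = trans (∑-cong as λ a → sym (*-identityʳ [ P? a ]?))
  (∑-indicator P? (λ _ → 1ℚ) u b∈ p unique)

-- Double counting along a relation which restricts to a bijection between as and bs.
∑-match : {as : List A} {bs : List B} {R : A → B → Set} {f : A → ℚ} {g : B → ℚ} →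
  Unique as → Unique bs → (∀ a b → Dec (R a b)) →
  (∀ {a} → a ∈ as → ∃ λ b → b ∈ bs × R a b) →
  (∀ {a b b′} → a ∈ as → b ∈ bs → b′ ∈ bs → R a b → R a b′ → b ≡ b′) →
  (∀ {b} → b ∈ bs → ∃ λ a → a ∈ as × R a b) →
  (∀ {a a′ b} → a ∈ as → a′ ∈ as → b ∈ bs → R a b → R a′ b → a ≡ a′) →
  (∀ {a b} → a ∈ as → b ∈ bs → R a b → f a ≡ g b) → ∑ as f ≡ ∑ bs g
∑-match {as = as} {bs} {R} {f} {g} ua ub R? tot fun tot′ fun′ eq = begin
  ∑ as f  ≡⟨ ∑-cong∈ as row ⟨
  ∑ as (λ a → ∑ bs (λ b → [ R? a b ]? * g b))  ≡⟨ ∑-swap as bs _ ⟩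
  ∑ bs (λ b → ∑ as (λ a → [ R? a b ]? * g b))  ≡⟨ ∑-cong∈ bs col ⟩
  ∑ bs g  ∎
  where
  open ≡-Reasoning
  row : ∀ {a} → a ∈ as → ∑ bs (λ b → [ R? a b ]? * g b) ≡ f a
  row a∈ = let b , b∈ , r = tot a∈ in
    trans (∑-indicator (R? _) g ub b∈ r (λ b′∈ r′ → fun a∈ b′∈ b∈ r′ r)) (sym (eq a∈ b∈ r))
  col : ∀ {b} → b ∈ bs → ∑ as (λ a → [ R? a b ]? * g b) ≡ g b
  col b∈ = let a , a∈ , r = tot′ b∈ in
    ∑-indicator (λ a → R? a _) (λ _ → g _) ua a∈ r (λ a′∈ r′ → fun′ a′∈ a∈ b∈ r′ r)

∑-reindex : DecidableEquality B → {as : List A} {bs : List B} (h : A → B) (h⁻¹ : B → A) (g : B → ℚ) →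
  Unique as → Unique bs →
  (∀ {a} → a ∈ as → h a ∈ bs × h⁻¹ (h a) ≡ a) → (∀ {b} → b ∈ bs → h⁻¹ b ∈ as × h (h⁻¹ b) ≡ b) →
  ∑ as (g ∘ h) ≡ ∑ bs g
∑-reindex _≟_ h h⁻¹ g ua ub to from = ∑-match {R = λ a b → h a ≡ b} ua ub (λ a b → h a ≟ b)
  (λ a∈ → _ , proj₁ (to a∈) , refl) (λ _ _ _ r r′ → trans (sym r) r′)
  (λ b∈ → _ , from b∈)
  (λ a∈ a′∈ _ r r′ → trans (sym (proj₂ (to a∈))) (trans (cong h⁻¹ (trans r (sym r′))) (proj₂ (to a′∈))))
  (λ _ _ r → cong g r)

unique-elements : ∀ n → Unique (elements n)
unique-elements n = Uniqueₚ.concat⁺ (Allₚ.map⁺ (All.universal unique-withSigns _))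
  (AllPairsₚ.map⁺ (AllPairs.map disjoint (unique-allVec (Uniqueₚ.allFin⁺ n) n)))
  where
  unique-withSigns : (π : Vec (Fin n) n) → Unique (withSigns π)
  unique-withSigns π with injective? π
  ... | yes inj = Uniqueₚ.map⁺ (λ { refl → refl }) (unique-allVec (((λ ()) ∷ []) ∷ [] ∷ []) n)
  ... | no _    = []
  perm-withSigns : ∀ {π} {w : W n} → w ∈ withSigns π → W.perm w ≡ π
  perm-withSigns {π} w∈ with injective? π
  ... | yes inj with _ , _ , refl ← ∈-map⁻ (λ s → signedPerm π s inj) w∈ = refl
  perm-withSigns {π} () | no _
  disjoint : ∀ {π π′} → π ≢ π′ → ∀ {w} → ¬ (w ∈ withSigns π × w ∈ withSigns π′)
  disjoint π≢ (w∈ , w∈′) = π≢ (trans (sym (perm-withSigns w∈)) (perm-withSigns w∈′))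

abstract
  -- Existence arguments below pick an extremal group element; `P` restricts the choice to a
  -- parabolic subgroup or to the maximisers of an earlier function.
  maximiser : (f : A → ℚ) {P : Pred A 0ℓ} (P? : Decidable P) {as : List A} → (∀ a → a ∈ as) → ∃ P →
              ∃ λ a → P a × (∀ b → P b → f b ≤ f a)
  maximiser {A} f {P} P? {as} all (a₀ , p₀) = best , pbest , λ b p →
      All.lookup (f[xs]≤f[argmax] {f = f} a₀ (filter P? as)) (∈-filter⁺ P? (all b) p)
    where
    best : A
    best = argmax f a₀ (filter P? as)
    pbest : P best
    pbest with argmax-sel f a₀ (filter P? as)
    ... | inj₁ eq = subst P (sym eq) p₀
    ... | inj₂ b∈ = proj₂ (∈-filter⁻ P? {xs = as} b∈)

-- The group of signed permutations

infix 10 _⁻¹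

-- The field `injective` of `W` is irrelevant; decidable equality on `Fin n` recovers a usable proof
-- from it.
perm-injective : (w : W n) → ∀ i j → lookup (W.perm w) i ≡ lookup (W.perm w) j → i ≡ j
perm-injective (signedPerm π s inj) i j eq with i Finₚ.≟ j
... | yes i≡j = i≡j
... | no i≢j  = contradiction-irr (inj i j eq) i≢j

-- If `j` were missed, punching it out would give an injection into a smaller finite set.
injective⇒surjective : (f : Fin n → Fin n) → (∀ i j → f i ≡ f j → i ≡ j) → ∀ j → ∃ λ i → f i ≡ j
injective⇒surjective {suc n} f inj j with Finₚ.any? (λ i → f i Finₚ.≟ j)
... | yes found = found
... | no missed = contradiction (Finₚ.injective⇒≤ {f = g} g-injective) ℕₚ.1+n≰n
  where
  g : Fin (suc n) → Fin n
  g i = punchOut {i = j} {f i} λ eq → missed (i , sym eq)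
  g-injective : ∀ {i i′} → g i ≡ g i′ → i ≡ i′
  g-injective {i} {i′} eq = inj i i′ (Finₚ.punchOut-injective (λ q → missed (i , sym q)) (λ q → missed (i′ , sym q)) eq)

preimage : (w : W n) → ∀ j → ∃ λ i → lookup (W.perm w) i ≡ j
preimage w = injective⇒surjective (lookup (W.perm w)) (perm-injective w)

neg-involutive : ∀ q → - (- q) ≡ q
neg-involutive = solve 1 (λ q → :- (:- q) := q) refl

signed-involutive : ∀ s q → signed s (signed s q) ≡ q
signed-involutive Sign.+ q = refl
signed-involutive Sign.- q = neg-involutive q

signed-* : ∀ s t q → signed (s Sign.* t) q ≡ signed s (signed t q)
signed-* Sign.+ t      q = refl
signed-* Sign.- Sign.+ q = refl
signed-* Sign.- Sign.- q = sym (neg-involutive q)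

lookup-act : (w : W n) (v : V n) (i : Fin n) →
             lookup (act w v) i ≡ signed (lookup (W.sign w) i) (lookup v (lookup (W.perm w) i))
lookup-act w v i = Vecₚ.lookup∘tabulate _ i

abstract
  _⁻¹ : W n → W n
  w ⁻¹ = record
    { perm      = tabulate (proj₁ ∘ preimage w)
    ; sign      = tabulate (λ j → lookup (W.sign w) (proj₁ (preimage w j)))
    ; injective = λ i j eq → trans (sym (proj₂ (preimage w i)))
        (trans (cong (lookup (W.perm w)) (trans (sym (Vecₚ.lookup∘tabulate _ i)) (trans eq (Vecₚ.lookup∘tabulate _ j))))
               (proj₂ (preimage w j)))
    }

  act-⁻¹ʳ : (w : W n) (v : V n) → act w (act (w ⁻¹) v) ≡ v
  act-⁻¹ʳ {n} w v = lookup-ext λ i → let j = lookup (W.perm w) i in begin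
    lookup (act w (act (w ⁻¹) v)) i  ≡⟨ lookup-act w (act (w ⁻¹) v) i ⟩
    signed (s i) (lookup (act (w ⁻¹) v) j)  ≡⟨ cong (signed (s i)) (lookup-act (w ⁻¹) v j) ⟩
    signed (s i) (signed (lookup (W.sign (w ⁻¹)) j) (lookup v (lookup (W.perm (w ⁻¹)) j)))
      ≡⟨ cong₂ (λ t l → signed (s i) (signed t (lookup v l)))
           (trans (Vecₚ.lookup∘tabulate _ j) (cong s (back i))) (trans (Vecₚ.lookup∘tabulate _ j) (back i)) ⟩
    signed (s i) (signed (s i) (lookup v i)) ≡⟨ signed-involutive (s i) (lookup v i) ⟩
    lookup v i ∎
    where
    open ≡-Reasoning
    s : Fin n → Sign
    s = lookup (W.sign w)
    back : ∀ i → proj₁ (preimage w (lookup (W.perm w) i)) ≡ i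
    back i = perm-injective w _ i (proj₂ (preimage w (lookup (W.perm w) i)))

  act-⁻¹ˡ : (w : W n) (v : V n) → act (w ⁻¹) (act w v) ≡ v
  act-⁻¹ˡ w v = lookup-ext λ j → let i = proj₁ (preimage w j) in begin
    lookup (act (w ⁻¹) (act w v)) j  ≡⟨ lookup-act (w ⁻¹) (act w v) j ⟩
    signed (lookup (W.sign (w ⁻¹)) j) (lookup (act w v) (lookup (W.perm (w ⁻¹)) j))
      ≡⟨ cong₂ (λ t l → signed t (lookup (act w v) l)) (Vecₚ.lookup∘tabulate _ j) (Vecₚ.lookup∘tabulate _ j) ⟩
    signed (lookup (W.sign w) i) (lookup (act w v) i) ≡⟨ cong (signed (lookup (W.sign w) i)) (lookup-act w v i) ⟩
    signed (lookup (W.sign w) i) (signed (lookup (W.sign w) i) (lookup v (lookup (W.perm w) i)))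
      ≡⟨ signed-involutive (lookup (W.sign w) i) _ ⟩
    lookup v (lookup (W.perm w) i)  ≡⟨ cong (lookup v) (proj₂ (preimage w j)) ⟩
    lookup v j ∎
    where open ≡-Reasoning

signed-+ : ∀ s p q → signed s (p + q) ≡ signed s p + signed s q
signed-+ Sign.+ p q = refl
signed-+ Sign.- p q = ℚₚ.neg-distrib-+ p q

signed-neg : ∀ s q → signed s (- q) ≡ - signed s q
signed-neg Sign.+ q = refl
signed-neg Sign.- q = refl

act-+ : (w : W n) (u v : V n) → act w (u +ᵥ v) ≡ act w u +ᵥ act w v
act-+ w u v = lookup-ext λ i → trans (lookup-act w (u +ᵥ v) i) (trans
  (cong (signed (lookup (W.sign w) i)) (Vecₚ.lookup-zipWith _+_ (lookup (W.perm w) i) u v))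
  (trans (signed-+ (lookup (W.sign w) i) _ _) (sym (trans (Vecₚ.lookup-zipWith _+_ i (act w u) (act w v))
    (cong₂ _+_ (lookup-act w u i) (lookup-act w v i))))))

act-neg : (w : W n) (v : V n) → act w (-ᵥ v) ≡ -ᵥ act w v
act-neg w v = lookup-ext λ i → trans (lookup-act w (-ᵥ v) i) (trans
  (cong (signed (lookup (W.sign w) i)) (Vecₚ.lookup-map (lookup (W.perm w) i) -_ v))
  (trans (signed-neg (lookup (W.sign w) i) _)
    (sym (trans (Vecₚ.lookup-map i -_ (act w v)) (cong -_ (lookup-act w v i))))))

∑-allFin-suc : (f : Fin (suc n) → ℚ) → ∑ (allFin (suc n)) f ≡ f zero + ∑ (allFin n) (f ∘ suc)
∑-allFin-suc {n} f = cong (f zero +_) (trans (cong (λ xs → ∑ xs f) (sym (Listₚ.map-tabulate (λ i → i) suc)))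
  (∑-map suc (allFin n) f))

⟨⟩-∑ : (u v : V n) → ⟨ u , v ⟩ ≡ ∑ (allFin n) (λ i → lookup u i * lookup v i)
⟨⟩-∑ []      []      = refl
⟨⟩-∑ (x ∷ u) (y ∷ v) = trans (cong (x * y +_) (⟨⟩-∑ u v)) (sym (∑-allFin-suc (λ i → lookup (x ∷ u) i * lookup (y ∷ v) i)))

⟨⟩-comm : (u v : V n) → ⟨ u , v ⟩ ≡ ⟨ v , u ⟩
⟨⟩-comm []      []      = refl
⟨⟩-comm (x ∷ u) (y ∷ v) = cong₂ _+_ (*-comm x y) (⟨⟩-comm u v)

⟨neg⟩ˡ : (u v : V n) → ⟨ -ᵥ u , v ⟩ ≡ - ⟨ u , v ⟩
⟨neg⟩ˡ u v = ⟨signed⟩ˡ Sign.- u v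

⟨⟩-ext : {u u′ : V n} → (∀ v → ⟨ u , v ⟩ ≡ ⟨ u′ , v ⟩) → u ≡ u′
⟨⟩-ext {u = u} {u′} eq = lookup-ext λ i → begin
  lookup u i  ≡⟨ ⟨e,⟩ i u ⟨
  ⟨ e i , u ⟩  ≡⟨ ⟨⟩-comm (e i) u ⟩
  ⟨ u , e i ⟩  ≡⟨ eq (e i) ⟩
  ⟨ u′ , e i ⟩  ≡⟨ ⟨⟩-comm u′ (e i) ⟩
  ⟨ e i , u′ ⟩  ≡⟨ ⟨e,⟩ i u′ ⟩
  lookup u′ i  ∎
  where open ≡-Reasoning

act-⟨⟩ : (w : W n) (u v : V n) → ⟨ act w u , act w v ⟩ ≡ ⟨ u , v ⟩
act-⟨⟩ {n} w u v = begin
  ⟨ act w u , act w v ⟩  ≡⟨ ⟨⟩-∑ (act w u) (act w v) ⟩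
  ∑ (allFin n) (λ i → lookup (act w u) i * lookup (act w v) i) ≡⟨ ∑-cong (allFin n) step ⟩
  ∑ (allFin n) (λ i → g (lookup (W.perm w) i))  ≡⟨ ∑-reindex Finₚ._≟_ (lookup (W.perm w)) (proj₁ ∘ preimage w) g
                                                                    (Uniqueₚ.allFin⁺ n) (Uniqueₚ.allFin⁺ n)
                                                                    (λ _ → ∈-allFin _ , perm-injective w _ _ (proj₂ (preimage w _)))
                                                                    (λ _ → ∈-allFin _ , proj₂ (preimage w _)) ⟩
  ∑ (allFin n) g  ≡⟨ ⟨⟩-∑ u v ⟨
  ⟨ u , v ⟩ ∎
  where
  open ≡-Reasoning
  g : Fin n → ℚ
  g i = lookup u i * lookup v i
  cancel : ∀ s p q → signed s p * signed s q ≡ p * q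
  cancel Sign.+ p q = refl
  cancel Sign.- p q = solve 2 (λ p q → (:- p) :* (:- q) := p :* q) refl p q
  step : ∀ i → lookup (act w u) i * lookup (act w v) i ≡ g (lookup (W.perm w) i)
  step i = trans (cong₂ _*_ (lookup-act w u i) (lookup-act w v i)) (cancel (lookup (W.sign w) i) _ _)

act-adjoint : (w : W n) (u v : V n) → ⟨ act w u , v ⟩ ≡ ⟨ u , act (w ⁻¹) v ⟩
act-adjoint w u v = trans (cong ⟨ act w u ,_⟩ (sym (act-⁻¹ʳ w v))) (act-⟨⟩ w u (act (w ⁻¹) v))

act-adjoint′ : (w : W n) (u v : V n) → ⟨ act (w ⁻¹) u , v ⟩ ≡ ⟨ u , act w v ⟩
act-adjoint′ w u v = trans (sym (act-⟨⟩ w (act (w ⁻¹) u) v)) (cong ⟨_, act w v ⟩ (act-⁻¹ʳ w u))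

act-injective : (w : W n) {u v : V n} → act w u ≡ act w v → u ≡ v
act-injective w {u} {v} eq = trans (sym (act-⁻¹ˡ w u)) (trans (cong (act (w ⁻¹)) eq) (act-⁻¹ˡ w v))

infix 9 _⟦_⟧
infixl 8 _◃_

-- The 2n functionals ± vᵢ. A root of Cₙ is the difference of two of them.
SignedIndex : ℕ → Set
SignedIndex n = Sign × Fin n

_⟦_⟧ : V n → SignedIndex n → ℚ
v ⟦ s , i ⟧ = signed s (lookup v i)

_◃_ : SignedIndex n → W n → SignedIndex n
(s , i) ◃ w = s Sign.* lookup (W.sign w) i , lookup (W.perm w) i

act-⟦⟧ : (w : W n) (v : V n) (a : SignedIndex n) → act w v ⟦ a ⟧ ≡ v ⟦ a ◃ w ⟧
act-⟦⟧ w v (s , i) = trans (cong (signed s) (lookup-act w v i)) (sym (signed-* s (lookup (W.sign w) i) _))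

se : SignedIndex n → V n
se (s , i) = Vec.map (signed s) (e i)

⟨se,⟩ : (a : SignedIndex n) (v : V n) → ⟨ se a , v ⟩ ≡ v ⟦ a ⟧
⟨se,⟩ (s , i) v = trans (⟨signed⟩ˡ s (e i) v) (cong (signed s) (⟨e,⟩ i v))

⟨se-se,⟩ : (a c : SignedIndex n) (v : V n) → ⟨ se a -ᵥ se c , v ⟩ ≡ v ⟦ a ⟧ - v ⟦ c ⟧
⟨se-se,⟩ a c v = trans (⟨-⟩ˡ (se a) (se c) v) (cong₂ _-_ (⟨se,⟩ a v) (⟨se,⟩ c v))

-- Roots

≤∧≢⇒< : ∀ {p q} → p ≤ q → p ≢ q → p < q
≤∧≢⇒< {p} {q} p≤q p≢q with ℚₚ.<-cmp p q
... | tri< p<q _ _ = p<q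
... | tri≈ _ p≡q _ = contradiction p≡q p≢q
... | tri> _ _ q<p = contradiction (<-≤-trans q<p p≤q) (ℚₚ.<-irrefl refl)

fromℕ-mono : ∀ {a b} → a ℕ.≤ b → fromℕ a ≤ fromℕ b
fromℕ-mono {a} {b} a≤b = subst (λ m → fromℕ a ≤ fromℕ m) (ℕₚ.m+[n∸m]≡n a≤b)
  (subst₂ _≤_ (+-identityʳ (fromℕ a)) (sym (fromℕ-+ a (b ℕ.∸ a))) (ℚₚ.+-monoʳ-≤ (fromℕ a) (0≤fromℕ (b ℕ.∸ a))))
  where
  0≤fromℕ : ∀ m → 0ℚ ≤ fromℕ m
  0≤fromℕ m = ℚₚ.nonNegative⁻¹ (fromℕ m) {{ℚₚ.normalize-nonNeg m 1}}

fromℕ-mono-< : ∀ {a b} → a ℕ.< b → fromℕ a < fromℕ b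
fromℕ-mono-< a<b = ≤∧≢⇒< (fromℕ-mono (ℕₚ.<⇒≤ a<b)) λ eq → ℕₚ.<⇒≢ a<b (fromℕ-injective eq)

neg⇒<0 : ∀ {q} → 0ℚ < - q → q < 0ℚ
neg⇒<0 {q} p = subst (_< 0ℚ) (neg-involutive q) (ℚₚ.neg-antimono-< p)

-- The position of ± vᵢ in the chain - v₁ < - v₂ < … < v₂ < v₁.
rank : SignedIndex n → ℕ
rank {suc n} (s      , suc i) = suc (rank (s , i))
rank {suc n} (Sign.+ , zero)  = suc (n ℕ.+ n)
rank {suc n} (Sign.- , zero)  = 0

rank-< : (a : SignedIndex n) → rank a ℕ.< n ℕ.+ n
rank-< {suc n} (Sign.+ , zero)  = ℕ.s≤s (ℕₚ.≤-reflexive (sym (ℕₚ.+-suc n n)))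
rank-< {suc n} (Sign.- , zero)  = ℕ.s≤s ℕ.z≤n
rank-< {suc n} (s      , suc i) = ℕ.s≤s (ℕₚ.≤-trans (rank-< (s , i)) (ℕₚ.+-monoʳ-≤ n (ℕₚ.n≤1+n n)))

rank-injective : (a c : SignedIndex n) → rank a ≡ rank c → a ≡ c
rank-injective (Sign.+ , zero)  (Sign.+ , zero)  eq = refl
rank-injective (Sign.+ , zero)  (s      , suc j) eq =
  contradiction (sym (ℕₚ.suc-injective eq)) (ℕₚ.<⇒≢ (rank-< (s , j)))
rank-injective (Sign.- , zero)  (Sign.- , zero)  eq = refl
rank-injective (s      , suc i) (Sign.+ , zero)  eq =
  contradiction (ℕₚ.suc-injective eq) (ℕₚ.<⇒≢ (rank-< (s , i)))
rank-injective (s      , suc i) (t      , suc j) eq =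
  cong (λ (s , i) → s , suc i) (rank-injective (s , i) (t , j) (ℕₚ.suc-injective eq))

-- Every simple root pairs to 2 with η = (2n-1, … , 3, 1).
η : V n
η {zero}  = []
η {suc n} = fromℕ (suc (n ℕ.+ n)) ∷ η

-- Along the chain `η` takes the odd values from 1 - 2n to 2n - 1 in increasing order; the shift by
-- 2n makes them natural numbers.
η-rank : (a : SignedIndex n) → η ⟦ a ⟧ + fromℕ (n ℕ.+ n) ≡ fromℕ (suc (rank a ℕ.+ rank a))
η-rank {suc n} (Sign.+ , zero) = trans (sym (fromℕ-+ (suc (n ℕ.+ n)) (suc n ℕ.+ suc n)))
  (cong fromℕ (shuffle n))
  where
  shuffle : ∀ n → suc (n ℕ.+ n) ℕ.+ (suc n ℕ.+ suc n) ≡ suc (suc (n ℕ.+ n) ℕ.+ suc (n ℕ.+ n))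
  shuffle = solve-∀
η-rank {suc n} (Sign.- , zero) = trans
  (cong (- fromℕ (suc (n ℕ.+ n)) +_) (trans (cong (λ m → fromℕ (suc m)) (ℕₚ.+-suc n n)) (fromℕ-+ 1 (suc (n ℕ.+ n)))))
  (solve 2 (λ x y → (:- x) :+ (y :+ x) := y) refl (fromℕ (suc (n ℕ.+ n))) (fromℕ 1))
η-rank {suc n} (s , suc i) = begin
  η ⟦ s , i ⟧ + fromℕ (suc n ℕ.+ suc n)  ≡⟨ cong (λ m → η ⟦ s , i ⟧ + fromℕ (suc m)) (ℕₚ.+-suc n n) ⟩
  η ⟦ s , i ⟧ + fromℕ (2 ℕ.+ (n ℕ.+ n))  ≡⟨ cong (η ⟦ s , i ⟧ +_) (fromℕ-+ 2 (n ℕ.+ n)) ⟩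
  η ⟦ s , i ⟧ + (fromℕ 2 + fromℕ (n ℕ.+ n))  ≡⟨ solve 3 (λ x y z → x :+ (y :+ z) := y :+ (x :+ z)) refl (η ⟦ s , i ⟧) (fromℕ 2) (fromℕ (n ℕ.+ n)) ⟩
  fromℕ 2 + (η ⟦ s , i ⟧ + fromℕ (n ℕ.+ n))  ≡⟨ cong (fromℕ 2 +_) (η-rank (s , i)) ⟩
  fromℕ 2 + fromℕ (suc (r ℕ.+ r))  ≡⟨ fromℕ-+ 2 (suc (r ℕ.+ r)) ⟨
  fromℕ (3 ℕ.+ (r ℕ.+ r))  ≡⟨ cong (λ m → fromℕ (2 ℕ.+ m)) (ℕₚ.+-suc r r) ⟨
  fromℕ (suc (suc r ℕ.+ suc r))  ∎
  where
  open ≡-Reasoning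
  r = rank (s , i)

-- For a positive root the gap `d` in the chain is its height, so pairing with `η` gives twice the
-- height.
η-difference : ∀ d (a c : SignedIndex n) → rank a ≡ d ℕ.+ rank c → η ⟦ a ⟧ - η ⟦ c ⟧ ≡ fromℕ (d ℕ.+ d)
η-difference {n} d a c eq = begin
  η ⟦ a ⟧ - η ⟦ c ⟧  ≡⟨ solve 3 (λ x y z → x :- y := (x :+ z) :- (y :+ z)) refl (η ⟦ a ⟧) (η ⟦ c ⟧) (fromℕ (n ℕ.+ n)) ⟩
  (η ⟦ a ⟧ + fromℕ (n ℕ.+ n)) - (η ⟦ c ⟧ + fromℕ (n ℕ.+ n))
    ≡⟨ cong₂ _-_ (trans (η-rank a) (trans (cong fromℕ (trans (cong (λ m → suc (m ℕ.+ m)) eq) (shuffle d r)))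
                                          (fromℕ-+ (d ℕ.+ d) (suc (r ℕ.+ r))))) (η-rank c) ⟩
  (fromℕ (d ℕ.+ d) + fromℕ (suc (r ℕ.+ r))) - fromℕ (suc (r ℕ.+ r))
    ≡⟨ solve 2 (λ x y → (x :+ y) :- y := x) refl (fromℕ (d ℕ.+ d)) (fromℕ (suc (r ℕ.+ r))) ⟩
  fromℕ (d ℕ.+ d) ∎
  where
  open ≡-Reasoning
  r = rank c
  shuffle : ∀ d r → suc ((d ℕ.+ r) ℕ.+ (d ℕ.+ r)) ≡ (d ℕ.+ d) ℕ.+ suc (r ℕ.+ r)
  shuffle = solve-∀

η-mono : {a c : SignedIndex n} → rank c ℕ.< rank a → 2ℚ ≤ η ⟦ a ⟧ - η ⟦ c ⟧
η-mono {a = a} {c} c<a with d , eq ← ℕₚ.m≤n⇒∃[o]m+o≡n c<a = subst (2ℚ ≤_)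
  (sym (η-difference (suc d) a c (trans (sym eq) (cong suc (ℕₚ.+-comm (rank c) d)))))
  (fromℕ-mono (ℕ.s≤s (subst (1 ℕ.≤_) (sym (ℕₚ.+-suc d d)) (ℕ.s≤s ℕ.z≤n))))

se-suc : (a : SignedIndex n) → se (proj₁ a , suc (proj₂ a)) ≡ 0ℚ ∷ se a
se-suc (Sign.+ , i) = refl
se-suc (Sign.- , i) = refl

se-0 : {a b : SignedIndex n} {v : V n} → se a -ᵥ se b ≡ v →
       se (proj₁ a , suc (proj₂ a)) -ᵥ se (proj₁ b , suc (proj₂ b)) ≡ 0ℚ ∷ v
se-0 {a = a} {b} eq = trans (cong₂ _-ᵥ_ (se-suc a) (se-suc b)) (cong (0ℚ ∷_) eq)

-ᵥ-self : (v : V n) → v -ᵥ v ≡ 0ᵥ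
-ᵥ-self []      = refl
-ᵥ-self (x ∷ v) = cong₂ _∷_ (+-inverseʳ x) (-ᵥ-self v)

se-zero-suc : 1ℚ ∷ - 1ℚ ∷ 0ᵥ {n} ≡ se (Sign.+ , zero) -ᵥ se (Sign.+ , suc zero)
se-zero-suc {n} = cong (λ v → 1ℚ ∷ - 1ℚ ∷ v) (sym (trans (cong₂ _-ᵥ_ (Vecₚ.map-id 0ᵥ) (Vecₚ.map-id 0ᵥ)) (-ᵥ-self 0ᵥ)))

se-suc-zero : 1ℚ ∷ - 1ℚ ∷ 0ᵥ {n} ≡ se (Sign.- , suc zero) -ᵥ se (Sign.- , zero)
se-suc-zero {n} = cong (λ v → 1ℚ ∷ - 1ℚ ∷ v) (sym (-ᵥ-self (-ᵥ 0ᵥ)))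

simple-neighbours : (i : Fin n) → ∃ λ a → ∃ λ b → rank a ≡ suc (rank b) × simple i ≡ se a -ᵥ se b
simple-neighbours {suc zero}    zero    = (Sign.+ , zero) , (Sign.- , zero) , refl , refl
simple-neighbours {suc (suc n)} zero    = (Sign.+ , zero) , (Sign.+ , suc zero) ,
  cong (λ m → suc (suc m)) (ℕₚ.+-suc n n) , se-zero-suc
simple-neighbours {suc (suc n)} (suc i) = let (s , j) , (t , k) , r , eq = simple-neighbours i in
  (s , suc j) , (t , suc k) , cong suc r , sym (se-0 {a = s , j} {t , k} (sym eq))

-- Every simple root but the last is a difference of neighbours at two places of the chain, as eᵢ -
-- eᵢ₊₁ and as (- eᵢ₊₁) - (- eᵢ); hence the two forms `se-zero-suc` and `se-suc-zero`. The long
-- simple root sits in the middle.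
neighbour : (a : SignedIndex n) → rank a ≡ 0 ⊎ ∃ λ b → ∃ λ i → rank a ≡ suc (rank b) × se a -ᵥ se b ≡ simple i
neighbour {suc zero}    (Sign.+ , zero)     = inj₂ ((Sign.- , zero) , zero , refl , refl)
neighbour {suc (suc n)} (Sign.+ , zero)     =
  inj₂ ((Sign.+ , suc zero) , zero , cong (λ m → suc (suc m)) (ℕₚ.+-suc n n) , sym se-zero-suc)
neighbour               (Sign.- , zero)     = inj₁ refl
neighbour {suc (suc n)} (Sign.- , suc zero) = inj₂ ((Sign.- , zero) , zero , refl , sym se-suc-zero)
neighbour {suc (suc n)} (Sign.+ , suc i)    with neighbour (Sign.+ , i)
neighbour {suc (suc n)} (Sign.+ , suc zero)    | inj₁ ()
neighbour {suc (suc n)} (Sign.+ , suc (suc i)) | inj₁ ()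
... | inj₂ ((t , k) , j , r , eq) = inj₂ ((t , suc k) , suc j , cong suc r , se-0 {a = Sign.+ , i} {t , k} eq)
neighbour {suc (suc n)} (Sign.- , suc (suc i)) with neighbour (Sign.- , suc i)
... | inj₂ ((t , k) , j , r , eq) = inj₂ ((t , suc k) , suc j , cong suc r , se-0 {a = Sign.- , suc i} {t , k} eq)

-- Opposite `a` and `c` give the long roots, and a short root has two presentations, since `a` and
-- `c` may be exchanged after changing both signs. Positivity is a comparison of positions in the
-- chain.
Root Positive : V n → Set
Root     α = ∃ λ a → ∃ λ c → a ≢ c × α ≡ se a -ᵥ se c
Positive α = ∃ λ a → ∃ λ c → rank c ℕ.< rank a × α ≡ se a -ᵥ se c

positive-simple : (i : Fin n) → Positive (simple i)
positive-simple i = let a , b , r , eq = simple-neighbours i in a , b , ℕₚ.≤-reflexive (sym r) , eq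

positive-root : {α : V n} → Positive α → Root α
positive-root (a , c , c<a , eq) = a , c , (λ { refl → ℕₚ.<-irrefl refl c<a }) , eq

-- The difference of two positions telescopes: the step from the upper position to the neighbour
-- below it is a simple root, and what remains is a positive root of smaller height.
positive-induction : (P : V n → Set) → (∀ i → P (simple i)) →
  (∀ {β γ} → Positive β → Positive γ → P β → P γ → P (β +ᵥ γ)) → ∀ {α} → Positive α → P α
positive-induction P base step (a , c , c<a , refl)
  with d , eq ← ℕₚ.m≤n⇒∃[o]m+o≡n c<a = go d a (trans (sym eq) (cong suc (ℕₚ.+-comm (rank c) d)))
  where
  split : ∀ {m} (u v w : V m) → u -ᵥ w ≡ (u -ᵥ v) +ᵥ (v -ᵥ w)
  split []      []      []      = refl
  split (x ∷ u) (y ∷ v) (z ∷ w) = cong₂ _∷_ (solve 3 (λ x y z → x :- z := (x :- y) :+ (y :- z)) refl x y z) (split u v w)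
  go : ∀ d a → rank a ≡ suc d ℕ.+ rank c → P (se a -ᵥ se c)
  go d a r with neighbour a
  ... | inj₁ r0 = contradiction (trans (sym r0) r) λ ()
  go zero a r | inj₂ (b , i , r′ , eq) with refl ← rank-injective b c (ℕₚ.suc-injective (trans (sym r′) r)) =
    subst P (sym eq) (base i)
  go (suc d) a r | inj₂ (b , i , r′ , eq) = subst P (sym (split (se a) (se b) (se c)))
    (step (a , b , ℕₚ.≤-reflexive (sym r′) , refl) (b , c , c<b , refl) (subst P (sym eq) (base i)) (go d b rb))
    where
    rb : rank b ≡ suc d ℕ.+ rank c
    rb = ℕₚ.suc-injective (trans (sym r′) r)
    c<b : rank c ℕ.< rank b
    c<b = ℕₚ.≤-trans (ℕ.s≤s (ℕₚ.m≤n+m (rank c) d)) (ℕₚ.≤-reflexive (sym rb))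

Decomposed : V n → Set
Decomposed α = (∃ λ i → α ≡ simple i) ⊎ ∃ λ β → ∃ λ γ → Positive β × Positive γ × α ≡ β +ᵥ γ

-- This is how simple roots are recognised later: if both summands of a root pair to at least 2 with
-- some vector, the root pairs to at least 4, so a pairing of 2 leaves only the simple case.
decompose : {α : V n} → Positive α → Decomposed α
decompose = positive-induction Decomposed (λ i → inj₁ (i , refl)) (λ β⁺ γ⁺ _ _ → inj₂ (_ , _ , β⁺ , γ⁺ , refl))

positive-η : {α : V n} → Positive α → 2ℚ ≤ ⟨ α , η ⟩
positive-η (a , c , c<a , refl) = subst (2ℚ ≤_) (sym (⟨se-se,⟩ a c η)) (η-mono {a = a} {c} c<a)

0<positive-η : {α : V n} → Positive α → 0ℚ < ⟨ α , η ⟩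
0<positive-η α⁺ = <-≤-trans 0<2 (positive-η α⁺)

simple-η : (i : Fin n) → ⟨ simple i , η ⟩ ≡ 2ℚ
simple-η i = let a , b , r , eq = simple-neighbours i in
  trans (cong ⟨_, η ⟩ eq) (trans (⟨se-se,⟩ a b η) (η-difference 1 a b r))

2<4 : 2ℚ < 2ℚ + 2ℚ
2<4 = fromℕ-mono-< {2} {4} (ℕ.s≤s (ℕ.s≤s (ℕ.s≤s ℕ.z≤n)))

neg-se : (a c : SignedIndex n) → -ᵥ (se a -ᵥ se c) ≡ se c -ᵥ se a
neg-se a c = go (se a) (se c)
  where
  go : ∀ {m} (u v : V m) → -ᵥ (u -ᵥ v) ≡ v -ᵥ u
  go []      []      = refl
  go (x ∷ u) (y ∷ v) = cong₂ _∷_ (solve 2 (λ x y → :- (x :- y) := y :- x) refl x y) (go u v)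

root-sign : {α : V n} → Root α → Positive α ⊎ Positive (-ᵥ α)
root-sign (a , c , a≢c , refl) with ℕₚ.<-cmp (rank a) (rank c)
... | tri< a<c _ _ = inj₂ (c , a , a<c , neg-se a c)
... | tri≈ _ eq _  = contradiction (rank-injective a c eq) a≢c
... | tri> _ _ c<a = inj₁ (a , c , c<a , refl)

0<⟨,η⟩⇒positive : {α : V n} → Root α → 0ℚ < ⟨ α , η ⟩ → Positive α
0<⟨,η⟩⇒positive {α = α} α∈ 0<α with root-sign α∈
... | inj₁ α⁺ = α⁺
... | inj₂ α⁻ = contradiction 0<α (<-asym (neg⇒<0 (subst (0ℚ <_) (⟨neg⟩ˡ α η) (0<positive-η α⁻))))

⟨,η⟩<0⇒negative : {α : V n} → Root α → ⟨ α , η ⟩ < 0ℚ → Positive (-ᵥ α)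
⟨,η⟩<0⇒negative {α = α} α∈ α<0 with root-sign α∈
... | inj₁ α⁺ = contradiction α<0 (<-asym (0<positive-η α⁺))
... | inj₂ α⁻ = α⁻

◃-injective : (w : W n) (a c : SignedIndex n) → a ◃ w ≡ c ◃ w → a ≡ c
◃-injective w (s , i) (t , j) eq with refl ← perm-injective w i j (cong proj₂ eq) =
  cong (_, i) (Signₚ.*-cancelʳ-≡ _ s t (cong proj₁ eq))

root-act : (w : W n) {α : V n} → Root α → Root (act w α)
root-act w (a , c , a≢c , refl) = a ◃ w ⁻¹ , c ◃ w ⁻¹ , a≢c ∘ ◃-injective (w ⁻¹) a c , ⟨⟩-ext λ v → begin
  ⟨ act w (se a -ᵥ se c) , v ⟩  ≡⟨ act-adjoint w (se a -ᵥ se c) v ⟩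
  ⟨ se a -ᵥ se c , act (w ⁻¹) v ⟩  ≡⟨ ⟨se-se,⟩ a c (act (w ⁻¹) v) ⟩
  act (w ⁻¹) v ⟦ a ⟧ - act (w ⁻¹) v ⟦ c ⟧  ≡⟨ cong₂ _-_ (act-⟦⟧ (w ⁻¹) v a) (act-⟦⟧ (w ⁻¹) v c) ⟩
  v ⟦ a ◃ w ⁻¹ ⟧ - v ⟦ c ◃ w ⁻¹ ⟧  ≡⟨ ⟨se-se,⟩ (a ◃ w ⁻¹) (c ◃ w ⁻¹) v ⟨
  ⟨ se (a ◃ w ⁻¹) -ᵥ se (c ◃ w ⁻¹) , v ⟩ ∎
  where open ≡-Reasoning

-- Comparison with the list of positive roots

rank⁻ : (i : Fin n) → rank (Sign.- , i) ≡ toℕ i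
rank⁻ {suc n} zero    = refl
rank⁻ {suc n} (suc i) = cong suc (rank⁻ i)

rank⁺ : (i : Fin n) → rank (Sign.+ , i) ℕ.+ suc (toℕ i) ≡ n ℕ.+ n
rank⁺ {suc n} zero    = cong suc (trans (ℕₚ.+-comm (n ℕ.+ n) 1) (sym (ℕₚ.+-suc n n)))
rank⁺ {suc n} (suc i) = cong suc (trans (ℕₚ.+-suc (rank (Sign.+ , i)) (suc (toℕ i)))
  (trans (cong suc (rank⁺ i)) (sym (ℕₚ.+-suc n n))))

rank⁻<rank⁺ : (i j : Fin n) → rank (Sign.- , i) ℕ.< rank (Sign.+ , j)
rank⁻<rank⁺ {n} i j = ℕₚ.+-cancelʳ-< (suc (toℕ j)) _ _
  (subst₂ (λ a b → a ℕ.+ suc (toℕ j) ℕ.< b) (sym (rank⁻ i)) (sym (rank⁺ j))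
    (ℕₚ.+-mono-<-≤ (Finₚ.toℕ<n i) (Finₚ.toℕ<n j)))

rank⁺-reflects : {i j : Fin n} → rank (Sign.+ , j) ℕ.< rank (Sign.+ , i) → i Fin.< j
rank⁺-reflects {i = i} {j} p with i Finₚ.<? j
... | yes i<j = i<j
... | no i≮j  = contradiction (trans (rank⁺ j) (sym (rank⁺ i)))
  (ℕₚ.<⇒≢ (ℕₚ.+-mono-<-≤ p (ℕ.s≤s (ℕₚ.≮⇒≥ i≮j))))

rank⁺-mono : {i j : Fin n} → i Fin.< j → rank (Sign.+ , j) ℕ.< rank (Sign.+ , i)
rank⁺-mono {i = i} {j} i<j with rank (Sign.+ , j) ℕₚ.<? rank (Sign.+ , i)
... | yes p = p
... | no ¬p = contradiction (trans (rank⁺ i) (sym (rank⁺ j)))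
  (ℕₚ.<⇒≢ (ℕₚ.+-mono-≤-< (ℕₚ.≮⇒≥ ¬p) (ℕ.s≤s i<j)))

se⁺ : (i : Fin n) → se (Sign.+ , i) ≡ e i
se⁺ i = Vecₚ.map-id (e i)

-ᵥ-neg : (u v : V n) → u -ᵥ (-ᵥ v) ≡ u +ᵥ v
-ᵥ-neg []      []      = refl
-ᵥ-neg (x ∷ u) (y ∷ v) = cong₂ _∷_ (solve 2 (λ x y → x :- (:- y) := x :+ y) refl x y) (-ᵥ-neg u v)

+ᵥ-comm : (u v : V n) → u +ᵥ v ≡ v +ᵥ u
+ᵥ-comm = Vecₚ.zipWith-comm ℚₚ.+-comm

+ᵥ-self : (v : V n) → v +ᵥ v ≡ 2ℚ · v
+ᵥ-self []      = refl
+ᵥ-self (x ∷ v) = cong₂ _∷_ (solve 1 (λ x → x :+ x := con 2ℚ :* x) refl x) (+ᵥ-self v)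

e+e : (i j : Fin n) → se (Sign.+ , i) -ᵥ se (Sign.- , j) ≡ e i +ᵥ e j
e+e i j = trans (cong (_-ᵥ se (Sign.- , j)) (se⁺ i)) (-ᵥ-neg (e i) (e j))

e-e : (i j : Fin n) → se (Sign.+ , i) -ᵥ se (Sign.+ , j) ≡ e i -ᵥ e j
e-e i j = cong₂ _-ᵥ_ (se⁺ i) (se⁺ j)

PositiveRoot⇒Positive : {α : V n} → PositiveRoot α → Positive α
PositiveRoot⇒Positive (long i) = (Sign.+ , i) , (Sign.- , i) , rank⁻<rank⁺ i i , sym (trans (e+e i i) (+ᵥ-self (e i)))
PositiveRoot⇒Positive (minus {i} {j} i<j) = (Sign.+ , i) , (Sign.+ , j) , rank⁺-mono i<j , sym (e-e i j)
PositiveRoot⇒Positive (plus {i} {j} i<j) = (Sign.+ , i) , (Sign.- , j) , rank⁻<rank⁺ j i , sym (e+e i j)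

Positive⇒PositiveRoot : {α : V n} → Positive α → PositiveRoot α
Positive⇒PositiveRoot ((Sign.+ , i) , (Sign.+ , j) , p , refl) =
  subst PositiveRoot (sym (e-e i j)) (minus (rank⁺-reflects p))
Positive⇒PositiveRoot ((Sign.+ , i) , (Sign.- , j) , p , refl) with Finₚ.<-cmp i j
... | tri< i<j _ _ = subst PositiveRoot (sym (e+e i j)) (plus i<j)
... | tri≈ _ refl _ = subst PositiveRoot (sym (trans (e+e i i) (+ᵥ-self (e i)))) (long i)
... | tri> _ _ j<i = subst PositiveRoot (sym (trans (e+e i j) (+ᵥ-comm (e i) (e j)))) (plus j<i)
Positive⇒PositiveRoot ((Sign.- , i) , (Sign.+ , j) , p , refl) = contradiction p (ℕₚ.<-asym (rank⁻<rank⁺ i j))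
Positive⇒PositiveRoot ((Sign.- , i) , (Sign.- , j) , p , refl) = subst PositiveRoot
  (sym (trans (-ᵥ-neg (-ᵥ e i) (e j)) (neg+ (e i) (e j))))
  (minus (subst₂ ℕ._<_ (rank⁻ j) (rank⁻ i) p))
  where
  neg+ : ∀ {m} (u v : V m) → (-ᵥ u) +ᵥ v ≡ v -ᵥ u
  neg+ []      []      = refl
  neg+ (x ∷ u) (y ∷ v) = cong₂ _∷_ (ℚₚ.+-comm (- x) y) (neg+ u v)

Φ⁺-short : {i j : Fin n} → i Fin.< j → {α : V n} → α ∈ (e i -ᵥ e j ∷ e i +ᵥ e j ∷ []) → α ∈ Φ⁺ n
Φ⁺-short {n} i<j α∈ = ∈-++⁺ʳ (List.map (λ i → 2ℚ · e i) (allFin n))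
  (∈-concatMap⁺ _ (lose (∈-filter⁺ (λ (i , j) → i Finₚ.<? j) (∈-cartesianProduct⁺ (∈-allFin _) (∈-allFin _)) i<j) α∈))

PositiveRoot⇒∈Φ⁺ : {α : V n} → PositiveRoot α → α ∈ Φ⁺ n
PositiveRoot⇒∈Φ⁺ (long i)    = Φ⁺-long i
PositiveRoot⇒∈Φ⁺ (minus i<j) = Φ⁺-short i<j (here refl)
PositiveRoot⇒∈Φ⁺ (plus i<j)  = Φ⁺-short i<j (there (here refl))

positive-∈Φ⁺ : {α : V n} → Positive α → α ∈ Φ⁺ n
positive-∈Φ⁺ = PositiveRoot⇒∈Φ⁺ ∘ Positive⇒PositiveRoot

∈Φ⁺-positive : {α : V n} → α ∈ Φ⁺ n → Positive α
∈Φ⁺-positive = PositiveRoot⇒Positive ∘ Φ⁺-cases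

root-simple : (i : Fin n) → Root (simple i)
root-simple i = positive-root (positive-simple i)

Negative⇔ : {α : V n} → Root α → Negative α ⇔ ⟨ α , η ⟩ < 0ℚ
Negative⇔ {α = α} α∈ = mk⇔
  (λ neg → neg⇒<0 (subst (0ℚ <_) (⟨neg⟩ˡ α η) (0<positive-η (∈Φ⁺-positive neg))))
  (λ α<0 → positive-∈Φ⁺ (⟨,η⟩<0⇒negative α∈ α<0))

-- Descents become signs of pairings with `η`, the form in which they can be compared with signs of
-- roots at points.
∈Des⇔ : (w : W n) (i : Fin n) → i Subset.∈ Des w ⇔ ⟨ act w (simple i) , η ⟩ < 0ℚ
∈Des⇔ w i = mk⇔ to from
  where
  open Equivalence (Negative⇔ (root-act w (root-simple i))) renaming (to to neg⇒; from to ⇒neg)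
  to : i Subset.∈ Des w → ⟨ act w (simple i) , η ⟩ < 0ℚ
  to i∈ with negative? (act w (simple i)) | trans (sym (Vecₚ.lookup∘tabulate (λ i → does (negative? (act w (simple i)))) i)) (Vecₚ.[]=⇒lookup i∈)
  ... | yes neg | _ = neg⇒ neg
  ... | no _    | ()
  from : ⟨ act w (simple i) , η ⟩ < 0ℚ → i Subset.∈ Des w
  from p = Vecₚ.lookup⇒[]= i (Des w) (trans (Vecₚ.lookup∘tabulate _ i) (Dec.dec-true (negative? _) (⇒neg p)))

-- Reflections as signed permutations

lookup-sub : (u v : V n) (i : Fin n) → lookup (u -ᵥ v) i ≡ lookup u i - lookup v i
lookup-sub u v i = Vecₚ.lookup-zipWith _-_ i u v

lookup-· : (c : ℚ) (v : V n) (i : Fin n) → lookup (c · v) i ≡ c * lookup v i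
lookup-· c v i = Vecₚ.lookup-map i (c *_) v

-- Reflection in eᵢ - t eⱼ, as a signed permutation.
module _ {i j : Fin n} (i<j : i Fin.< j) (t : Sign) where
  transposition-act : Fin n → Sign × Fin n
  transposition-act l with l Finₚ.≟ i | l Finₚ.≟ j
  ... | yes _ | _     = t , j
  ... | no _  | yes _ = t , i
  ... | no _  | no _  = Sign.+ , l

  private
    σ : Fin n → Fin n
    σ = proj₂ ∘ transposition-act

    σ-involutive : ∀ l → σ (σ l) ≡ l
    σ-involutive l with l Finₚ.≟ i | l Finₚ.≟ j
    σ-involutive l | yes refl | _ with j Finₚ.≟ i | j Finₚ.≟ j
    ... | yes j≡i | _      = j≡i
    ... | no _    | yes _  = refl
    ... | no _    | no j≢j = contradiction refl j≢j
    σ-involutive l | no _ | yes refl with i Finₚ.≟ i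
    ... | yes _   = refl
    ... | no i≢i = contradiction refl i≢i
    σ-involutive l | no l≢i | no l≢j with l Finₚ.≟ i | l Finₚ.≟ j
    ... | yes l≡i | _       = contradiction l≡i l≢i
    ... | no _    | yes l≡j = contradiction l≡j l≢j
    ... | no _    | no _    = refl

  transposition : W n
  transposition = record
    { perm      = tabulate σ
    ; sign      = tabulate (proj₁ ∘ transposition-act)
    ; injective = λ l m eq → trans (sym (σ-involutive l))
        (trans (cong σ (trans (sym (Vecₚ.lookup∘tabulate σ l)) (trans eq (Vecₚ.lookup∘tabulate σ m)))) (σ-involutive m))
    }

  act-transposition : (v : V n) →
    act transposition v ≡ v -ᵥ ⟨ v , e i -ᵥ Vec.map (signed t) (e j) ⟩ · (e i -ᵥ Vec.map (signed t) (e j))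
  act-transposition v = lookup-ext λ l → trans
    (trans (lookup-act transposition v l)
      (cong₂ (λ s m → signed s (lookup v m)) (Vecₚ.lookup∘tabulate (proj₁ ∘ transposition-act) l) (Vecₚ.lookup∘tabulate σ l)))
    (trans (entry l) (sym (trans (lookup-sub v _ l) (cong (λ q → lookup v l - q)
      (trans (lookup-· ⟨ v , α ⟩ α l) (cong₂ _*_ pairing (trans (lookup-sub (e i) (Vec.map (signed t) (e j)) l)
        (cong (λ q → lookup (e i) l - q) (Vecₚ.lookup-map l (signed t) (e j))))))))))
    where
    α : V n
    α = e i -ᵥ Vec.map (signed t) (e j)
    pairing : ⟨ v , e i -ᵥ Vec.map (signed t) (e j) ⟩ ≡ lookup v i - signed t (lookup v j)
    pairing = trans (⟨⟩-comm v _) (trans (⟨-⟩ˡ (e i) _ v) (cong₂ _-_ (⟨e,⟩ i v) (⟨se,⟩ (t , j) v)))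
    entry-j : ∀ t x y → signed t x ≡ y - (x - signed t y) * (0ℚ - signed t 1ℚ)
    entry-j Sign.+ = solve 2 (λ x y → x := y :- (x :- y) :* (con 0ℚ :- con 1ℚ)) refl
    entry-j Sign.- = solve 2 (λ x y → :- x := y :- (x :- (:- y)) :* (con 0ℚ :- (:- con 1ℚ))) refl
    entry-l : ∀ t x z → z ≡ z - x * (0ℚ - signed t 0ℚ)
    entry-l Sign.+ = solve 2 (λ x z → z := z :- x :* (con 0ℚ :- con 0ℚ)) refl
    entry-l Sign.- = solve 2 (λ x z → z := z :- x :* (con 0ℚ :- (:- con 0ℚ))) refl
    entry-i : ∀ t x y → signed t y ≡ x - (x - signed t y) * (1ℚ - signed t 0ℚ)
    entry-i Sign.+ = solve 2 (λ x y → y := x :- (x :- y) :* (con 1ℚ :- con 0ℚ)) refl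
    entry-i Sign.- = solve 2 (λ x y → :- y := x :- (x :- (:- y)) :* (con 1ℚ :- (:- con 0ℚ))) refl
    entry : ∀ l → signed (proj₁ (transposition-act l)) (lookup v (σ l)) ≡
      lookup v l - (lookup v i - signed t (lookup v j)) * (lookup (e i) l - signed t (lookup (e j) l))
    entry l with l Finₚ.≟ i | l Finₚ.≟ j
    ... | yes refl | _ rewrite lookup-e-≡ i | lookup-e-≢ j i (i≢j i<j ∘ sym) = entry-i t (lookup v i) (lookup v j)
    ... | no _ | yes refl rewrite lookup-e-≡ j | lookup-e-≢ i j (i≢j i<j) = entry-j t (lookup v i) (lookup v j)
    ... | no l≢i | no l≢j rewrite lookup-e-≢ i l (l≢i ∘ sym) | lookup-e-≢ j l (l≢j ∘ sym) = entry-l t (lookup v i - signed t (lookup v j)) (lookup v l)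

signChange : Fin n → W n
signChange {n} i = record
  { perm      = Vec.allFin n
  ; sign      = tabulate λ l → if does (l Finₚ.≟ i) then Sign.- else Sign.+
  ; injective = λ l m eq → trans (sym (Vecₚ.lookup-allFin l)) (trans eq (Vecₚ.lookup-allFin m))
  }

act-signChange : (i : Fin n) (v : V n) → act (signChange i) v ≡ v -ᵥ ⟨ v , e i ⟩ · 2ℚ · e i
act-signChange i v = lookup-ext λ l → trans
  (trans (lookup-act (signChange i) v l)
    (cong₂ (λ s m → signed s (lookup v m)) (Vecₚ.lookup∘tabulate _ l) (Vecₚ.lookup-allFin l)))
  (trans (entry l) (sym (trans (lookup-sub v _ l) (cong (λ q → lookup v l - q)
    (trans (lookup-· ⟨ v , e i ⟩ (2ℚ · e i) l) (cong₂ _*_ (trans (⟨⟩-comm v (e i)) (⟨e,⟩ i v)) (lookup-· 2ℚ (e i) l)))))))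
  where
  entry : ∀ l → signed (if does (l Finₚ.≟ i) then Sign.- else Sign.+) (lookup v l) ≡
    lookup v l - lookup v i * (2ℚ * lookup (e i) l)
  entry l with l Finₚ.≟ i
  ... | yes refl rewrite lookup-e-≡ i = solve 1 (λ x → :- x := x :- x :* (con 2ℚ :* con 1ℚ)) refl (lookup v i)
  ... | no l≢i rewrite lookup-e-≢ i l (l≢i ∘ sym) =
    solve 2 (λ x y → y := y :- x :* (con 2ℚ :* con 0ℚ)) refl (lookup v i) (lookup v l)

reflection′ : {α : V n} → PositiveRoot α → ∃ λ s → ∀ v → act s v ≡ reflect α v
reflection′ (long i) = signChange i , λ v → trans (act-signChange i v)
  (cong (λ u → v -ᵥ ⟨ v , u ⟩ · 2ℚ · e i) (sym (coroot-long i)))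
reflection′ (minus {i} {j} i<j) = transposition i<j Sign.+ , λ v → trans (act-transposition i<j Sign.+ v)
  (trans (cong (λ u → v -ᵥ ⟨ v , e i -ᵥ u ⟩ · (e i -ᵥ u)) (se⁺ j))
         (cong (λ u → v -ᵥ ⟨ v , u ⟩ · (e i -ᵥ e j)) (sym (coroot-minus i<j))))
reflection′ (plus {i} {j} i<j) = transposition i<j Sign.- , λ v → trans (act-transposition i<j Sign.- v)
  (trans (cong (λ u → v -ᵥ ⟨ v , u ⟩ · u) (-ᵥ-neg (e i) (e j)))
         (cong (λ u → v -ᵥ ⟨ v , u ⟩ · (e i +ᵥ e j)) (sym (coroot-plus i<j))))

abstract
  reflection : {α : V n} → Positive α → ∃ λ s → ∀ v → act s v ≡ reflect α v
  reflection = reflection′ ∘ Positive⇒PositiveRoot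

-- Order and positivity

≤⇒≯ : ∀ {p q} → p ≤ q → ¬ q < p
≤⇒≯ p≤q q<p = ℚₚ.<-irrefl refl (<-≤-trans q<p p≤q)

p≤q⇒0≤q-p : ∀ {p q} → p ≤ q → 0ℚ ≤ q - p
p≤q⇒0≤q-p {p} {q} p≤q = subst (_≤ q - p) (+-inverseʳ p) (+-monoˡ-≤ (- p) p≤q)

*-nonneg : ∀ {p q} → 0ℚ ≤ p → 0ℚ ≤ q → 0ℚ ≤ p * q
*-nonneg {p} {q} 0≤p 0≤q = subst (_≤ p * q) (*-zeroʳ p) (ℚₚ.*-monoˡ-≤-nonNeg p {{nonNegative 0≤p}} 0≤q)

*-pos : ∀ {p q} → 0ℚ < p → 0ℚ < q → 0ℚ < p * q
*-pos {p} {q} 0<p 0<q = subst (_< p * q) (*-zeroʳ p) (ℚₚ.*-monoʳ-<-pos p {{positive 0<p}} 0<q)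

*-zero : ∀ p q → p * q ≡ 0ℚ → p ≡ 0ℚ ⊎ q ≡ 0ℚ
*-zero p q eq with p ℚₚ.≟ 0ℚ
... | yes p≡0 = inj₁ p≡0
... | no p≢0  = inj₂ (begin
  q  ≡⟨ *-identityˡ q ⟨
  1ℚ * q  ≡⟨ cong (_* q) (inverse p p≢0) ⟨
  p * r * q  ≡⟨ solve 3 (λ p r q → p :* r :* q := r :* (p :* q)) refl p r q ⟩
  r * (p * q)  ≡⟨ cong (r *_) eq ⟩
  r * 0ℚ  ≡⟨ *-zeroʳ r ⟩
  0ℚ  ∎)
  where
  open ≡-Reasoning
  r : ℚ
  r = (1/ p) {{≢-nonZero p≢0}}

*-cancel-nonneg : ∀ {p q} → 0ℚ < p → 0ℚ ≤ p * q → 0ℚ ≤ q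
*-cancel-nonneg {p} {q} 0<p 0≤pq = ℚₚ.*-cancelˡ-≤-pos p {{positive 0<p}} (subst (_≤ p * q) (sym (*-zeroʳ p)) 0≤pq)

*-cancel-pos : ∀ {p q} → 0ℚ < p → 0ℚ < p * q → 0ℚ < q
*-cancel-pos {p} {q} 0<p 0<pq = ≤∧≢⇒< (*-cancel-nonneg 0<p (<⇒≤ 0<pq))
  λ { refl → <⇒≢ 0<pq (sym (*-zeroʳ p)) }

⟨⟩-self-nonneg : (v : V n) → 0ℚ ≤ ⟨ v , v ⟩
⟨⟩-self-nonneg []      = ℚₚ.≤-refl
⟨⟩-self-nonneg (x ∷ v) = +-mono-≤ (square-nonneg x) (⟨⟩-self-nonneg v)
  where
  square-nonneg : ∀ x → 0ℚ ≤ x * x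
  square-nonneg x with ℚₚ.≤-total 0ℚ x
  ... | inj₁ 0≤x = *-nonneg 0≤x 0≤x
  ... | inj₂ x≤0 = subst (0ℚ ≤_) (solve 1 (λ x → (:- x) :* (:- x) := x :* x) refl x)
                     (*-nonneg (neg-antimono-≤ x≤0) (neg-antimono-≤ x≤0))

sum-zero : ∀ {p q} → 0ℚ ≤ p → 0ℚ ≤ q → p + q ≡ 0ℚ → p ≡ 0ℚ × q ≡ 0ℚ
sum-zero {p} {q} 0≤p 0≤q eq = ℚₚ.≤-antisym (bound 0≤q eq) 0≤p ,
  ℚₚ.≤-antisym (bound 0≤p (trans (ℚₚ.+-comm q p) eq)) 0≤q
  where
  bound : ∀ {p q} → 0ℚ ≤ q → p + q ≡ 0ℚ → p ≤ 0ℚ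
  bound {p} 0≤q eq = subst₂ _≤_ (+-identityʳ p) eq (ℚₚ.+-monoʳ-≤ p 0≤q)

⟨⟩-definite : (v : V n) → ⟨ v , v ⟩ ≡ 0ℚ → v ≡ 0ᵥ
⟨⟩-definite []      _  = refl
⟨⟩-definite (x ∷ v) eq with p , q ← sum-zero (subst (0ℚ ≤_) (+-identityʳ (x * x)) (⟨⟩-self-nonneg (x ∷ []))) (⟨⟩-self-nonneg v) eq =
  cong₂ _∷_ ([ (λ z → z) , (λ z → z) ]′ (*-zero x x p)) (⟨⟩-definite v q)

⟨⟩-nonneg : (u v : V n) → (∀ i → 0ℚ ≤ lookup u i) → (∀ i → 0ℚ ≤ lookup v i) → 0ℚ ≤ ⟨ u , v ⟩
⟨⟩-nonneg []      []      p q = ℚₚ.≤-refl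
⟨⟩-nonneg (x ∷ u) (y ∷ v) p q =
  +-mono-≤ (*-nonneg (p zero) (q zero)) (⟨⟩-nonneg u v (p ∘ suc) (q ∘ suc))

-- Regularity of `η` and the group laws

positive-dominant : {d α : V n} → Dominant d → Positive α → 0ℚ ≤ ⟨ α , d ⟩
positive-dominant {d = d} dom = positive-induction (λ α → 0ℚ ≤ ⟨ α , d ⟩) dom
  λ {β} {γ} _ _ p q → subst (0ℚ ≤_) (sym (⟨+⟩ˡ β γ d)) (+-mono-≤ p q)

dominant-nonneg : {d : V n} → Dominant d → ∀ i → 0ℚ ≤ lookup d i
dominant-nonneg {d = d} dom i = halve (subst (0ℚ ≤_)
  (trans (⟨·⟩ˡ 2ℚ (e i) d) (cong (2ℚ *_) (⟨e,⟩ i d))) (positive-dominant dom (PositiveRoot⇒Positive (long i))))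

η-dominant : Dominant (η {n})
η-dominant i = subst (0ℚ ≤_) (sym (simple-η i)) (<⇒≤ 0<2)

-- No root pairs with `η` to a value strictly between -2 and 2. This gap turns weak inequalities
-- into the bound 2.
root-regular : {α : V n} → Root α → 0ℚ ≤ ⟨ α , η ⟩ → 2ℚ ≤ ⟨ α , η ⟩
root-regular {α = α} α∈ 0≤α with root-sign α∈
... | inj₁ α⁺ = positive-η α⁺
... | inj₂ α⁻ = contradiction (neg⇒<0 (subst (0ℚ <_) (⟨neg⟩ˡ α η) (0<positive-η α⁻))) (≤⇒≯ 0≤α)

-- The 2n numbers ± ηᵢ are distinct, so the entries of `act w η` reveal both the permutation and the
-- signs. Equality in the group can therefore be tested on a single vector.
act-faithful : {w u : W n} → act w η ≡ act u η → w ≡ u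
act-faithful {n} {w@(signedPerm π s _)} {u@(signedPerm π′ s′ _)} eq =
  W-≡ (lookup-ext (cong proj₂ ∘ index)) (lookup-ext (cong proj₁ ∘ index))
  where
  W-≡ : {w u : W n} → W.perm w ≡ W.perm u → W.sign w ≡ W.sign u → w ≡ u
  W-≡ {signedPerm _ _ _} {signedPerm _ _ _} refl refl = refl
  index : ∀ i → (Sign.+ , i) ◃ w ≡ (Sign.+ , i) ◃ u
  index i = rank-injective _ _ (double (fromℕ-injective (begin
    fromℕ (suc (rank wi ℕ.+ rank wi))  ≡⟨ η-rank wi ⟨
    η ⟦ wi ⟧ + fromℕ (n ℕ.+ n)  ≡⟨ cong (_+ fromℕ (n ℕ.+ n)) (trans (sym (lookup-act w η i)) (trans (cong (λ v → lookup v i) eq) (lookup-act u η i))) ⟩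
    η ⟦ ui ⟧ + fromℕ (n ℕ.+ n)  ≡⟨ η-rank ui ⟩
    fromℕ (suc (rank ui ℕ.+ rank ui))  ∎)))
    where
    open ≡-Reasoning
    wi ui : SignedIndex n
    wi = (Sign.+ , i) ◃ w
    ui = (Sign.+ , i) ◃ u
    double : ∀ {a b} → suc (a ℕ.+ a) ≡ suc (b ℕ.+ b) → a ≡ b
    double {a} {b} eq with ℕₚ.<-cmp a b
    ... | tri< a<b _ _ = contradiction (ℕₚ.suc-injective eq) (ℕₚ.<⇒≢ (ℕₚ.+-mono-< a<b a<b))
    ... | tri≈ _ a≡b _ = a≡b
    ... | tri> _ _ b<a = contradiction (sym (ℕₚ.suc-injective eq)) (ℕₚ.<⇒≢ (ℕₚ.+-mono-< b<a b<a))

W-ext : {w u : W n} → (∀ v → act w v ≡ act u v) → w ≡ u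
W-ext eq = act-faithful (eq η)

∙-assoc : (w u v : W n) → w ∙ u ∙ v ≡ w ∙ (u ∙ v)
∙-assoc w u v = W-ext λ x → begin
  act (w ∙ u ∙ v) x  ≡⟨ act-∙ (w ∙ u) v x ⟩
  act (w ∙ u) (act v x)  ≡⟨ act-∙ w u (act v x) ⟩
  act w (act u (act v x)) ≡⟨ cong (act w) (act-∙ u v x) ⟨
  act w (act (u ∙ v) x)  ≡⟨ act-∙ w (u ∙ v) x ⟨
  act (w ∙ (u ∙ v)) x  ∎
  where open ≡-Reasoning

∙-identityˡ : (w : W n) → ε ∙ w ≡ w
∙-identityˡ w = W-ext λ x → trans (act-∙ ε w x) (act-ε (act w x))

∙-identityʳ : (w : W n) → w ∙ ε ≡ w
∙-identityʳ w = W-ext λ x → trans (act-∙ w ε x) (cong (act w) (act-ε x))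

∙-inverseˡ : (w : W n) → w ⁻¹ ∙ w ≡ ε
∙-inverseˡ w = W-ext λ x → trans (act-∙ (w ⁻¹) w x) (trans (act-⁻¹ˡ w x) (sym (act-ε x)))

∙-inverseʳ : (w : W n) → w ∙ w ⁻¹ ≡ ε
∙-inverseʳ w = W-ext λ x → trans (act-∙ w (w ⁻¹) x) (trans (act-⁻¹ʳ w x) (sym (act-ε x)))

⁻¹-involutive : (w : W n) → w ⁻¹ ⁻¹ ≡ w
⁻¹-involutive w = W-ext λ x → trans (cong (act (w ⁻¹ ⁻¹)) (sym (act-⁻¹ˡ w x))) (act-⁻¹ˡ (w ⁻¹) (act w x))

∙≡ε⇒≡⁻¹ : {w u : W n} → w ∙ u ≡ ε → u ≡ w ⁻¹
∙≡ε⇒≡⁻¹ {w = w} {u} eq = W-ext λ x → trans (sym (act-⁻¹ˡ w (act u x)))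
  (cong (act (w ⁻¹)) (trans (sym (act-∙ w u x)) (trans (cong (λ y → act y x) eq) (act-ε x))))

-- If xη is dominant then so is u = xη - η, as ⟨αᵢ , xη⟩ ≥ 2 by regularity. Hence
-- 0 = |xη|² - |η|² = 2⟨u , η⟩ + |u|² forces u = 0.
dominant-regular : {x : W n} → Dominant (act x η) → x ≡ ε
dominant-regular {n} {x} dom = act-faithful (trans xη≡η (sym (act-ε η)))
  where
  u : V n
  u = act x η -ᵥ η
  u-dominant : Dominant u
  u-dominant i = subst (0ℚ ≤_) (sym (trans (⟨⟩-comm (simple i) u) (trans (⟨-⟩ˡ (act x η) η (simple i))
    (cong₂ _-_ (⟨⟩-comm (act x η) (simple i)) (trans (⟨⟩-comm η (simple i)) (simple-η i))))))
    (p≤q⇒0≤q-p (subst (2ℚ ≤_) (act-adjoint′ x (simple i) η)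
      (root-regular (root-act (x ⁻¹) (root-simple i)) (subst (0ℚ ≤_) (sym (act-adjoint′ x (simple i) η)) (dom i)))))
  split : ∀ {m} (a b : V m) → a ≡ (a -ᵥ b) +ᵥ b
  split []      []      = refl
  split (x ∷ a) (y ∷ b) = cong₂ _∷_ (solve 2 (λ x y → x := (x :- y) :+ y) refl x y) (split a b)
  expand : ⟨ η {n} , η ⟩ ≡ (⟨ u , u ⟩ + ⟨ u , η ⟩) + (⟨ u , η ⟩ + ⟨ η {n} , η ⟩)
  expand = trans (sym (act-⟨⟩ x η η)) (trans (cong (λ v → ⟨ v , v ⟩) (split (act x η) η))
    (trans (⟨+⟩ˡ u η (u +ᵥ η)) (cong₂ _+_ (⟨⟩-+ u u η) (trans (⟨⟩-+ η u η) (cong (_+ ⟨ η {n} , η ⟩) (⟨⟩-comm η u))))))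
  norm : (⟨ u , η ⟩ + ⟨ u , η ⟩) + ⟨ u , u ⟩ ≡ 0ℚ
  norm = trans (solve 3 (λ x y z → (x :+ x) :+ y := ((y :+ x) :+ (x :+ z)) :- z) refl (⟨ u , η ⟩) (⟨ u , u ⟩) (⟨ η {n} , η ⟩))
    (trans (cong (λ q → q - ⟨ η {n} , η ⟩) (sym expand)) (+-inverseʳ (⟨ η {n} , η ⟩)))
  -- Dominant vectors have nonnegative coordinates, because 2eᵢ is a positive root; so two of them
  -- have a nonnegative scalar product.
  0≤uη : 0ℚ ≤ ⟨ u , η ⟩
  0≤uη = ⟨⟩-nonneg u η (dominant-nonneg u-dominant) (dominant-nonneg η-dominant)
  xη≡η : act x η ≡ η
  xη≡η = trans (split (act x η) η) (trans
    (cong (_+ᵥ η) (⟨⟩-definite u (proj₂ (sum-zero (+-mono-≤ 0≤uη 0≤uη) (⟨⟩-self-nonneg u) norm))))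
    (+ᵥ-identityˡ η))

-- What the arguments below use of a coroot: it is a positive multiple of the root, with pairing 2.
-- Long and short roots are treated alike. The root is nonzero since it pairs positively with `η`.
coroot-pairing : {α : V n} → Positive α →
  ∃ λ c → 0ℚ < c × c * ⟨ α , α ⟩ ≡ 2ℚ × ∀ v → ⟨ v , coroot α ⟩ ≡ c * ⟨ α , v ⟩
coroot-pairing {n} {α} α⁺ = c , *-cancel-pos (≤∧≢⇒< (⟨⟩-self-nonneg α) (αα≢0 ∘ sym)) (subst (0ℚ <_) (sym scale) 0<2) ,
  trans (*-comm c ⟨ α , α ⟩) scale , λ v → trans (⟨⟩-· v c α) (cong (c *_) (⟨⟩-comm v α))
  where
  c : ℚ
  c = 2ℚ ÷₀ ⟨ α , α ⟩
  αα≢0 : ⟨ α , α ⟩ ≢ 0ℚ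
  αα≢0 eq = <⇒≢ (0<positive-η α⁺) (sym (trans (cong ⟨_, η ⟩ (⟨⟩-definite α eq)) (⟨0,⟩ (η {n}))))
  scale : ⟨ α , α ⟩ * c ≡ 2ℚ
  scale = ÷₀-* 2ℚ ⟨ α , α ⟩ αα≢0

reflect-fixes : {α : V n} → Positive α → {v : V n} → ⟨ α , v ⟩ ≡ 0ℚ → reflect α v ≡ v
reflect-fixes {n} {α} α⁺ {v} eq = trans (cong (λ q → v -ᵥ q · α) vanish) (sub-0· v α)
  where
  sub-0· : ∀ {m} (v α : V m) → v -ᵥ 0ℚ · α ≡ v
  sub-0· []      []      = refl
  sub-0· (x ∷ v) (y ∷ α) = cong₂ _∷_ (solve 2 (λ x y → x :- con 0ℚ :* y := x) refl x y) (sub-0· v α)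
  vanish : ⟨ v , coroot α ⟩ ≡ 0ℚ
  vanish = let c , _ , _ , pairing = coroot-pairing α⁺ in trans (pairing v) (0c c _ eq)

⟨,reflect⟩ : (u α v : V n) → ⟨ u , reflect α v ⟩ ≡ ⟨ u , v ⟩ - ⟨ v , coroot α ⟩ * ⟨ u , α ⟩
⟨,reflect⟩ u α v = trans (⟨⟩-comm u (reflect α v)) (trans (⟨-⟩ˡ v _ u) (cong₂ _-_ (⟨⟩-comm v u)
  (trans (⟨·⟩ˡ ⟨ v , coroot α ⟩ α u) (cong (⟨ v , coroot α ⟩ *_) (⟨⟩-comm α u)))))

-- Pairing v and its reflection with `η` shows that the coefficient of α times the pairing of α with
-- `η` vanishes, and the latter is positive.
fixed-by-reflection : {α : V n} → Positive α → {v : V n} → reflect α v ≡ v → ⟨ α , v ⟩ ≡ 0ℚ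
fixed-by-reflection {n} {α} α⁺ {v} eq with coroot-pairing α⁺
... | c , 0<c , _ , pairing = [ (λ c≡0 → contradiction (sym c≡0) (<⇒≢ 0<c)) , (λ z → z) ]′
  (*-zero c ⟨ α , v ⟩ ([ (λ z → trans (sym (pairing v)) z) , (λ η≡0 → contradiction (sym η≡0) (<⇒≢ 0<η)) ]′
    (*-zero ⟨ v , coroot α ⟩ ⟨ η , α ⟩ vanish)))
  where
  0<η : 0ℚ < ⟨ η , α ⟩
  0<η = subst (0ℚ <_) (⟨⟩-comm α η) (0<positive-η α⁺)
  vanish : ⟨ v , coroot α ⟩ * ⟨ η , α ⟩ ≡ 0ℚ
  vanish = trans (solve 2 (λ a b → b := a :- (a :- b)) refl ⟨ η , v ⟩ _)
    (trans (cong (λ q → ⟨ η , v ⟩ - q) (trans (sym (⟨,reflect⟩ η α v)) (cong ⟨ η ,_⟩ eq))) (+-inverseʳ ⟨ η , v ⟩))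

reflect-involutive : {α : V n} → Positive α → (v : V n) → reflect α (reflect α v) ≡ v
reflect-involutive {n} {α} α⁺ v = trans (cong (λ q → reflect α v -ᵥ q · α) flipped) (undo v α)
  where
  q : ℚ
  q = ⟨ v , coroot α ⟩
  undo : ∀ {m} (v α : V m) → v -ᵥ q · α -ᵥ (- q) · α ≡ v
  undo []      []      = refl
  undo (x ∷ v) (y ∷ α) = cong₂ _∷_ (solve 3 (λ x y q → x :- q :* y :- (:- q) :* y := x) refl x y q) (undo v α)
  αα^ : ⟨ α , coroot α ⟩ ≡ 2ℚ
  αα^ = let _ , _ , c≡2 , pairing = coroot-pairing α⁺ in trans (pairing α) c≡2
  flipped : ⟨ reflect α v , coroot α ⟩ ≡ - q
  flipped = trans (⟨-⟩ˡ v (q · α) (coroot α)) (trans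
    (cong (λ r → q - r) (trans (⟨·⟩ˡ q α (coroot α)) (cong (q *_) αα^)))
    (solve 1 (λ q → q :- q :* con 2ℚ := :- q) refl q))

-- Reflection in a simple root lowers the pairing with `η` by a positive multiple of the pairing of
-- v with that root. Hence a point where no simple reflection raises the pairing is dominant.
reflection-ascent : (i : Fin n) {v : V n} → ⟨ η , reflect (simple i) v ⟩ ≤ ⟨ η , v ⟩ → 0ℚ ≤ ⟨ simple i , v ⟩
reflection-ascent {n} i {v} p with coroot-pairing (positive-simple i)
... | c , 0<c , _ , pairing = *-cancel-nonneg 0<c (*-cancel-nonneg 0<2 (subst (0ℚ ≤_) drop (p≤q⇒0≤q-p p)))
  where
  α : V n
  α = simple i
  drop : ⟨ η , v ⟩ - ⟨ η , reflect α v ⟩ ≡ 2ℚ * (c * ⟨ α , v ⟩)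
  drop = trans (cong (λ q → ⟨ η , v ⟩ - q) (trans (⟨,reflect⟩ η α v)
    (cong₂ (λ q r → ⟨ η , v ⟩ - q * r) (pairing v)
       (trans (⟨⟩-comm η α) (simple-η i)))))
    (solve 3 (λ x c y → x :- (x :- c :* y :* con 2ℚ) := con 2ℚ :* (c :* y)) refl (⟨ η , v ⟩) c (⟨ α , v ⟩))

-- Dominant vectors and parabolic subgroups

-- α is positive on w (t + ϵη) for small ϵ > 0.
LexPositive : W n → V n → V n → Set
LexPositive w t α = 0ℚ < ⟨ α , act w t ⟩ ⊎ (⟨ α , act w t ⟩ ≡ 0ℚ × 0ℚ < ⟨ α , act w η ⟩)

LexDominant : W n → V n → Set
LexDominant w t = ∀ i → LexPositive w t (simple i)

-- The vector `act w η` lies on no root hyperplane: `w ⁻¹` would carry such a root to one orthogonal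
-- to `η`.
root-act⁻¹ : (w : W n) {α : V n} → Root α → ⟨ α , act w η ⟩ ≡ 0ℚ → ∀ {X : Set} → X
root-act⁻¹ w {α} α∈ eq with root-sign (root-act (w ⁻¹) α∈)
... | inj₁ β⁺ = contradiction (trans (act-adjoint′ w α η) eq) (<⇒≢ (0<positive-η β⁺) ∘ sym)
... | inj₂ β⁻ = contradiction (trans (⟨neg⟩ˡ (act (w ⁻¹) α) η) (cong -_ (trans (act-adjoint′ w α η) eq)))
                  (<⇒≢ (0<positive-η β⁻) ∘ sym)

-- Maximise the pairing of `η` with `act w t`, and among the maximisers that with `act w η`. The two
-- maxima are the leading term and the tie break of dominance at t + ϵη.
lexDominant-exists : (t : V n) → ∃ λ w → LexDominant w t
lexDominant-exists {n} t = from-max₀ (maximiser (λ w → ⟨ η , act w t ⟩) {λ w → w ≡ w} (λ w → w ≟w w) ∈-elements (ε , refl))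
  where
  module _ {w₀ w : W n} (max₀ : ∀ u → u ≡ u → ⟨ η , act u t ⟩ ≤ ⟨ η , act w₀ t ⟩) (eq : ⟨ η , act w t ⟩ ≡ ⟨ η , act w₀ t ⟩)
    (max : ∀ u → ⟨ η , act u t ⟩ ≡ ⟨ η , act w₀ t ⟩ → ⟨ η {n} , act u η ⟩ ≤ ⟨ η {n} , act w η ⟩) (i : Fin n) where
    s : W n
    s = proj₁ (reflection (positive-simple i))
    act-s : ∀ v → act s v ≡ reflect (simple i) v
    act-s = proj₂ (reflection (positive-simple i))
    act-sw : ∀ v → act (s ∙ w) v ≡ reflect (simple i) (act w v)
    act-sw v = trans (act-∙ s w v) (act-s (act w v))
    first : 0ℚ ≤ ⟨ simple i , act w t ⟩
    first = reflection-ascent i (subst₂ _≤_ (cong ⟨ η ,_⟩ (act-sw t)) (sym eq) (max₀ (s ∙ w) refl))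
    -- When the simple root vanishes at `act w t`, the reflection does not move that point, so
    -- `s ∙ w` is again a first maximiser and the second maximum applies to it.
    second : ⟨ simple i , act w t ⟩ ≡ 0ℚ → 0ℚ < ⟨ simple i , act w η ⟩
    second on = ≤∧≢⇒< (reflection-ascent i (subst (_≤ ⟨ η {n} , act w η ⟩) (cong ⟨ η ,_⟩ (act-sw η))
        (max (s ∙ w) (trans (cong ⟨ η ,_⟩ (trans (act-sw t) (reflect-fixes (positive-simple i) on))) eq))))
      (λ 0≡ → root-act⁻¹ w (root-simple i) (sym 0≡))
    lex : LexPositive w t (simple i)
    lex with ⟨ simple i , act w t ⟩ ℚₚ.≟ 0ℚ
    ... | yes on = inj₂ (on , second on)
    ... | no off = inj₁ (≤∧≢⇒< first (off ∘ sym))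
  from-max₀ : (∃ λ w₀ → w₀ ≡ w₀ × (∀ u → u ≡ u → ⟨ η , act u t ⟩ ≤ ⟨ η , act w₀ t ⟩)) → ∃ λ w → LexDominant w t
  from-max₀ (w₀ , _ , max₀) =
    let w , eq , max = maximiser (λ w → ⟨ η {n} , act w η ⟩) (λ w → ⟨ η , act w t ⟩ ℚₚ.≟ ⟨ η , act w₀ t ⟩) ∈-elements (w₀ , refl)
    in w , lex {w₀} {w} max₀ eq max

module _ {w : W n} {t : V n} (lex : LexDominant w t) where

  lex-positive : {α : V n} → Positive α → LexPositive w t α
  lex-positive = positive-induction (LexPositive w t) lex λ {β} {γ} _ _ → step β γ
    where
    0+0 : {β γ v : V n} → 0ℚ < ⟨ β , v ⟩ → 0ℚ < ⟨ γ , v ⟩ → 0ℚ < ⟨ β +ᵥ γ , v ⟩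
    0+0 {β} {γ} {v} p q = subst (0ℚ <_) (sym (⟨+⟩ˡ β γ v)) (ℚₚ.+-mono-< p q)
    step : ∀ β γ → LexPositive w t β → LexPositive w t γ → LexPositive w t (β +ᵥ γ)
    step β γ (inj₁ p) (inj₁ q) = inj₁ (0+0 {β} {γ} p q)
    step β γ (inj₁ p) (inj₂ (q , _)) = inj₁ (subst (0ℚ <_)
      (sym (trans (⟨+⟩ˡ β γ (act w t)) (trans (cong (⟨ β , act w t ⟩ +_) q) (+-identityʳ _)))) p)
    step β γ (inj₂ (p , _)) (inj₁ q) = inj₁ (subst (0ℚ <_)
      (sym (trans (⟨+⟩ˡ β γ (act w t)) (trans (cong (_+ ⟨ γ , act w t ⟩) p) (+-identityˡ _)))) q)
    step β γ (inj₂ (p , p′)) (inj₂ (q , q′)) = inj₂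
      (trans (⟨+⟩ˡ β γ (act w t)) (cong₂ _+_ p q) , 0+0 {β} {γ} p′ q′)

  lex-dominant : Dominant (act w t)
  lex-dominant i with lex i
  ... | inj₁ p       = <⇒≤ p
  ... | inj₂ (p , _) = ≤-reflexive (sym p)

  -- A positive root which vanishes at t is not inverted: if it were, the tie break for the negative
  -- of its image would make it pair negatively with `η`. So the inversions of `w` depend on t
  -- alone.
  lex-sorts : {β : V n} → Positive β →
    (⟨ act w β , η ⟩ < 0ℚ → ⟨ β , t ⟩ < 0ℚ) × (⟨ β , t ⟩ < 0ℚ → ⟨ act w β , η ⟩ < 0ℚ)
  lex-sorts {β} β⁺ with root-sign (root-act w (positive-root β⁺))
  ... | inj₁ wβ⁺ = (λ p → contradiction p (<-asym (0<positive-η wβ⁺))) ,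
                   (λ p → contradiction p (≤⇒≯ (subst (0ℚ ≤_) (act-⟨⟩ w β t) (positive-dominant lex-dominant wβ⁺))))
  ... | inj₂ wβ⁻ = (λ _ → case (lex-positive wβ⁻)) , (λ _ → neg⇒<0 (subst (0ℚ <_) (⟨neg⟩ˡ (act w β) η) (0<positive-η wβ⁻)))
    where
    pairing : ∀ v → ⟨ -ᵥ act w β , act w v ⟩ ≡ - ⟨ β , v ⟩
    pairing v = trans (⟨neg⟩ˡ (act w β) (act w v)) (cong -_ (act-⟨⟩ w β v))
    case : LexPositive w t (-ᵥ act w β) → ⟨ β , t ⟩ < 0ℚ
    case (inj₁ p)       = neg⇒<0 (subst (0ℚ <_) (pairing t) p)
    case (inj₂ (_ , q)) = contradiction (neg⇒<0 (subst (0ℚ <_) (pairing η) q)) (<-asym (0<positive-η β⁺))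

  -- The image is positive by `lex-sorts` and pairs to 2 with `act w η`. Were it a sum of two
  -- positive roots, both would vanish at the dominant point `act w t`, and the tie break with
  -- regularity would make each pair to at least 2, giving 4.
  lex-simple : (i : Fin n) → ⟨ simple i , t ⟩ ≡ 0ℚ → ∃ λ j → act w (simple i) ≡ simple j
  lex-simple i on = case (root-sign (root-act w (root-simple i)))
    where
    on′ : ⟨ act w (simple i) , act w t ⟩ ≡ 0ℚ
    on′ = trans (act-⟨⟩ w (simple i) t) on
    big : {γ : V n} → Positive γ → ⟨ γ , act w t ⟩ ≡ 0ℚ → 2ℚ ≤ ⟨ γ , act w η ⟩
    big {γ} γ⁺ eq with lex-positive γ⁺
    ... | inj₁ p       = contradiction (sym eq) (<⇒≢ p)
    ... | inj₂ (_ , q) = subst (2ℚ ≤_) (act-adjoint′ w γ η) (root-regular (root-act (w ⁻¹) (positive-root γ⁺))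
                           (subst (0ℚ ≤_) (sym (act-adjoint′ w γ η)) (<⇒≤ q)))
    case : Positive (act w (simple i)) ⊎ Positive (-ᵥ act w (simple i)) → ∃ λ j → act w (simple i) ≡ simple j
    case (inj₂ wα⁻) = contradiction on (<⇒≢ (proj₁ (lex-sorts (positive-simple i))
      (neg⇒<0 (subst (0ℚ <_) (⟨neg⟩ˡ (act w (simple i)) η) (0<positive-η wα⁻)))))
    case (inj₁ wα⁺) with decompose wα⁺
    ... | inj₁ simple = simple
    ... | inj₂ (β , γ , β⁺ , γ⁺ , eq) = contradiction
      (trans (sym (simple-η i)) (trans (sym (act-⟨⟩ w (simple i) η)) (trans (cong (λ α → ⟨ α , act w η ⟩) eq) (⟨+⟩ˡ β γ (act w η)))))
      (<⇒≢ (<-≤-trans 2<4 (+-mono-≤ (big β⁺ (proj₁ zeros)) (big γ⁺ (proj₂ zeros)))))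
      where
      zeros : ⟨ β , act w t ⟩ ≡ 0ℚ × ⟨ γ , act w t ⟩ ≡ 0ℚ
      zeros = sum-zero (positive-dominant lex-dominant β⁺) (positive-dominant lex-dominant γ⁺)
        (trans (sym (⟨+⟩ˡ β γ (act w t))) (trans (cong (λ α → ⟨ α , act w t ⟩) (sym eq)) on′))

-- If `w` and `u` invert the same positive roots, `u` sends each `act (w ⁻¹) (simple i)` to a
-- positive root, as `w` does. This says that `w ∙ u ⁻¹` keeps `η` dominant, so it is the identity.
inversions-determine : {w u : W n} →
  (∀ {β} → Positive β → ⟨ act w β , η ⟩ < 0ℚ → ⟨ act u β , η ⟩ < 0ℚ) →
  (∀ {β} → Positive β → ⟨ act u β , η ⟩ < 0ℚ → ⟨ act w β , η ⟩ < 0ℚ) → w ≡ u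
inversions-determine {n} {w} {u} to from = begin
  w  ≡⟨ ∙-identityʳ w ⟨
  w ∙ ε  ≡⟨ cong (w ∙_) (∙-inverseˡ u) ⟨
  w ∙ (u ⁻¹ ∙ u)  ≡⟨ ∙-assoc w (u ⁻¹) u ⟨
  w ∙ u ⁻¹ ∙ u  ≡⟨ cong (_∙ u) (dominant-regular {x = w ∙ u ⁻¹} dom) ⟩
  ε ∙ u  ≡⟨ ∙-identityˡ u ⟩
  u  ∎
  where
  open ≡-Reasoning
  dom : Dominant (act (w ∙ u ⁻¹) η)
  dom i = subst (0ℚ ≤_) (sym pairing) (nonneg (root-sign (root-act (w ⁻¹) (root-simple i))))
    where
    δ : V n
    δ = act (w ⁻¹) (simple i)
    pairing : ⟨ simple i , act (w ∙ u ⁻¹) η ⟩ ≡ ⟨ act u δ , η ⟩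
    pairing = trans (cong ⟨ simple i ,_⟩ (act-∙ w (u ⁻¹) η))
      (trans (sym (act-adjoint′ w (simple i) (act (u ⁻¹) η))) (sym (act-adjoint u δ η)))
    wδ : ⟨ act w δ , η ⟩ ≡ 2ℚ
    wδ = trans (cong ⟨_, η ⟩ (act-⁻¹ʳ w (simple i))) (simple-η i)
    neg-pairing : (x : W n) → ⟨ act x (-ᵥ δ) , η ⟩ ≡ - ⟨ act x δ , η ⟩
    neg-pairing x = trans (cong ⟨_, η ⟩ (act-neg x δ)) (⟨neg⟩ˡ (act x δ) η)
    nonneg : Positive δ ⊎ Positive (-ᵥ δ) → 0ℚ ≤ ⟨ act u δ , η ⟩
    nonneg (inj₁ δ⁺) = ≮⇒≥ λ p → <-asym 0<2 (subst (_< 0ℚ) wδ (from δ⁺ p))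
    nonneg (inj₂ δ⁻) = <⇒≤ (<0⇒neg (subst (_< 0ℚ) (neg-pairing u) (to δ⁻
      (subst (_< 0ℚ) (sym (trans (neg-pairing w) (cong -_ wδ))) (ℚₚ.neg-antimono-< 0<2)))))
      where
      <0⇒neg : ∀ {q} → - q < 0ℚ → 0ℚ < q
      <0⇒neg {q} p = subst (0ℚ <_) (neg-involutive q) (ℚₚ.neg-antimono-< p)

lexDominant-unique : {w u : W n} {t : V n} → LexDominant w t → LexDominant u t → w ≡ u
lexDominant-unique {w = w} {u} {t} lex lex′ = inversions-determine
  (λ β⁺ p → proj₂ (lex-sorts {w = u} {t} lex′ β⁺) (proj₁ (lex-sorts {w = w} {t} lex β⁺) p))
  (λ β⁺ p → proj₂ (lex-sorts {w = w} {t} lex β⁺) (proj₁ (lex-sorts {w = u} {t} lex′ β⁺) p))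

-- `IsReflection` constrains s on the vectors eⱼ only. The coordinates of s⁻¹v are the pairings of v
-- with the s eⱼ, so s⁻¹, and with it s, agrees with the element found by `reflection`.
isReflection-ext : {α : V n} {s : W n} → Positive α → IsReflection α s → ∀ v → act s v ≡ reflect α v
isReflection-ext {α = α} {s} α⁺ refl-s v with r , act-r ← reflection α⁺ = begin
  act s v  ≡⟨ cong (λ x → act x v) s≡r ⟩
  act r v  ≡⟨ act-r v ⟩
  reflect α v  ∎
  where
  open ≡-Reasoning
  inverses : ∀ v → act (s ⁻¹) v ≡ act (r ⁻¹) v
  inverses v = lookup-ext λ j → begin
    lookup (act (s ⁻¹) v) j  ≡⟨ sym (⟨e,⟩ j _) ⟩
    ⟨ e j , act (s ⁻¹) v ⟩  ≡⟨ sym (act-adjoint s (e j) v) ⟩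
    ⟨ act s (e j) , v ⟩  ≡⟨ cong ⟨_, v ⟩ (trans (refl-s j) (sym (act-r (e j)))) ⟩
    ⟨ act r (e j) , v ⟩  ≡⟨ act-adjoint r (e j) v ⟩
    ⟨ e j , act (r ⁻¹) v ⟩  ≡⟨ ⟨e,⟩ j _ ⟩
    lookup (act (r ⁻¹) v) j  ∎
  s≡r : s ≡ r
  s≡r = trans (sym (⁻¹-involutive s)) (trans (cong _⁻¹ (W-ext inverses)) (⁻¹-involutive r))

parabolic-∙ : {K : Subset n} {x y : W n} → x ∈W⟨ K ⟩ → y ∈W⟨ K ⟩ → x ∙ y ∈W⟨ K ⟩
parabolic-∙ {K = K} {y = y} ε∈ y∈ = subst (_∈W⟨ K ⟩) (sym (∙-identityˡ y)) y∈
parabolic-∙ {K = K} {y = y} (s∙ {s = s} {u} i∈ refl-s u∈) y∈ =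
  subst (_∈W⟨ K ⟩) (sym (∙-assoc s u y)) (s∙ {s = s} i∈ refl-s (parabolic-∙ u∈ y∈))

reflection-∙-self : (i : Fin n) {s : W n} → IsReflection (simple i) s → s ∙ s ≡ ε
reflection-∙-self i {s} refl-s = W-ext λ v → begin
  act (s ∙ s) v  ≡⟨ act-∙ s s v ⟩
  act s (act s v)  ≡⟨ trans (cong (act s) (act-s v)) (act-s _) ⟩
  reflect (simple i) (reflect (simple i) v) ≡⟨ reflect-involutive (positive-simple i) v ⟩
  v  ≡⟨ act-ε v ⟨
  act ε v  ∎
  where
  open ≡-Reasoning
  act-s : ∀ v → act s v ≡ reflect (simple i) v
  act-s = isReflection-ext {s = s} (positive-simple i) refl-s

parabolic-⁻¹ : {K : Subset n} {x : W n} → x ∈W⟨ K ⟩ → x ⁻¹ ∈W⟨ K ⟩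
parabolic-⁻¹ {K = K} ε∈ = subst (_∈W⟨ K ⟩) (∙≡ε⇒≡⁻¹ (∙-identityˡ ε)) ε∈
parabolic-⁻¹ {K = K} (s∙ {i = i} {s} {u} i∈ refl-s u∈) = subst (_∈W⟨ K ⟩) (∙≡ε⇒≡⁻¹ (begin
  s ∙ u ∙ (u ⁻¹ ∙ (s ∙ ε))  ≡⟨ ∙-assoc s u (u ⁻¹ ∙ (s ∙ ε)) ⟩
  s ∙ (u ∙ (u ⁻¹ ∙ (s ∙ ε))) ≡⟨ cong (s ∙_) (∙-assoc u (u ⁻¹) (s ∙ ε)) ⟨
  s ∙ (u ∙ u ⁻¹ ∙ (s ∙ ε))  ≡⟨ cong₂ (λ x y → s ∙ (x ∙ y)) (∙-inverseʳ u) (∙-identityʳ s) ⟩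
  s ∙ (ε ∙ s)  ≡⟨ cong (s ∙_) (∙-identityˡ s) ⟩
  s ∙ s  ≡⟨ reflection-∙-self i {s} refl-s ⟩
  ε  ∎)) (parabolic-∙ (parabolic-⁻¹ u∈) (s∙ {s = s} i∈ refl-s ε∈))
  where open ≡-Reasoning

Vanishes : Subset n → V n → Set
Vanishes K v = ∀ i → i Subset.∈ K → ⟨ simple i , v ⟩ ≡ 0ℚ

parabolic-fixes : {K : Subset n} {x : W n} {v : V n} → Vanishes K v → x ∈W⟨ K ⟩ → act x v ≡ v
parabolic-fixes {v = v} van ε∈ = act-ε v
parabolic-fixes {v = v} van (s∙ {i = i} {s} {u} i∈ refl-s u∈) = begin
  act (s ∙ u) v  ≡⟨ act-∙ s u v ⟩
  act s (act u v)  ≡⟨ cong (act s) (parabolic-fixes van u∈) ⟩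
  act s v  ≡⟨ isReflection-ext {s = s} (positive-simple i) refl-s v ⟩
  reflect (simple i) v  ≡⟨ reflect-fixes (positive-simple i) (van i i∈) ⟩
  v  ∎
  where open ≡-Reasoning

simple-reflection : (i : Fin n) → ∃ λ s → IsReflection (simple i) s × (∀ v → act s v ≡ reflect (simple i) v)
simple-reflection i = let s , act-s = reflection (positive-simple i) in s , (λ j → act-s (e j)) , act-s

-- Choose y ∈ W_K maximising ⟨η , y x η⟩; then y x η is dominant, so y x = ε.
dominant-transport : {K : Subset n} {d d′ : V n} {x : W n} → Dominant d → Dominant d′ → act x d ≡ d′ →
  (∀ i → i Subset.∈ K ⇔ ⟨ simple i , d′ ⟩ ≡ 0ℚ) → x ∈W⟨ K ⟩
dominant-transport {n} {K} {d} {d′} {x} dom dom′ eq zeros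
  = let y , y∈ , max = maximiser f _∈W⟨ K ⟩? ∈-elements (ε , ε∈) in
    subst (_∈W⟨ K ⟩) (sym (∙≡ε⇒≡⁻¹ {w = y} {x} (dominant-regular {x = y ∙ x} (domᵥ y y∈ max)))) (parabolic-⁻¹ y∈)
  where
  f : W n → ℚ
  f y = ⟨ η , act (y ∙ x) η ⟩
  module _ (y : W n) (y∈ : y ∈W⟨ K ⟩) (max : ∀ u → u ∈W⟨ K ⟩ → f u ≤ f y) where
    v : W n
    v = y ∙ x
    vd : act v d ≡ d′
    vd = trans (act-∙ y x d) (trans (cong (act y) eq) (parabolic-fixes (λ i → ⇒ (zeros i)) y∈))
    domᵥ : Dominant (act v η)
    domᵥ i = ≮⇒≥ λ p → ≤⇒≯ (ascent (⇐ (zeros i) (vanish p))) p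
      where
      -- A simple root negative at `act v η` is taken by `v ⁻¹` to a negative root, so it is at most
      -- 0 at d′ = v d, where dominance makes it at least 0. Hence its index lies in `K`, and its
      -- reflection may be used for an ascent within the parabolic subgroup.
      vanish : ⟨ simple i , act v η ⟩ < 0ℚ → ⟨ simple i , d′ ⟩ ≡ 0ℚ
      vanish p = ℚₚ.≤-antisym (subst (λ u → ⟨ simple i , u ⟩ ≤ 0ℚ) vd (subst (_≤ 0ℚ) (act-adjoint′ v (simple i) d)
        (subst (_≤ 0ℚ) (neg-involutive _) (neg-antimono-≤ (subst (0ℚ ≤_) (⟨neg⟩ˡ (act (v ⁻¹) (simple i)) d)
          (positive-dominant dom (⟨,η⟩<0⇒negative (root-act (v ⁻¹) (root-simple i)) (subst (_< 0ℚ) (sym (act-adjoint′ v (simple i) η)) p)))))))) (dom′ i)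
      ascent : i Subset.∈ K → 0ℚ ≤ ⟨ simple i , act v η ⟩
      ascent i∈ with s , refl-s , act-s ← simple-reflection i = reflection-ascent i
        (subst (_≤ ⟨ η {n} , act v η ⟩) (cong ⟨ η ,_⟩ (trans (cong (λ u → act u η) (∙-assoc s y x))
           (trans (act-∙ s v η) (act-s (act v η))))) (max (s ∙ y) (s∙ {s = s} i∈ refl-s y∈)))

zeros : V n → Subset n
zeros d = tabulate λ i → does (⟨ simple i , d ⟩ ℚₚ.≟ 0ℚ)

∈zeros : (d : V n) (i : Fin n) → i Subset.∈ zeros d ⇔ ⟨ simple i , d ⟩ ≡ 0ℚ
∈zeros d i = mk⇔ to from
  where
  to : i Subset.∈ zeros d → ⟨ simple i , d ⟩ ≡ 0ℚ
  to i∈ with ⟨ simple i , d ⟩ ℚₚ.≟ 0ℚ | trans (sym (Vecₚ.lookup∘tabulate (λ i → does (⟨ simple i , d ⟩ ℚₚ.≟ 0ℚ)) i)) (Vecₚ.[]=⇒lookup i∈)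
  ... | yes eq | _ = eq
  ... | no _   | ()
  from : ⟨ simple i , d ⟩ ≡ 0ℚ → i Subset.∈ zeros d
  from eq = Vecₚ.lookup⇒[]= i (zeros d) (trans (Vecₚ.lookup∘tabulate _ i) (Dec.dec-true (_ ℚₚ.≟ 0ℚ) eq))

-- By `dominant-transport` the element x lies in the parabolic subgroup of the zero set of
-- `act x d`, which fixes that point.
dominant-unique : {d : V n} {x : W n} → Dominant d → Dominant (act x d) → act x d ≡ d
dominant-unique {d = d} {x} dom dom′ = trans (sym (parabolic-fixes (λ i → ⇒ (∈zeros (act x d) i))
  (parabolic-⁻¹ (dominant-transport {d = d} {x = x} dom dom′ refl (∈zeros (act x d)))))) (act-⁻¹ˡ x d)

stabiliser : {K : Subset n} {d : V n} → Dominant d → (∀ i → i Subset.∈ K ⇔ ⟨ simple i , d ⟩ ≡ 0ℚ) →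
  (x : W n) → act x d ≡ d ⇔ x ∈W⟨ K ⟩
stabiliser dom zeros x = mk⇔ (λ eq → dominant-transport dom dom eq zeros)
  (parabolic-fixes λ i → ⇒ (zeros i))

-- Faces of the dominant chamber

-- The default 0 makes the last wall look like the others: 2eₙ compares the last coordinate with an
-- imagined coordinate 0 after it, up to the factor 2 recorded by `scale`.
head₀ : V n → ℚ
head₀ []      = 0ℚ
head₀ (x ∷ v) = x

scale : ℕ → ℚ
scale zero    = 2ℚ
scale (suc n) = 1ℚ

0<scale : ∀ n → 0ℚ < scale n
0<scale zero    = 0<2
0<scale (suc n) = 0<1

simple-zero : ∀ x (t : V n) → ⟨ simple zero , x ∷ t ⟩ ≡ scale n * (x - head₀ t)
simple-zero x []      = solve 1 (λ x → con 2ℚ :* x :+ con 0ℚ := con 2ℚ :* (x :- con 0ℚ)) refl x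
simple-zero x (y ∷ t) = trans (cong (λ q → 1ℚ * x + (- 1ℚ * y + q)) (⟨0,⟩ t))
  (solve 2 (λ x y → con 1ℚ :* x :+ (con (- 1ℚ) :* y :+ con 0ℚ) := con 1ℚ :* (x :- y)) refl x y)

simple-suc : ∀ (i : Fin n) x (t : V n) → ⟨ simple (suc i) , x ∷ t ⟩ ≡ ⟨ simple i , t ⟩
simple-suc {suc n} i x t = trans (cong (_+ ⟨ simple i , t ⟩) (*-zeroˡ x)) (+-identityˡ _)

free : Subset n → ℕ
free []            = 0
free (inside ∷ K)  = free K
free (outside ∷ K) = suc (free K)

-- The coordinates of the face of the dominant chamber on which the roots in K
-- vanish: it is a dominant chamber of type C with free K coordinates.
blowUp : (K : Subset n) → V (free K) → V n
blowUp []            z       = []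
blowUp (inside ∷ K)  z       = head₀ (blowUp K z) ∷ blowUp K z
blowUp (outside ∷ K) (x ∷ z) = x ∷ blowUp K z

embed : (K : Subset n) → Fin (free K) → Fin n
embed (inside ∷ K)  i       = suc (embed K i)
embed (outside ∷ K) zero    = zero
embed (outside ∷ K) (suc i) = suc (embed K i)

restrict : (K : Subset n) → Subset n → Subset (free K)
restrict []            D       = []
restrict (inside ∷ K)  (_ ∷ D) = restrict K D
restrict (outside ∷ K) (b ∷ D) = b ∷ restrict K D

lookup-restrict : (K D : Subset n) (i : Fin (free K)) → lookup (restrict K D) i ≡ lookup D (embed K i)
lookup-restrict (inside ∷ K)  (_ ∷ D) i       = lookup-restrict K D i
lookup-restrict (outside ∷ K) (_ ∷ D) zero    = refl
lookup-restrict (outside ∷ K) (_ ∷ D) (suc i) = lookup-restrict K D i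

embed-∉ : (K : Subset n) (i : Fin n) → i Subset.∉ K → ∃ λ j → embed K j ≡ i
embed-∉ (inside ∷ K)  zero    i∉ = contradiction Vec.here i∉
embed-∉ (outside ∷ K) zero    i∉ = zero , refl
embed-∉ (inside ∷ K)  (suc i) i∉ = let j , eq = embed-∉ K i (i∉ ∘ Vec.there) in j , cong suc eq
embed-∉ (outside ∷ K) (suc i) i∉ = let j , eq = embed-∉ K i (i∉ ∘ Vec.there) in suc j , cong suc eq

head₀-blowUp : (K : Subset n) (z : V (free K)) → head₀ (blowUp K z) ≡ head₀ z
head₀-blowUp []            []      = refl
head₀-blowUp (inside ∷ K)  z       = head₀-blowUp K z
head₀-blowUp (outside ∷ K) (x ∷ z) = refl

blowUp-vanishes : (K : Subset n) (z : V (free K)) → Vanishes K (blowUp K z)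
blowUp-vanishes {suc n} (inside ∷ K) z zero _ = trans (simple-zero _ (blowUp K z))
  (trans (cong (scale n *_) (+-inverseʳ (head₀ (blowUp K z)))) (*-zeroʳ (scale n)))
blowUp-vanishes (inside ∷ K)  z       (suc i) (Vec.there i∈) = trans (simple-suc i _ (blowUp K z)) (blowUp-vanishes K z i i∈)
blowUp-vanishes (outside ∷ K) (x ∷ z) (suc i) (Vec.there i∈) = trans (simple-suc i x (blowUp K z)) (blowUp-vanishes K z i i∈)

vanishes-tail : {b : Bool.Bool} {K : Subset n} {x : ℚ} {t : V n} → Vanishes (b ∷ K) (x ∷ t) → Vanishes K t
vanishes-tail {x = x} {t} van i i∈ = trans (sym (simple-suc i x t)) (van (suc i) (Vec.there i∈))

blowUp-surjective : (K : Subset n) (v : V n) → Vanishes K v → ∃ λ z → blowUp K z ≡ v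
blowUp-surjective []            []      van = [] , refl
blowUp-surjective {suc n} (inside ∷ K) (x ∷ t) van =
  let z , eq = blowUp-surjective K t (vanishes-tail {x = x} van) in
  z , cong₂ _∷_ (trans (cong head₀ eq) (sym x≡)) eq
  where
  x≡ : x ≡ head₀ t
  x≡ with *-zero (scale n) (x - head₀ t) (trans (sym (simple-zero x t)) (van zero Vec.here))
  ... | inj₁ eq = contradiction (sym eq) (<⇒≢ (0<scale n))
  ... | inj₂ eq = p-q≡0⇒p≡q x (head₀ t) eq
blowUp-surjective (outside ∷ K) (x ∷ t) van =
  let z , eq = blowUp-surjective K t (vanishes-tail {x = x} van) in x ∷ z , cong (x ∷_) eq

-- The restriction of a simple root not in K is a simple root up to scale, which
-- is not 1 if the last simple root is in K.
blowUp-simple : (K : Subset n) (i : Fin (free K)) →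
  ∃ λ c → 0ℚ < c × ∀ z → ⟨ simple (embed K i) , blowUp K z ⟩ ≡ c * ⟨ simple i , z ⟩
blowUp-simple (inside ∷ K) i = let c , 0<c , eq = blowUp-simple K i in
  c , 0<c , λ z → trans (simple-suc (embed K i) _ (blowUp K z)) (eq z)
blowUp-simple (outside ∷ K) (suc i) = let c , 0<c , eq = blowUp-simple K i in
  c , 0<c , λ { (x ∷ z) → trans (simple-suc (embed K i) x (blowUp K z)) (trans (eq z) (cong (c *_) (sym (simple-suc i x z)))) }
blowUp-simple {suc n} (outside ∷ K) zero = ratio n (free K) , 0<ratio n (free K) , λ { (x ∷ z) →
  trans (simple-zero x (blowUp K z)) (trans (cong (λ h → scale n * (x - h)) (head₀-blowUp K z))
    (trans (cong (_* (x - head₀ z)) (sym (ratio-scale n (free K))))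
      (trans (*-assoc (ratio n (free K)) (scale (free K)) (x - head₀ z))
        (cong (ratio n (free K) *_) (sym (simple-zero x z)))))) }
  where
  -- The quotient of the two normalising factors. The value ½ belongs to a root eᵢ - eᵢ₊₁ all of
  -- whose successors lie in `K`: then vᵢ₊₁ = 0 on the face, and the root restricts to half of a
  -- long root.
  ratio : ℕ → ℕ → ℚ
  ratio zero    zero    = 1ℚ
  ratio zero    (suc _) = 2ℚ
  ratio (suc _) zero    = ½
  ratio (suc _) (suc _) = 1ℚ
  0<ratio : ∀ m p → 0ℚ < ratio m p
  0<ratio zero    zero    = 0<1
  0<ratio zero    (suc _) = 0<2
  0<ratio (suc _) zero    = ℚₚ.positive⁻¹ ½
  0<ratio (suc _) (suc _) = 0<1
  ratio-scale : ∀ m p → ratio m p * scale p ≡ scale m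
  ratio-scale zero    zero    = refl
  ratio-scale zero    (suc _) = refl
  ratio-scale (suc _) zero    = refl
  ratio-scale (suc _) (suc _) = refl

-- A point of the relative interior of the face cut out by `K`. Its stabiliser is the parabolic
-- subgroup of `K`, so questions about the subgroup become questions about one vector.
generic : Subset n → V n
generic K = blowUp K η

generic-positive : (K : Subset n) (i : Fin n) → i Subset.∉ K → 0ℚ < ⟨ simple i , generic K ⟩
generic-positive K i i∉ with j , refl ← embed-∉ K i i∉ = let c , 0<c , eq = blowUp-simple K j in
  subst (0ℚ <_) (sym (eq η)) (*-pos 0<c (subst (0ℚ <_) (sym (simple-η j)) 0<2))

generic-dominant : (K : Subset n) → Dominant (generic K)
generic-dominant K i with i Subsetₚ.∈? K
... | yes i∈ = ≤-reflexive (sym (blowUp-vanishes K η i i∈))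
... | no i∉  = <⇒≤ (generic-positive K i i∉)

generic-zeros : (K : Subset n) (i : Fin n) → i Subset.∈ K ⇔ ⟨ simple i , generic K ⟩ ≡ 0ℚ
generic-zeros K i = mk⇔ (blowUp-vanishes K η i) from
  where
  from : ⟨ simple i , generic K ⟩ ≡ 0ℚ → i Subset.∈ K
  from eq with i Subsetₚ.∈? K
  ... | yes i∈ = i∈
  ... | no i∉  = contradiction (sym eq) (<⇒≢ (generic-positive K i i∉))

stabiliser-generic : (K : Subset n) (x : W n) → act x (generic K) ≡ generic K ⇔ x ∈W⟨ K ⟩
stabiliser-generic K = stabiliser (generic-dominant K) (generic-zeros K)

-- w W_K w⁻¹ = W_L.
Conjugates : Subset n → Subset n → W n → Set
Conjugates K L w = ∀ u v → v ∙ w ≡ w ∙ u → (u ∈W⟨ K ⟩ → v ∈W⟨ L ⟩) × (v ∈W⟨ L ⟩ → u ∈W⟨ K ⟩)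

conjugates? : (K L : Subset n) → Decidable (Conjugates K L)
conjugates? K L w = ∀W? λ u → ∀W? λ v → ((v ∙ w) ≟w (w ∙ u)) →-dec
  ((u ∈W⟨ K ⟩? →-dec v ∈W⟨ L ⟩?) ×-dec (v ∈W⟨ L ⟩? →-dec u ∈W⟨ K ⟩?))

intertwine : {w u v : W n} → v ∙ w ≡ w ∙ u → ∀ x → act v (act w x) ≡ act w (act u x)
intertwine {w = w} {u} {v} eq x = trans (sym (act-∙ v w x)) (trans (cong (λ y → act y x) eq) (act-∙ w u x))

∙⁻¹∙ʳ : (x w : W n) → x ∙ w ⁻¹ ∙ w ≡ x
∙⁻¹∙ʳ x w = trans (∙-assoc x (w ⁻¹) w) (trans (cong (x ∙_) (∙-inverseˡ w)) (∙-identityʳ x))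

-- Since w takes K onto L, every root of K vanishes at w⁻¹ `generic L` and every root of L at w
-- `generic K`. Elements of either subgroup fix the corresponding point, and intertwining by w moves
-- this to the generic point of the other side.
sendsTo⇒conjugates : {K L : Subset n} {w : W n} → SendsTo w K L → Conjugates K L w
sendsTo⇒conjugates {n} {K} {L} {w} (to , from) u v eq = forth , back
  where
  t : V n
  t = act (w ⁻¹) (generic L)
  wt : act w t ≡ generic L
  wt = act-⁻¹ʳ w (generic L)
  t-vanishes : Vanishes K t
  t-vanishes i i∈ = let j , j∈ , wα = to i i∈ in begin
    ⟨ simple i , t ⟩  ≡⟨ sym (act-⟨⟩ w (simple i) t) ⟩
    ⟨ act w (simple i) , act w t ⟩  ≡⟨ cong₂ ⟨_,_⟩ wα wt ⟩
    ⟨ simple j , generic L ⟩  ≡⟨ blowUp-vanishes L η j j∈ ⟩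
    0ℚ  ∎
    where open ≡-Reasoning
  gK-vanishes : Vanishes L (act w (generic K))
  gK-vanishes j j∈ = let i , i∈ , wα = from j j∈ in
    trans (cong (λ α → ⟨ α , act w (generic K) ⟩) (sym wα))
      (trans (act-⟨⟩ w (simple i) (generic K)) (blowUp-vanishes K η i i∈))
  forth : u ∈W⟨ K ⟩ → v ∈W⟨ L ⟩
  forth u∈ = ⇒ (stabiliser-generic L v) (trans (cong (act v) (sym wt))
    (trans (intertwine {w = w} {u} {v} eq t) (trans (cong (act w) (parabolic-fixes t-vanishes u∈)) wt)))
  back : v ∈W⟨ L ⟩ → u ∈W⟨ K ⟩
  back v∈ = ⇒ (stabiliser-generic K u) (act-injective w
    (trans (sym (intertwine {w = w} {u} {v} eq (generic K))) (parabolic-fixes gK-vanishes v∈)))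

-- The given w need not map simple roots to simple roots. It is replaced by the element v which is
-- lexicographically dominant for t = w⁻¹ `generic L`: the stabiliser of t is the parabolic subgroup
-- of K, and v t = `generic L` by uniqueness of dominant representatives, so v maps K onto L.
conjugates⇒∼ : {K L : Subset n} {w : W n} → Conjugates K L w → K ∼ L
conjugates⇒∼ {n} {K} {L} {w} conj = from-lex (lexDominant-exists t)
  where
  t : V n
  t = act (w ⁻¹) (generic L)
  wt : act w t ≡ generic L
  wt = act-⁻¹ʳ w (generic L)
  stabiliser-t : ∀ u → act u t ≡ t ⇔ u ∈W⟨ K ⟩
  stabiliser-t u = mk⇔
    (λ eq → proj₂ (conj u v (∙⁻¹∙ʳ (w ∙ u) w)) (⇒ (stabiliser-generic L v)
      (trans (cong (act v) (sym wt)) (trans (twine t) (trans (cong (act w) eq) wt)))))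
    (λ u∈ → act-injective w (trans (sym (twine t)) (trans (cong (act v) wt)
      (trans (⇐ (stabiliser-generic L v) (proj₁ (conj u v (∙⁻¹∙ʳ (w ∙ u) w)) u∈)) (sym wt)))))
    where
    v : W n
    v = w ∙ u ∙ w ⁻¹
    twine : ∀ x → act v (act w x) ≡ act w (act u x)
    twine = intertwine {w = w} {u} {v} (∙⁻¹∙ʳ (w ∙ u) w)
  -- A root vanishes at a point exactly if its reflection fixes the point. The points t and
  -- `generic K` have the same stabiliser, so the same roots vanish at both.
  t⇒g : {α : V n} → Positive α → ⟨ α , t ⟩ ≡ 0ℚ → ⟨ α , generic K ⟩ ≡ 0ℚ
  t⇒g α⁺ eq = let s , act-s = reflection α⁺ in fixed-by-reflection α⁺ (trans (sym (act-s (generic K)))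
    (⇐ (stabiliser-generic K s) (⇒ (stabiliser-t s) (trans (act-s t) (reflect-fixes α⁺ eq)))))
  g⇒t : {α : V n} → Positive α → ⟨ α , generic K ⟩ ≡ 0ℚ → ⟨ α , t ⟩ ≡ 0ℚ
  g⇒t α⁺ eq = let s , act-s = reflection α⁺ in fixed-by-reflection α⁺ (trans (sym (act-s t))
    (⇐ (stabiliser-t s) (⇒ (stabiliser-generic K s) (trans (act-s (generic K)) (reflect-fixes α⁺ eq)))))
  from-lex : (∃ λ v → LexDominant v t) → K ∼ L
  from-lex (v , lex) = v , to , from
    where
    vt : act v t ≡ generic L
    vt = trans (sym (act-∙ v (w ⁻¹) (generic L))) (dominant-unique {x = v ∙ w ⁻¹} (generic-dominant L)
      (subst Dominant (sym (act-∙ v (w ⁻¹) (generic L))) (lex-dominant {w = v} {t} lex)))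
    to : ∀ i → i Subset.∈ K → ∃ λ j → j Subset.∈ L × act v (simple i) ≡ simple j
    to i i∈ = let j , eq = lex-simple {w = v} {t} lex i on in j , ⇐ (generic-zeros L j)
      (trans (cong₂ ⟨_,_⟩ (sym eq) (sym vt)) (trans (act-⟨⟩ v (simple i) t) on)) , eq
      where
      on : ⟨ simple i , t ⟩ ≡ 0ℚ
      on = g⇒t (positive-simple i) (blowUp-vanishes K η i i∈)
    -- The preimage of a simple root of L is positive by the tie break and vanishes at `generic K`.
    -- If it were a sum of two positive roots, both would vanish there, neither would be inverted by
    -- v, and the simple root would pair to at least 4 with `η`.
    from : ∀ j → j Subset.∈ L → ∃ λ i → i Subset.∈ K × act v (simple i) ≡ simple j
    from j j∈ = case (decompose α⁺)
      where
      α : V n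
      α = act (v ⁻¹) (simple j)
      vα : act v α ≡ simple j
      vα = act-⁻¹ʳ v (simple j)
      on : ⟨ simple j , act v t ⟩ ≡ 0ℚ
      on = trans (cong ⟨ simple j ,_⟩ vt) (blowUp-vanishes L η j j∈)
      0<α : ⟨ simple j , act v t ⟩ ≡ 0ℚ → 0ℚ < ⟨ α , η ⟩
      0<α on with lex j
      ... | inj₁ p       = contradiction (sym on) (<⇒≢ p)
      ... | inj₂ (_ , p) = subst (0ℚ <_) (sym (act-adjoint′ v (simple j) η)) p
      α⁺ : Positive α
      α⁺ = 0<⟨,η⟩⇒positive (root-act (v ⁻¹) (root-simple j)) (0<α on)
      αg : ⟨ α , generic K ⟩ ≡ 0ℚ
      αg = t⇒g α⁺ (trans (act-adjoint′ v (simple j) t) on)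
      big : {γ : V n} → Positive γ → ⟨ γ , generic K ⟩ ≡ 0ℚ → 2ℚ ≤ ⟨ act v γ , η ⟩
      big γ⁺ eq = root-regular (root-act v (positive-root γ⁺)) (≮⇒≥ λ p →
        <⇒≢ (proj₁ (lex-sorts {w = v} {t} lex γ⁺) p) (g⇒t γ⁺ eq))
      case : Decomposed α → ∃ λ i → i Subset.∈ K × act v (simple i) ≡ simple j
      case (inj₁ (i , eq)) = i , ⇐ (generic-zeros K i) (trans (cong (λ α → ⟨ α , generic K ⟩) (sym eq)) αg) ,
        trans (cong (act v) (sym eq)) vα
      case (inj₂ (γ , δ , γ⁺ , δ⁺ , eq)) = contradiction
        (trans (sym (simple-η j)) (trans (cong ⟨_, η ⟩ (trans (sym vα) (trans (cong (act v) eq) (act-+ v γ δ)))) (⟨+⟩ˡ (act v γ) (act v δ) η)))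
        (<⇒≢ (<-≤-trans 2<4 (+-mono-≤ (big γ⁺ (proj₁ vanish)) (big δ⁺ (proj₂ vanish)))))
        where
        vanish : ⟨ γ , generic K ⟩ ≡ 0ℚ × ⟨ δ , generic K ⟩ ≡ 0ℚ
        vanish = sum-zero (positive-dominant (generic-dominant K) γ⁺) (positive-dominant (generic-dominant K) δ⁺)
          (trans (sym (⟨+⟩ˡ γ δ (generic K))) (trans (cong (λ α → ⟨ α , generic K ⟩) (sym eq)) αg))

-- Points of the cube

∑-× : {C : Set} (_⊗_ : A → B → C) (as : List A) (bs : List B) (f : C → ℚ) →
      ∑ (cartesianProductWith _⊗_ as bs) f ≡ ∑ as (λ a → ∑ bs (λ b → f (a ⊗ b)))
∑-× _⊗_ []       bs f = refl
∑-× _⊗_ (a ∷ as) bs f = trans (∑-++ (List.map (a ⊗_) bs) _ f)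
  (cong₂ _+_ (∑-map (a ⊗_) bs f) (∑-× _⊗_ as bs f))

∑-same : DecidableEquality A → {as bs : List A} (f : A → ℚ) → Unique as → Unique bs →
         (∀ {a} → a ∈ as → a ∈ bs) → (∀ {a} → a ∈ bs → a ∈ as) → ∑ as f ≡ ∑ bs f
∑-same _≟_ f ua ub to from = ∑-reindex _≟_ (λ a → a) (λ a → a) f ua ub (λ a∈ → to a∈ , refl) (λ a∈ → from a∈ , refl)

allVec⁺ : {as : List A} (v : Vec A n) → (∀ i → lookup v i ∈ as) → v ∈ allVec as n
allVec⁺ []      _  = here refl
allVec⁺ (x ∷ v) v∈ = ∈-cartesianProductWith⁺ _∷_ (v∈ zero) (allVec⁺ v (v∈ ∘ suc))

allVec⁻ : {as : List A} (v : Vec A n) → v ∈ allVec as n → ∀ i → lookup v i ∈ as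
allVec⁻ {n = suc n} {as} (x ∷ v) v∈ i with _ , _ , x∈ , v∈′ , refl ← ∈-cartesianProductWith⁻ _∷_ as (allVec as n) v∈ | i
... | zero  = x∈
... | suc i = allVec⁻ v v∈′ i

∑-allVec-1 : (as : List A) (n : ℕ) → ∑ (allVec as n) (λ _ → 1ℚ) ≡ fromℕ (length as) ^ n
∑-allVec-1 as zero    = refl
∑-allVec-1 as (suc n) = begin
  ∑ (allVec as (suc n)) (λ _ → 1ℚ)  ≡⟨ ∑-× _∷_ as (allVec as n) (λ _ → 1ℚ) ⟩
  ∑ as (λ _ → ∑ (allVec as n) (λ _ → 1ℚ))  ≡⟨ ∑-cong as (λ _ → trans (∑-allVec-1 as n) (sym (*-identityˡ _))) ⟩
  ∑ as (λ _ → 1ℚ * fromℕ (length as) ^ n)  ≡⟨ ∑-*ʳ _ as (λ _ → 1ℚ) ⟩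
  ∑ as (λ _ → 1ℚ) * fromℕ (length as) ^ n  ≡⟨ cong (_* fromℕ (length as) ^ n) (fromℕ-length as) ⟨
  fromℕ (length as) * fromℕ (length as) ^ n  ∎
  where open ≡-Reasoning

⊆?-same : ∀ b (p q : Subset n) → [ (b ∷ p) ⊆? (b ∷ q) ]? ≡ [ p ⊆? q ]?
⊆?-same b p q = []?-cong ((b ∷ p) ⊆? (b ∷ q)) (p ⊆? q)
  (λ sub {x} → Subsetₚ.drop-∷-⊆ {p = p} {q = q} sub {x}) (λ sub {x} → Subsetₚ.s⊆s {p = p} {q = q} sub {x})

⊆?-outside : ∀ b (p q : Subset n) → [ (outside ∷ p) ⊆? (b ∷ q) ]? ≡ [ p ⊆? q ]?
⊆?-outside b p q = []?-cong ((outside ∷ p) ⊆? (b ∷ q)) (p ⊆? q)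
  (λ sub {x} → Subsetₚ.drop-∷-⊆ {p = p} {q = q} sub {x}) (λ sub {x} → Subsetₚ.out⊆ {p = p} {q = q} sub {x})

⊆?-inside : (p q : Subset n) → [ (inside ∷ p) ⊆? (outside ∷ q) ]? ≡ 0ℚ
⊆?-inside p q = []?-no ((inside ∷ p) ⊆? (outside ∷ q)) λ sub → contradiction (sub Vec.here) λ ()

-- t lies in the relative interior of the face of the dominant chamber cut out by L.
OnFace : Subset n → V n → Set
OnFace L t = Vanishes L t × (∀ i → i Subset.∉ L → 0ℚ < ⟨ simple i , t ⟩)

onFace? : (L : Subset n) → Decidable (OnFace L)
onFace? L t = Finₚ.all? (λ i → (i Subsetₚ.∈? L) →-dec (⟨ simple i , t ⟩ ℚₚ.≟ 0ℚ))
  ×-dec Finₚ.all? (λ i → ¬? (i Subsetₚ.∈? L) →-dec (0ℚ ℚₚ.<? ⟨ simple i , t ⟩))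

onFace-dominant : {L : Subset n} {t : V n} → OnFace L t → Dominant t
onFace-dominant {L = L} (on , off) i with i Subsetₚ.∈? L
... | yes i∈ = ≤-reflexive (sym (on i i∈))
... | no i∉  = <⇒≤ (off i i∉)

onFace-zeros : {L : Subset n} {t : V n} → OnFace L t → ∀ i → i Subset.∈ L ⇔ ⟨ simple i , t ⟩ ≡ 0ℚ
onFace-zeros {L = L} {t} (on , off) i = mk⇔ (on i) from
  where
  from : ⟨ simple i , t ⟩ ≡ 0ℚ → i Subset.∈ L
  from eq with i Subsetₚ.∈? L
  ... | yes i∈ = i∈
  ... | no i∉  = contradiction (sym eq) (<⇒≢ (off i i∉))

dominant-onFace : {d : V n} → Dominant d → OnFace (zeros d) d
dominant-onFace {d = d} dom = (λ i → ⇒ (∈zeros d i)) ,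
  λ i i∉ → ≤∧≢⇒< (dom i) (λ 0≡ → i∉ (⇐ (∈zeros d i) (sym 0≡)))

onFace-unique : {L : Subset n} {d : V n} → OnFace L d → L ≡ zeros d
onFace-unique {d = d} face = Subsetₚ.⊆-antisym
  (λ {i} i∈ → ⇐ (∈zeros d i) (⇒ (onFace-zeros face i) i∈))
  (λ {i} i∈ → ⇐ (onFace-zeros face i) (⇒ (∈zeros d i) i∈))

onFace-inside : {L : Subset n} {x : ℚ} {t : V n} → OnFace (inside ∷ L) (x ∷ t) ⇔ (x ≡ head₀ t × OnFace L t)
onFace-inside {n} {L} {x} {t} = mk⇔ to from
  where
  to : OnFace (inside ∷ L) (x ∷ t) → x ≡ head₀ t × OnFace L t
  to (on , off) = x≡ , vanishes-tail {x = x} on , λ i i∉ → subst (0ℚ <_) (simple-suc i x t) (off (suc i) λ { (Vec.there i∈) → i∉ i∈ })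
    where
    x≡ : x ≡ head₀ t
    x≡ with *-zero (scale n) (x - head₀ t) (trans (sym (simple-zero x t)) (on zero Vec.here))
    ... | inj₁ eq = contradiction (sym eq) (<⇒≢ (0<scale n))
    ... | inj₂ eq = p-q≡0⇒p≡q x (head₀ t) eq
  from : x ≡ head₀ t × OnFace L t → OnFace (inside ∷ L) (x ∷ t)
  from (x≡ , on , off) =
    (λ { zero _ → trans (simple-zero x t) (trans (cong (λ y → scale n * (y - head₀ t)) x≡)
           (trans (cong (scale n *_) (+-inverseʳ (head₀ t))) (*-zeroʳ (scale n))))
       ; (suc i) (Vec.there i∈) → trans (simple-suc i x t) (on i i∈) }) ,
    λ { zero i∉ → contradiction Vec.here i∉
      ; (suc i) i∉ → subst (0ℚ <_) (sym (simple-suc i x t)) (off i (i∉ ∘ Vec.there)) }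

p<q⇒0<q-p : ∀ {p q} → p < q → 0ℚ < q - p
p<q⇒0<q-p {p} {q} p<q = subst (_< q - p) (+-inverseʳ p) (ℚₚ.+-monoˡ-< (- p) p<q)

0<q-p⇒p<q : ∀ {p q} → 0ℚ < q - p → p < q
0<q-p⇒p<q {p} {q} 0< = subst₂ _<_ (+-identityˡ p) (solve 2 (λ q p → q :- p :+ p := q) refl q p) (ℚₚ.+-monoˡ-< p 0<)

onFace-outside : {L : Subset n} {x : ℚ} {t : V n} → OnFace (outside ∷ L) (x ∷ t) ⇔ (head₀ t < x × OnFace L t)
onFace-outside {n} {L} {x} {t} = mk⇔ to from
  where
  to : OnFace (outside ∷ L) (x ∷ t) → head₀ t < x × OnFace L t
  to (on , off) = 0<q-p⇒p<q (*-cancel-pos (0<scale n) (subst (0ℚ <_) (simple-zero x t) (off zero λ ()))) ,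
    vanishes-tail {x = x} on , λ i i∉ → subst (0ℚ <_) (simple-suc i x t) (off (suc i) λ { (Vec.there i∈) → i∉ i∈ })
  from : head₀ t < x × OnFace L t → OnFace (outside ∷ L) (x ∷ t)
  from (h<x , on , off) = (λ { (suc i) (Vec.there i∈) → trans (simple-suc i x t) (on i i∈) }) ,
    λ { zero _ → subst (0ℚ <_) (sym (simple-zero x t)) (*-pos (0<scale n) (p<q⇒0<q-p h<x))
      ; (suc i) i∉ → subst (0ℚ <_) (sym (simple-suc i x t)) (off i (i∉ ∘ Vec.there)) }

2∤⇒odd : ∀ k → ¬ (2 ∣ k) → ∃ λ m → k ≡ suc (m ℕ.+ m)
2∤⇒odd k 2∤k with parity k
  where
  parity : ∀ k → ∃ λ m → k ≡ m ℕ.+ m ⊎ k ≡ suc (m ℕ.+ m)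
  parity zero    = 0 , inj₁ refl
  parity (suc k) with parity k
  ... | m , inj₁ eq = m , inj₂ (cong suc eq)
  ... | m , inj₂ eq = suc m , inj₁ (cong suc (trans eq (sym (ℕₚ.+-suc m m))))
... | m , inj₂ eq = m , eq
... | m , inj₁ eq = contradiction (divides m (trans eq (double m))) 2∤k
  where
  double : ∀ m → m ℕ.+ m ≡ m ℕ.* 2
  double = solve-∀

fromℕ-cancel-< : ∀ {a b} → fromℕ a < fromℕ b → a ℕ.< b
fromℕ-cancel-< p = ℕₚ.≰⇒> λ b≤a → ≤⇒≯ (fromℕ-mono b≤a) p

unique-range : ∀ m → Unique (List.map (λ j → fromℕ j - fromℕ m) (upTo (suc (m ℕ.+ m))))
unique-range m = Uniqueₚ.map⁺ (λ {i} {j} eq → fromℕ-injective {i} {j} (trans (undo i) (trans (cong (_+ fromℕ m) eq) (sym (undo j)))))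
  (Uniqueₚ.upTo⁺ _)
  where
  undo : ∀ j → fromℕ j ≡ fromℕ j - fromℕ m + fromℕ m
  undo j = solve 2 (λ x y → x := x :- y :+ y) refl (fromℕ j) (fromℕ m)

module Cube (m : ℕ) where

  k : ℕ
  k = suc (m ℕ.+ m)

  range : List ℚ
  range = List.map (λ j → fromℕ j - fromℕ m) (upTo k)

  cube : ∀ n → List (V n)
  cube = allVec range

  unique-cube : ∀ n → Unique (cube n)
  unique-cube = unique-allVec (unique-range m)

  ∑-cube-1 : ∀ n → ∑ (cube n) (λ _ → 1ℚ) ≡ fromℕ k ^ n
  ∑-cube-1 n = trans (∑-allVec-1 range n) (cong (λ l → fromℕ l ^ n)
    (trans (Listₚ.length-map (λ j → fromℕ j - fromℕ m) (upTo k)) (Listₚ.length-upTo k)))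

  ∈-range : ∀ {q} → IsInt q → - fromℕ m ≤ q → q ≤ fromℕ m → q ∈ range
  ∈-range {q} q-int lo hi with j , j∈ , eq ← small {m ℕ.+ m} {q + fromℕ m} (int-+ q-int (ℤ.+ m , refl))
      (subst (_≤ q + fromℕ m) (ℚₚ.+-inverseˡ (fromℕ m)) (+-monoˡ-≤ (fromℕ m) lo))
      (subst (q + fromℕ m ≤_) (sym (fromℕ-+ m m)) (+-monoˡ-≤ (fromℕ m) hi)) =
    subst (_∈ range) (trans (cong (_- fromℕ m) (sym eq)) (solve 2 (λ x y → x :+ y :- y := x) refl q (fromℕ m)))
      (∈-map⁺ (λ j → fromℕ j - fromℕ m) j∈)

  range⁻ : ∀ {q} → q ∈ range → IsInt q × - fromℕ m ≤ q × q ≤ fromℕ m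
  range⁻ q∈ with j , j∈ , refl ← ∈-map⁻ (λ j → fromℕ j - fromℕ m) q∈ =
    int-+ (ℤ.+ j , refl) (int-neg (ℤ.+ m , refl)) ,
    subst (_≤ fromℕ j - fromℕ m) (+-identityˡ (- fromℕ m)) (+-monoˡ-≤ (- fromℕ m) (fromℕ-mono {0} {j} ℕ.z≤n)) ,
    subst (fromℕ j - fromℕ m ≤_) (trans (cong (_- fromℕ m) (fromℕ-+ m m)) (solve 1 (λ x → x :+ x :- x := x) refl (fromℕ m)))
      (+-monoˡ-≤ (- fromℕ m) (fromℕ-mono (ℕₚ.≤-pred (∈-upTo⁻ j∈))))

  0∈range : 0ℚ ∈ range
  0∈range = ∈-range (ℤ.+ 0 , refl) (neg-antimono-≤ 0≤m) 0≤m
    where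
    0≤m : 0ℚ ≤ fromℕ m
    0≤m = fromℕ-mono {0} {m} ℕ.z≤n

  range-signed : ∀ s {q} → q ∈ range → signed s q ∈ range
  range-signed Sign.+ q∈ = q∈
  range-signed Sign.- q∈ = let q-int , lo , hi = range⁻ q∈ in ∈-range (int-neg q-int)
    (neg-antimono-≤ hi) (subst (- _ ≤_) (neg-involutive (fromℕ m)) (neg-antimono-≤ lo))

  head₀-range : (t : V n) → t ∈ cube n → head₀ t ∈ range
  head₀-range []      _  = 0∈range
  head₀-range (x ∷ t) t∈ = allVec⁻ (x ∷ t) t∈ zero

  act-cube : (w : W n) {t : V n} → t ∈ cube n → act w t ∈ cube n
  act-cube w {t} t∈ = allVec⁺ (act w t) λ i → subst (_∈ range) (sym (lookup-act w t i))
    (range-signed (lookup (W.sign w) i) (allVec⁻ t t∈ (lookup (W.perm w) i)))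

  ∑-act : (w : W n) (f : V n → ℚ) → ∑ (cube n) (λ t → f (act w t)) ≡ ∑ (cube n) f
  ∑-act {n} w f = ∑-reindex _≟ᵥ_ (act w) (act (w ⁻¹)) f (unique-cube n) (unique-cube n)
    (λ {t} t∈ → act-cube w t∈ , act-⁻¹ˡ w t) (λ {t} t∈ → act-cube (w ⁻¹) t∈ , act-⁻¹ʳ w t)

  -- The number of sequences m ≥ t₁ > … > tₚ > 0, weighted by f t₁.
  chains : ℕ → (ℚ → ℚ) → ℚ
  chains zero    f = f 0ℚ
  chains (suc p) f = chains p (λ y → ∑[ x ∈ range ] [ y ℚₚ.<? x ]? * f x)

  faceSize : ℕ → ℚ
  faceSize p = chains p (λ _ → 1ℚ)

  private
    ∑-head : {b : Bool.Bool} {L : Subset n} {R : ℚ → ℚ → Set} (R? : ∀ x y → Dec (R x y)) →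
      (∀ {x t} → OnFace (b ∷ L) (x ∷ t) ⇔ (R x (head₀ t) × OnFace L t)) → (f : ℚ → ℚ) →
      ∑ (cube (suc n)) (λ t → [ onFace? (b ∷ L) t ]? * f (head₀ t)) ≡
      ∑ (cube n) (λ t → [ onFace? L t ]? * ∑ range (λ x → [ R? x (head₀ t) ]? * f x))
    ∑-head {n} {b} {L} R? iff f = begin
      ∑ (cube (suc n)) (λ t → [ onFace? (b ∷ L) t ]? * f (head₀ t))
        ≡⟨ ∑-× _∷_ range (cube n) _ ⟩
      ∑ range (λ x → ∑ (cube n) (λ t → [ onFace? (b ∷ L) (x ∷ t) ]? * f x))
        ≡⟨ ∑-swap range (cube n) _ ⟩
      ∑ (cube n) (λ t → ∑ range (λ x → [ onFace? (b ∷ L) (x ∷ t) ]? * f x))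
        ≡⟨ ∑-cong (cube n) (λ t → trans (∑-cong range (λ x → trans (cong (_* f x) (trans
             ([]?-cong (onFace? (b ∷ L) (x ∷ t)) (R? x (head₀ t) ×-dec onFace? L t) (⇒ iff) (⇐ iff))
             ([]?-× (R? x (head₀ t)) (onFace? L t))))
             (solve 3 (λ p q r → p :* q :* r := q :* (p :* r)) refl [ R? x (head₀ t) ]? [ onFace? L t ]? (f x))))
           (∑-*ˡ [ onFace? L t ]? range _)) ⟩
      ∑ (cube n) (λ t → [ onFace? L t ]? * ∑ range (λ x → [ R? x (head₀ t) ]? * f x)) ∎
      where open ≡-Reasoning

  -- The weight f on the first coordinate carries the recursion: `inside` forces a new first
  -- coordinate to equal the next one, and `outside` sums over the larger values and so changes the
  -- weight. Only the number of `outside` entries survives.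
  ∑-onFace-head : (L : Subset n) (f : ℚ → ℚ) →
    ∑ (cube n) (λ t → [ onFace? L t ]? * f (head₀ t)) ≡ chains (free L) f
  ∑-onFace-head [] f = trans (+-identityʳ _) (trans
    (cong (_* f 0ℚ) ([]?-yes (onFace? [] []) ((λ ()) , λ ()))) (*-identityˡ (f 0ℚ)))
  ∑-onFace-head {suc n} (inside ∷ L) f = trans (∑-head {L = L} ℚₚ._≟_ onFace-inside f)
    (trans (∑-cong∈ (cube n) (λ {t} t∈ → cong ([ onFace? L t ]? *_)
             (∑-indicator (λ x → x ℚₚ.≟ head₀ t) f (unique-range m) (head₀-range t t∈) refl (λ _ eq → eq))))
           (∑-onFace-head L f))
  ∑-onFace-head (outside ∷ L) f = trans (∑-head {L = L} (λ x y → y ℚₚ.<? x) onFace-outside f)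
    (∑-onFace-head L (λ y → ∑ range (λ x → [ y ℚₚ.<? x ]? * f x)))

  ∑-onFace : (L : Subset n) → ∑ (cube n) (λ t → [ onFace? L t ]?) ≡ faceSize (free L)
  ∑-onFace {n} L = trans (∑-cong (cube n) λ t → sym (*-identityʳ [ onFace? L t ]?)) (∑-onFace-head L (λ _ → 1ℚ))

  ⟨θ,⟩ : ∀ x (t : V n) → ⟨ θ , x ∷ t ⟩ ≡ x + x
  ⟨θ,⟩ x t = trans (cong (2ℚ * x +_) (⟨0,⟩ t)) (solve 1 (λ x → con 2ℚ :* x :+ con 0ℚ := x :+ x) refl x)

  ∈-points⁻ : ∀ {t : V n} {k} → t ∈ points n k → ∀ i → ∃ λ j → lookup t i ≡ fromℕ j
  ∈-points⁻ {n} {t} {k} t∈ i with ms , _ , refl ← ∈-map⁻ (Vec.map fromℕ) {xs = allVec (upTo (suc k)) n} t∈ =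
    lookup ms i , Vecₚ.lookup-map i fromℕ ms

  -- A dominant point has all coordinates between 0 and the first one, and the condition 2t₁ < 2m +
  -- 1 means t₁ ≤ m for integers. So the points counted in [0, k] are those of the centred cube.
  a-outside : (L : Subset (suc n)) → fromℕ (a k (outside ∷ L)) ≡ faceSize (free L)
  a-outside {n} L = begin
    fromℕ (a k (outside ∷ L))
      ≡⟨ fromℕ-length (filter (face? k (outside ∷ L)) (points (suc n) k)) ⟩
    ∑ (filter (face? k (outside ∷ L)) (points (suc n) k)) (λ _ → 1ℚ)
      ≡⟨ ∑-same _≟ᵥ_ (λ _ → 1ℚ) (Uniqueₚ.filter⁺ (face? k (outside ∷ L)) (points-unique (suc n) k))
           (Uniqueₚ.filter⁺ (onFace? L) (unique-cube (suc n))) to from ⟩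
    ∑ (filter (onFace? L) (cube (suc n))) (λ _ → 1ℚ)
      ≡⟨ ∑-filter (onFace? L) (cube (suc n)) (λ _ → 1ℚ) ⟩
    ∑ (cube (suc n)) (λ t → [ onFace? L t ]? * 1ℚ)
      ≡⟨ ∑-onFace-head L (λ _ → 1ℚ) ⟩
    faceSize (free L) ∎
    where
    open ≡-Reasoning
    0≤m : 0ℚ ≤ fromℕ m
    0≤m = fromℕ-mono {0} {m} ℕ.z≤n
    to : ∀ {t} → t ∈ filter (face? k (outside ∷ L)) (points (suc n) k) → t ∈ filter (onFace? L) (cube (suc n))
    to {x ∷ t} t∈ with t∈p , on , off , _ , below ← ∈-filter⁻ (face? k (outside ∷ L)) {xs = points (suc n) k} t∈ =
      ∈-filter⁺ (onFace? L) (allVec⁺ (x ∷ t) λ i → let j , eq = ∈-points⁻ t∈p i ; lo , hi = proj₂ (bounds t dom) i in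
        ∈-range (ℤ.+ j , eq) (ℚₚ.≤-trans (neg-antimono-≤ 0≤m) lo) (ℚₚ.≤-trans hi x≤m)) face
      where
      face : OnFace L (x ∷ t)
      face = (λ i i∈ → on i (Vec.there i∈)) , (λ i i∉ → off i (λ { (Vec.there i∈) → i∉ i∈ }))
      dom : Dominant (x ∷ t)
      dom = onFace-dominant face
      x≤m : x ≤ fromℕ m
      x≤m = let j , eq = ∈-points⁻ t∈p zero in subst (_≤ fromℕ m) (sym eq) (fromℕ-mono {j} {m} (ℕₚ.≮⇒≥ λ m<j →
        ℕₚ.<⇒≱ (fromℕ-cancel-< {j ℕ.+ j} {k} (subst (_< fromℕ k)
          (trans (⟨θ,⟩ x t) (trans (cong (λ q → q + q) eq) (sym (fromℕ-+ j j)))) (below λ ())))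
        (ℕₚ.+-mono-≤ m<j (ℕₚ.<⇒≤ m<j))))
    from : ∀ {t} → t ∈ filter (onFace? L) (cube (suc n)) → t ∈ filter (face? k (outside ∷ L)) (points (suc n) k)
    from {x ∷ t} t∈ with t∈c , face@(on , off) ← ∈-filter⁻ (onFace? L) {xs = cube (suc n)} t∈ =
      ∈-filter⁺ (face? k (outside ∷ L)) (∈-cube (x ∷ t) λ i → let q-int , _ , hi = range⁻ (allVec⁻ (x ∷ t) t∈c i) in
          small q-int (proj₁ (proj₂ (bounds t (onFace-dominant face)) i)) (ℚₚ.≤-trans hi (fromℕ-mono (ℕₚ.m≤n⇒m≤1+n (ℕₚ.m≤m+n m m)))))
        ((λ { i (Vec.there i∈) → on i i∈ }) , (λ i i∉ → off i (i∉ ∘ Vec.there)) , (λ ()) ,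
         λ _ → subst (_< fromℕ k) (sym (⟨θ,⟩ x t)) (ℚₚ.≤-<-trans (+-mono-≤ x≤m x≤m)
           (subst (_< fromℕ k) (fromℕ-+ m m) (fromℕ-mono-< (ℕₚ.n<1+n (m ℕ.+ m))))))
      where
      x≤m : x ≤ fromℕ m
      x≤m = proj₂ (proj₂ (range⁻ (allVec⁻ (x ∷ t) t∈c zero)))

  a-inside : (L : Subset (suc n)) → fromℕ (a k (inside ∷ L)) ≡ 0ℚ
  a-inside {n} L = trans (count-∑ (face? k (inside ∷ L)) (points (suc n) k)) (∑-zero (points (suc n) k) _ none)
    where
    odd : ∀ j m → j ℕ.+ j ≢ suc (m ℕ.+ m)
    odd (suc j) zero    eq = contradiction (ℕₚ.suc-injective (trans (sym (cong suc (ℕₚ.+-suc j j))) eq)) λ ()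
    odd (suc j) (suc m) eq = odd j m (ℕₚ.suc-injective (ℕₚ.suc-injective
      (trans (sym (cong suc (ℕₚ.+-suc j j))) (trans eq (cong (λ x → suc (suc x)) (ℕₚ.+-suc m m))))))
    none : ∀ {t} → t ∈ points (suc n) k → [ face? k (inside ∷ L) t ]? ≡ 0ℚ
    none {x ∷ t} t∈ = []?-no (face? k (inside ∷ L) (x ∷ t)) λ (_ , _ , on , _) → let j , eq = ∈-points⁻ t∈ zero in
      odd j m (fromℕ-injective {j ℕ.+ j} {k} (trans (fromℕ-+ j j) (trans (cong (λ q → q + q) (sym eq)) (trans (sym (⟨θ,⟩ x t)) (on Vec.here)))))

  x-∑ : (w : W (suc n)) → x[ k ] w ≡ (1ℚ ÷₀ fromℕ k ^ suc n)
    * (∑[ K ∈ subsets (suc n) ] [ K ⊆? ∁ (Des w) ]? * faceSize (free K))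
  x-∑ {n} w = cong ((1ℚ ÷₀ fromℕ k ^ suc n) *_) (begin
    ∑ (filter (_⊆? ∁ (Cdes w)) (subsets (suc (suc n)))) f
      ≡⟨ ∑-filter (_⊆? ∁ (Cdes w)) (subsets (suc (suc n))) f ⟩
    ∑ (subsets (suc (suc n))) (λ I → [ I ⊆? ∁ (Cdes w) ]? * f I)
      ≡⟨ ∑-× _∷_ (inside ∷ outside ∷ []) (subsets (suc n)) _ ⟩
    ∑ (subsets (suc n)) (λ K → [ (inside ∷ K) ⊆? ∁ (Cdes w) ]? * f (inside ∷ K))
      + (∑ (subsets (suc n)) (λ K → [ (outside ∷ K) ⊆? ∁ (Cdes w) ]? * f (outside ∷ K)) + 0ℚ)
      -- Sets containing α₀ contribute 0, and the others impose no condition at α₀, so `Cdes` can be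
      -- replaced by `Des`.
      ≡⟨ cong₂ (λ p q → p + (q + 0ℚ))
           (∑-zero (subsets (suc n)) _ λ {K} _ → 0c [ (inside ∷ K) ⊆? ∁ (Cdes w) ]? (f (inside ∷ K)) (a-inside K))
           (∑-cong (subsets (suc n)) λ K → cong₂ _*_
             (⊆?-outside (lookup (∁ (Cdes w)) zero) K (∁ (Des w))) (a-outside K)) ⟩
    0ℚ + (∑ (subsets (suc n)) (λ K → [ K ⊆? ∁ (Des w) ]? * faceSize (free K)) + 0ℚ)
      ≡⟨ solve 1 (λ x → con 0ℚ :+ (x :+ con 0ℚ) := x) refl _ ⟩
    ∑ (subsets (suc n)) (λ K → [ K ⊆? ∁ (Des w) ]? * faceSize (free K)) ∎)
    where
    open ≡-Reasoning
    f : Subset (suc (suc n)) → ℚ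
    f I = fromℕ (a k I)

-- Dimensions of flats

signed-0 : ∀ s → signed s 0ℚ ≡ 0ℚ
signed-0 Sign.+ = refl
signed-0 Sign.- = refl

-- A coordinatewise description of linear maps whose matrix has in each row at
-- most one nonzero entry, which is ± 1.
SignedRow : ∀ {q} → (V q → ℚ) → Set
SignedRow {q} f = (∀ z → f z ≡ 0ℚ) ⊎ ∃ λ (a : SignedIndex q) → ∀ z → f z ≡ z ⟦ a ⟧

signedRow-signed : ∀ {q} s {f : V q → ℚ} → SignedRow f → SignedRow (signed s ∘ f)
signedRow-signed s (inj₁ eq)             = inj₁ λ z → trans (cong (signed s) (eq z)) (signed-0 s)
signedRow-signed s (inj₂ ((t , b) , eq)) = inj₂ ((s Sign.* t , b) , λ z →
  trans (cong (signed s) (eq z)) (sym (signed-* s t (lookup z b))))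

-- Points of U have signed parameters or 0 as coordinates, and by `retract` each parameter is in
-- turn a signed coordinate. So the points of U in the cube correspond to a cube of parameters.
record Parametrised {n : ℕ} (U : Subspace n) (q : ℕ) : Set where
  field
    point   : V q → V n
    row     : ∀ i → SignedRow (λ z → lookup (point z) i)
    retract : ∀ b → ∃ λ a → ∀ z → lookup z b ≡ point z ⟦ a ⟧
    into    : ∀ z → point z ∈ₛ U
    onto    : ∀ v → v ∈ₛ U → ∃ λ z → point z ≡ v

-- The zero set of f is the graph of a signed coordinate (or zero) over a
-- coordinate hyperplane.
record Kernel {q : ℕ} (f : V (suc q) → ℚ) : Set where
  field
    pivot   : Fin (suc q)
    value   : V q → ℚ
    signed? : SignedRow value
    killed  : ∀ z → f (Vec.insertAt z pivot (value z)) ≡ 0ℚ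
    solved  : ∀ z → f z ≡ 0ℚ → lookup z pivot ≡ value (Vec.removeAt z pivot)
    nonzero : ∃ λ z → f z ≢ 0ℚ

KernelOf : ∀ q → (V q → ℚ) → Set
KernelOf zero    f = ⊥
KernelOf (suc q) f = Kernel f

opposite-index : SignedIndex n → SignedIndex n
opposite-index (s , i) = Sign.opposite s , i

⟦opposite⟧ : (v : V n) (a : SignedIndex n) → v ⟦ opposite-index a ⟧ ≡ - (v ⟦ a ⟧)
⟦opposite⟧ v (Sign.+ , i) = refl
⟦opposite⟧ v (Sign.- , i) = sym (neg-involutive (lookup v i))

opposite-≢ : (a : SignedIndex n) → opposite-index a ≢ a
opposite-≢ (Sign.+ , i) ()
opposite-≢ (Sign.- , i) ()

root-η≢0 : (u : W n) {α : V n} → Root α → ⟨ α , act (u ⁻¹) η ⟩ ≢ 0ℚ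
root-η≢0 u α∈ eq = root-act⁻¹ (u ⁻¹) α∈ eq

Multiple : ∀ {q} → (V q → ℚ) → Set
Multiple f = ∃ λ α → ∃ λ c → Root α × 0ℚ < c × ∀ z → f z ≡ c * ⟨ α , z ⟩

-- A root restricted to a parametrised space is a difference of two rows. If one row is zero, the
-- remaining ± z_b is half of the long root ± 2z_b, which explains the factor ½.
row-difference : ∀ {q} {f g h : V q → ℚ} → SignedRow g → SignedRow h → (∀ z → f z ≡ g z - h z) →
                 (∀ z → f z ≡ 0ℚ) ⊎ Multiple f
row-difference (inj₁ p) (inj₁ r) eq = inj₁ λ z → trans (eq z) (cong₂ _-_ (p z) (r z))
row-difference (inj₂ (b , p)) (inj₁ r) eq = inj₂ (se b -ᵥ se (opposite-index b) , ½ , (b , opposite-index b , opposite-≢ b ∘ sym , refl) ,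
  ℚₚ.positive⁻¹ ½ , λ z → trans (eq z) (trans (cong₂ _-_ (p z) (r z))
    (trans (solve 1 (λ x → x :- con 0ℚ := con ½ :* (x :- (:- x))) refl (z ⟦ b ⟧))
      (cong (½ *_) (sym (trans (⟨se-se,⟩ b (opposite-index b) z) (cong (λ q → z ⟦ b ⟧ - q) (⟦opposite⟧ z b))))))))
row-difference (inj₁ p) (inj₂ (c , r)) eq = inj₂ (se (opposite-index c) -ᵥ se c , ½ , (opposite-index c , c , opposite-≢ c , refl) ,
  ℚₚ.positive⁻¹ ½ , λ z → trans (eq z) (trans (cong₂ _-_ (p z) (r z))
    (trans (solve 1 (λ x → con 0ℚ :- x := con ½ :* ((:- x) :- x)) refl (z ⟦ c ⟧))
      (cong (½ *_) (sym (trans (⟨se-se,⟩ (opposite-index c) c z) (cong (_- z ⟦ c ⟧) (⟦opposite⟧ z c))))))))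
row-difference (inj₂ (b , p)) (inj₂ (c , r)) eq with rank b ℕₚ.≟ rank c
... | yes same with refl ← rank-injective b c same = inj₁ λ z → trans (eq z)
        (trans (cong₂ _-_ (p z) (r z)) (+-inverseʳ (z ⟦ b ⟧)))
... | no apart = inj₂ (se b -ᵥ se c , 1ℚ , (b , c , (λ b≡c → apart (cong rank b≡c)) , refl) , 0<1 , λ z →
        trans (eq z) (trans (cong₂ _-_ (p z) (r z)) (trans (sym (⟨se-se,⟩ b c z)) (sym (*-identityˡ _)))))

module RootMultiple {q : ℕ} {f : V q → ℚ} (a c : SignedIndex q) (a≢c : a ≢ c) (κ : ℚ) (0<κ : 0ℚ < κ)
                    (eq : ∀ z → f z ≡ κ * ⟨ se a -ᵥ se c , z ⟩) where
  private
    split : ∀ z → f z ≡ 0ℚ → ⟨ se a -ᵥ se c , z ⟩ ≡ 0ℚ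
    split z fz = [ (λ κ≡0 → contradiction (sym κ≡0) (<⇒≢ 0<κ)) , (λ p → p) ]′ (*-zero κ _ (trans (sym (eq z)) fz))

  vanish : ∀ z → z ⟦ a ⟧ - z ⟦ c ⟧ ≡ 0ℚ → f z ≡ 0ℚ
  vanish z p = trans (eq z) (0c κ _ (trans (⟨se-se,⟩ a c z) p))

  vanishes : ∀ z → f z ≡ 0ℚ → z ⟦ a ⟧ - z ⟦ c ⟧ ≡ 0ℚ
  vanishes z fz = trans (sym (⟨se-se,⟩ a c z)) (split z fz)

  nonzero : f (act (ε ⁻¹) η) ≢ 0ℚ
  nonzero fz = root-η≢0 ε (a , c , a≢c , refl) (split _ fz)

-- A short root gives the equation z_b = ± z_c, solved for z_b. In a long root the two indices agree
-- with opposite signs, and the equation is z_b = 0.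
root-kernel : ∀ {q} {f : V q → ℚ} → Multiple f → KernelOf q f
root-kernel {zero} (_ , _ , ((_ , ()) , _) , _)
root-kernel {suc q} {f} (_ , κ , ((s , b) , (t , c) , a≢c , refl) , 0<κ , eq) with b Finₚ.≟ c
... | no b≢c = record
  { pivot   = b
  ; value   = λ z → z ⟦ s Sign.* t , punchOut b≢c ⟧
  ; signed? = inj₂ ((s Sign.* t , punchOut b≢c) , λ _ → refl)
  ; killed  = λ z → vanish _ (trans (cong₂ _-_
      (trans (cong (signed s) (Vecₚ.insertAt-lookup z b _)) (trans (cong (signed s) (signed-* s t _)) (signed-involutive s _)))
      (cong (signed t) (trans (cong (lookup (Vec.insertAt z b _)) (sym (Finₚ.punchIn-punchOut b≢c))) (Vecₚ.insertAt-punchIn z b _ (punchOut b≢c)))))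
      (+-inverseʳ (signed t (lookup z (punchOut b≢c)))))
  ; solved  = λ z fz → trans (sym (signed-involutive s (lookup z b))) (trans
      (cong (signed s) (p-q≡0⇒p≡q _ _ (vanishes z fz)))
      (trans (sym (signed-* s t (lookup z c))) (cong (signed (s Sign.* t)) (sym (Vecₚ.removeAt-punchOut z b≢c)))))
  ; nonzero = act (ε ⁻¹) η , nonzero
  }
  where
  open RootMultiple {f = f} (s , b) (t , c) a≢c κ 0<κ eq
... | yes refl = record
  { pivot   = b
  ; value   = λ _ → 0ℚ
  ; signed? = inj₁ (λ _ → refl)
  ; killed  = λ z → vanish _ (trans (cong (λ x → signed s x - signed t x) (Vecₚ.insertAt-lookup z b 0ℚ)) (cong₂ _-_ (signed-0 s) (signed-0 t)))
  ; solved  = λ z fz → unequal s t (λ { refl → a≢c refl }) (vanishes z fz)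
  ; nonzero = act (ε ⁻¹) η , nonzero
  }
  where
  open RootMultiple {f = f} (s , b) (t , b) a≢c κ 0<κ eq
  half : ∀ {x} → 2ℚ * x ≡ 0ℚ → x ≡ 0ℚ
  half {x} eq = [ (λ ()) , (λ p → p) ]′ (*-zero 2ℚ x eq)
  unequal : ∀ s t {x} → s ≢ t → signed s x - signed t x ≡ 0ℚ → x ≡ 0ℚ
  unequal Sign.+ Sign.+     s≢t _  = contradiction refl s≢t
  unequal Sign.- Sign.-     s≢t _  = contradiction refl s≢t
  unequal Sign.+ Sign.- {x} _   eq = half (trans (solve 1 (λ x → con 2ℚ :* x := x :- (:- x)) refl x) eq)
  unequal Sign.- Sign.+ {x} _   eq = half (trans (solve 1 (λ x → con 2ℚ :* x := :- ((:- x) :- x)) refl x) (cong -_ eq))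

cut-size-≡ : ∀ {d} (f : V n) (bs : Vec (V n) d) → (∀ c → ⟨ f , comb c bs ⟩ ≡ 0ℚ) → proj₁ (cut f bs) ≡ d
cut-size-≡ f []       vanish = refl
cut-size-≡ {d = suc d} f (b ∷ bs) vanish with ⟨ f , b ⟩ ℚₚ.≟ 0ℚ
... | yes _ = cong suc (cut-size-≡ f bs λ c → trans (sym (trans (⟨⟩-comb f b 0ℚ c bs)
                (trans (cong (_+ ⟨ f , comb c bs ⟩) (*-zeroˡ (⟨ f , b ⟩))) (+-identityˡ _)))) (vanish (0ℚ ∷ c)))
... | no ≢0 = contradiction (trans (sym (trans (⟨⟩-comb f b 1ℚ (replicate d 0ℚ) bs) (trans (cong₂ _+_ (*-identityˡ (⟨ f , b ⟩))
                (trans (cong ⟨ f ,_⟩ (comb-0 bs)) (⟨⟩-0 f))) (+-identityʳ _)))) (vanish (1ℚ ∷ replicate d 0ℚ))) ≢0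

-- `cut` discards exactly the first basis vector on which f is nonzero, and there is one if f is
-- nonzero on some combination.
cut-size-< : ∀ {d} (f : V n) (bs : Vec (V n) d) c → ⟨ f , comb c bs ⟩ ≢ 0ℚ → suc (proj₁ (cut f bs)) ≡ d
cut-size-< f []       []       ≢0 = contradiction (⟨⟩-0 f) ≢0
cut-size-< f (b ∷ bs) (c ∷ cs) ≢0 with ⟨ f , b ⟩ ℚₚ.≟ 0ℚ
... | yes eq = cong suc (cut-size-< f bs cs λ p → ≢0 (trans (⟨⟩-comb f b c cs bs) (cong₂ _+_ (0c c _ eq) p)))
... | no _   = refl

row-⟦⟧ : {U : Subspace n} {q : ℕ} (P : Parametrised U q) (a : SignedIndex n) →
         SignedRow (λ z → Parametrised.point P z ⟦ a ⟧)
row-⟦⟧ P (s , i) = signedRow-signed s (Parametrised.row P i)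

parametrised-kernel : {U : Subspace n} {q : ℕ} (P : Parametrised U (suc q)) (f : V n) →
  Kernel (λ z → ⟨ f , Parametrised.point P z ⟩) → Parametrised (f ∷ U) q
parametrised-kernel {n} {U} {q} P f ker = record
  { point   = point ∘ insert
  ; row     = λ i → row′ (row i)
  ; retract = λ b → let p , eq = retract (punchIn pivot b) in p , λ z →
                trans (sym (Vecₚ.insertAt-punchIn z pivot (value z) b)) (eq (insert z))
  ; into    = λ z → killed z ∷ into (insert z)
  ; onto    = λ { v (fv ∷ v∈) → let z , eq = onto v v∈ in Vec.removeAt z pivot ,
                trans (cong point (trans (cong (Vec.insertAt (Vec.removeAt z pivot) pivot)
                    (sym (solved z (trans (cong ⟨ f ,_⟩ eq) fv)))) (Vecₚ.insertAt-removeAt z pivot))) eq }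
  }
  where
  open Parametrised P
  open Kernel ker
  insert : V q → V (suc q)
  insert z = Vec.insertAt z pivot (value z)
  coordinate : ∀ b → SignedRow (λ z → lookup (insert z) b)
  coordinate b with pivot Finₚ.≟ b
  ... | yes refl = [ (λ eq → inj₁ λ z → trans (Vecₚ.insertAt-lookup z pivot (value z)) (eq z))
                   , (λ (p , eq) → inj₂ (p , λ z → trans (Vecₚ.insertAt-lookup z pivot (value z)) (eq z))) ]′ signed?
  ... | no p≢b   = inj₂ ((Sign.+ , punchOut p≢b) , λ z → trans (cong (lookup (insert z)) (sym (Finₚ.punchIn-punchOut p≢b)))
                     (Vecₚ.insertAt-punchIn z pivot (value z) (punchOut p≢b)))
  row′ : ∀ {g : V (suc q) → ℚ} → SignedRow g → SignedRow (g ∘ insert)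
  row′ (inj₁ eq)             = inj₁ (eq ∘ insert)
  row′ (inj₂ ((s , b) , eq)) with signedRow-signed s (coordinate b)
  ... | inj₁ eq′       = inj₁ λ z → trans (eq (insert z)) (eq′ z)
  ... | inj₂ (p , eq′) = inj₂ (p , λ z → trans (eq (insert z)) (eq′ z))

-- `dim` is the size of a basis obtained by elimination, whose vectors need not respect the cube. A
-- second solution by signed coordinates runs alongside it; a new equation either is redundant for
-- both or lowers both sizes by one.
parametrise : (U : Subspace n) → All Positive U → Parametrised U (dim U)
parametrise [] [] = record
  { point   = λ z → z
  ; row     = λ i → inj₂ ((Sign.+ , i) , λ _ → refl)
  ; retract = λ b → (Sign.+ , b) , λ _ → refl
  ; into    = λ _ → []
  ; onto    = λ v _ → v , refl
  }
parametrise {n} (f ∷ U) ((p , r , _ , f≡) ∷ U⁺) = step (row-difference (row-⟦⟧ P p) (row-⟦⟧ P r) λ z → trans (cong ⟨_, point z ⟩ f≡) (⟨se-se,⟩ p r (point z)))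
  where
  P : Parametrised U (dim U)
  P = parametrise U U⁺
  open Parametrised P
  open Basis (basis U) using (vectors; lies-in; spanning)
  step : (∀ z → ⟨ f , point z ⟩ ≡ 0ℚ) ⊎ Multiple (λ z → ⟨ f , point z ⟩) → Parametrised (f ∷ U) (dim (f ∷ U))
  step (inj₁ flat) = subst (Parametrised (f ∷ U)) (sym (cut-size-≡ f vectors λ c → let z , eq = onto _ (lies-in c) in
      trans (cong ⟨ f ,_⟩ (sym eq)) (flat z))) (record
    { point   = point
    ; row     = row
    ; retract = retract
    ; into    = λ z → flat z ∷ into z
    ; onto    = λ { v (_ ∷ v∈) → onto v v∈ }
    })
  step (inj₂ multiple) = smaller (dim U) refl P (root-kernel multiple) λ c z eq ≢0 → cut-size-< f vectors c λ vanish → ≢0 (trans (cong ⟨ f ,_⟩ (sym eq)) vanish)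
    where
    -- The dimension is generalised to q so that it can be matched as a successor; at 0 there is no
    -- `KernelOf`.
    smaller : ∀ q → dim U ≡ q → (P : Parametrised U q) → KernelOf q (λ z → ⟨ f , Parametrised.point P z ⟩) →
      (∀ c z → comb c vectors ≡ Parametrised.point P z → ⟨ f , Parametrised.point P z ⟩ ≢ 0ℚ → suc (dim (f ∷ U)) ≡ dim U) →
      Parametrised (f ∷ U) (dim (f ∷ U))
    smaller (suc q) dim≡ P ker drop = let z , ≢0 = Kernel.nonzero ker
                                          c , eq = spanning (Parametrised.point P z) (Parametrised.into P z) in
      subst (Parametrised (f ∷ U)) (sym (ℕₚ.suc-injective (trans (drop c z eq ≢0) dim≡))) (parametrised-kernel P f ker)

module _ (m : ℕ) where
  open Cube m

  -- The parametrisation is a bijection from the cube of parameters onto the points of U in the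
  -- cube, in both directions because `range` contains 0 and is closed under negation.
  ∑-∈ₛ : (U : Subspace n) → All Positive U → ∑ (cube n) (λ t → [ t ∈ₛ? U ]?) ≡ fromℕ k ^ dim U
  ∑-∈ₛ {n} U U⁺ = begin
    ∑ (cube n) (λ t → [ t ∈ₛ? U ]?)  ≡⟨ ∑-cong (cube n) (λ t → sym (*-identityʳ [ t ∈ₛ? U ]?)) ⟩
    ∑ (cube n) (λ t → [ t ∈ₛ? U ]? * 1ℚ)  ≡⟨ sym (∑-filter (_∈ₛ? U) (cube n) (λ _ → 1ℚ)) ⟩
    ∑ (filter (_∈ₛ? U) (cube n)) (λ _ → 1ℚ)  ≡⟨ sym (∑-match (unique-cube (dim U)) (Uniqueₚ.filter⁺ (_∈ₛ? U) (unique-cube n))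
      (λ z t → point z ≟ᵥ t)
      (λ {z} z∈ → point z , ∈-filter⁺ (_∈ₛ? U) (allVec⁺ (point z) (λ i → row-range (row i) z∈)) (into z) , refl)
      (λ _ _ _ p q → trans (sym p) q)
      (λ {t} t∈ → let t∈c , t∈U = ∈-filter⁻ (_∈ₛ? U) {xs = cube n} t∈ ; z , eq = onto t t∈U in z ,
        allVec⁺ z (λ b → let p , eq′ = retract b in subst (_∈ range) (sym (trans (eq′ z) (cong (_⟦ p ⟧) eq)))
          (range-signed (proj₁ p) (allVec⁻ t t∈c (proj₂ p)))) , eq)
      (λ {z} {z′} _ _ _ p q → lookup-ext λ b → let r , eq = retract b in
        trans (eq z) (trans (cong (_⟦ r ⟧) (trans p (sym q))) (sym (eq z′))))
      (λ _ _ _ → refl)) ⟩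
    ∑ (cube (dim U)) (λ _ → 1ℚ)  ≡⟨ ∑-cube-1 (dim U) ⟩
    fromℕ k ^ dim U  ∎
    where
    open ≡-Reasoning
    open Parametrised (parametrise U U⁺)
    row-range : ∀ {g : V (dim U) → ℚ} {z} → SignedRow g → z ∈ cube (dim U) → g z ∈ range
    row-range {z = z} (inj₁ eq)             z∈ = subst (_∈ range) (sym (eq z)) 0∈range
    row-range {z = z} (inj₂ ((s , b) , eq)) z∈ = subst (_∈ range) (sym (eq z)) (range-signed s (allVec⁻ z z∈ b))

-- The characteristic polynomial

deduplicate-allPairs : {R : A → A → Set} (R? : ∀ a b → Dec (R a b)) (as : List A) →
                       AllPairs (λ a b → ¬ R a b) (deduplicate R? as)
deduplicate-allPairs R? []       = AllPairs.[]
deduplicate-allPairs R? (a ∷ as) = Allₚ.all-filter (¬? ∘ R? a) (deduplicate R? as)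
  AllPairs.∷ AllPairsₚ.filter⁺ (¬? ∘ R? a) (deduplicate-allPairs R? as)

allPairs-lookup : {R : A → A → Set} {as : List A} → AllPairs R as → ∀ {i j} → i ≢ j →
                  R (List.lookup as i) (List.lookup as j) ⊎ R (List.lookup as j) (List.lookup as i)
allPairs-lookup (ps AllPairs.∷ pps) {zero}  {zero}  i≢j = contradiction refl i≢j
allPairs-lookup (ps AllPairs.∷ pps) {zero}  {suc j} i≢j = inj₁ (All.lookup ps (∈-lookup j))
allPairs-lookup (ps AllPairs.∷ pps) {suc i} {zero}  i≢j = inj₂ (All.lookup ps (∈-lookup i))
allPairs-lookup (ps AllPairs.∷ pps) {suc i} {suc j} i≢j = allPairs-lookup pps (i≢j ∘ cong suc)

filter-∈-sublists : {P : Pred A 0ℓ} (P? : Decidable P) (as : List A) → filter P? as ∈ sublists as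
filter-∈-sublists P? []       = here refl
filter-∈-sublists P? (a ∷ as) with does (P? a)
... | true  = ∈-++⁺ˡ (∈-map⁺ (a ∷_) (filter-∈-sublists P? as))
... | false = ∈-++⁺ʳ (List.map (a ∷_) (sublists as)) (filter-∈-sublists P? as)

sublists-All : {P : Pred A 0ℓ} {as bs : List A} → All P as → bs ∈ sublists as → All P bs
sublists-All {as = []}     []       (here refl) = []
sublists-All {as = a ∷ as} (p ∷ ps) bs∈ with ∈-++⁻ (List.map (a ∷_) (sublists as)) bs∈
... | inj₂ bs∈′ = sublists-All ps bs∈′
... | inj₁ bs∈′ with cs , cs∈ , refl ← ∈-map⁻ (a ∷_) {xs = sublists as} bs∈′ = p ∷ sublists-All ps cs∈

-- The equations of the smallest flat through t.
rootsAt : V n → Subspace n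
rootsAt {n} t = filter (λ α → ⟨ α , t ⟩ ℚₚ.≟ 0ℚ) (Φ⁺ n)

rootsAt⁺ : {t α : V n} → Positive α → ⟨ α , t ⟩ ≡ 0ℚ → α ∈ rootsAt t
rootsAt⁺ α⁺ eq = ∈-filter⁺ (λ α → ⟨ α , _ ⟩ ℚₚ.≟ 0ℚ) (positive-∈Φ⁺ α⁺) eq

rootsAt⁻ : {t α : V n} → α ∈ rootsAt t → Positive α × ⟨ α , t ⟩ ≡ 0ℚ
rootsAt⁻ {n} {t} α∈ = let α∈Φ , eq = ∈-filter⁻ (λ α → ⟨ α , t ⟩ ℚₚ.≟ 0ℚ) {xs = Φ⁺ n} α∈ in ∈Φ⁺-positive α∈Φ , eq

rootsAt-self : (t : V n) → t ∈ₛ rootsAt t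
rootsAt-self t = All.tabulate (proj₂ ∘ rootsAt⁻ {t = t})

rootsAt-least : {U : Subspace n} → All Positive U → (t : V n) → t ∈ₛ U ⇔ (rootsAt t ⊆ₛ U)
rootsAt-least U⁺ t = mk⇔
  (λ t∈U v v∈ → All.tabulate λ {f} f∈ → All.lookup v∈ (rootsAt⁺ {t = t} (All.lookup U⁺ f∈) (All.lookup t∈U f∈)))
  (λ sub → sub t (rootsAt-self t))

-- If u fixes t then eᵢ - u⁻¹eᵢ is zero or a root vanishing at t.
∈-rootsAt : (t v : V n) → v ∈ₛ rootsAt t ⇔ (∀ u → act u t ≡ t → act u v ≡ v)
∈-rootsAt t v = mk⇔ to from
  where
  from : (∀ u → act u t ≡ t → act u v ≡ v) → v ∈ₛ rootsAt t
  from fix = All.tabulate λ α∈ → let α⁺ , eq = rootsAt⁻ {t = t} α∈ ; s , act-s = reflection α⁺ in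
    fixed-by-reflection α⁺ (trans (sym (act-s v)) (fix s (trans (act-s t) (reflect-fixes α⁺ eq))))
  root-vanishes : v ∈ₛ rootsAt t → {α : V _} → Root α → ⟨ α , t ⟩ ≡ 0ℚ → ⟨ α , v ⟩ ≡ 0ℚ
  root-vanishes v∈ {α} α∈ eq with root-sign α∈
  ... | inj₁ α⁺ = All.lookup v∈ (rootsAt⁺ {t = t} α⁺ eq)
  ... | inj₂ α⁻ = ℚₚ.neg-injective (trans (sym (⟨neg⟩ˡ α v))
                    (All.lookup v∈ (rootsAt⁺ {t = t} α⁻ (trans (⟨neg⟩ˡ α t) (cong -_ eq)))))
  to : v ∈ₛ rootsAt t → ∀ u → act u t ≡ t → act u v ≡ v
  to v∈ u ut = lookup-ext λ i → coordinate i
    where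
    coordinate : ∀ i → lookup (act u v) i ≡ lookup v i
    coordinate i with rank ((Sign.+ , i) ◃ u) ℕₚ.≟ rank (Sign.+ , i)
    ... | yes same = trans (lookup-act u v i) (cong (v ⟦_⟧) (rank-injective ((Sign.+ , i) ◃ u) (Sign.+ , i) same))
    ... | no apart = trans (lookup-act u v i) (p-q≡0⇒p≡q _ _ (trans (sym (⟨se-se,⟩ ((Sign.+ , i) ◃ u) (Sign.+ , i) v))
      (root-vanishes v∈ ((Sign.+ , i) ◃ u , (Sign.+ , i) , (λ eq → apart (cong rank eq)) , refl)
        (trans (⟨se-se,⟩ ((Sign.+ , i) ◃ u) (Sign.+ , i) t)
          (trans (cong (_- lookup t i) (trans (sym (lookup-act u t i)) (cong (λ x → lookup x i) ut))) (+-inverseʳ (lookup t i)))))))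

Stabilises : Subset n → V n → Set
Stabilises K t = ∀ u → (act u t ≡ t → u ∈W⟨ K ⟩) × (u ∈W⟨ K ⟩ → act u t ≡ t)

stabilises? : (K : Subset n) → Decidable (Stabilises K)
stabilises? K t = ∀W? λ u → ((act u t ≟ᵥ t) →-dec u ∈W⟨ K ⟩?) ×-dec (u ∈W⟨ K ⟩? →-dec (act u t ≟ᵥ t))

-- By `∈-rootsAt` the smallest flat through t is the fixed space of the stabiliser of t. The fixed
-- space of the parabolic subgroup determines it, because it contains `generic K`, whose stabiliser
-- is that subgroup.
Fix-≐ : (K : Subset n) (t : V n) → (Fix K ≐ rootsAt t) ⇔ Stabilises K t
Fix-≐ K t = mk⇔ to from
  where
  open module F v = Equivalence (∈-Fix K v) using () renaming (to to Fix⁻; from to Fix⁺)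
  open module R v = Equivalence (∈-rootsAt t v) using () renaming (to to rootsAt⇒; from to ⇒rootsAt)
  to : Fix K ≐ rootsAt t → Stabilises K t
  to (Fix⊆ , ⊆Fix) u =
    (λ ut → ⇒ (stabiliser-generic K u) (rootsAt⇒ (generic K)
      (Fix⊆ (generic K) (Fix⁺ (generic K) λ x → ⇐ (stabiliser-generic K x))) u ut)) ,
    Fix⁻ t (⊆Fix t (rootsAt-self t)) u
  from : Stabilises K t → Fix K ≐ rootsAt t
  from stab = (λ v v∈ → ⇒rootsAt v λ u ut → Fix⁻ v v∈ u (proj₁ (stab u) ut)) ,
              (λ v v∈ → Fix⁺ v λ u u∈ → rootsAt⇒ v v∈ u (proj₂ (stab u) u∈))

module _ (n : ℕ) where
  open Lattice n

  space-∈ : (y : Flat) → space y ∈ sublists (Φ⁺ n)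
  space-∈ y = ∈-deduplicate⁻ _≐?_ (sublists (Φ⁺ n)) (∈-lookup y)

  space-positive : (y : Flat) → All Positive (space y)
  space-positive y = sublists-All (All.tabulate ∈Φ⁺-positive) (space-∈ y)

  ≐-sym : {X X′ : Subspace n} → X ≐ X′ → X′ ≐ X
  ≐-sym (p , q) = q , p

  ≐-trans : {X X′ X″ : Subspace n} → X ≐ X′ → X′ ≐ X″ → X ≐ X″
  ≐-trans (p , q) (p′ , q′) = (λ v → p′ v ∘ p v) , (λ v → q v ∘ q′ v)

  space-unique : {y z : Flat} → space y ≐ space z → y ≡ z
  space-unique {y} {z} eq with y Finₚ.≟ z
  ... | yes y≡z = y≡z
  ... | no y≢z with allPairs-lookup (deduplicate-allPairs _≐?_ (sublists (Φ⁺ n))) y≢z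
  ...   | inj₁ ¬eq = contradiction eq ¬eq
  ...   | inj₂ ¬eq = contradiction (≐-sym {space y} {space z} eq) ¬eq

  abstract
    flatAt : (t : V n) → ∃ λ y → space y ≐ rootsAt t
    flatAt t = Any.index found , Anyₚ.lookup-index found
      where
      found : Any.Any (_≐ rootsAt t) (L n)
      found = Anyₚ.deduplicate⁺ _≐?_ (λ {X} {X′} X′≐X X≐ → ≐-trans {X′} {X} {rootsAt t} X′≐X X≐)
        (lose (filter-∈-sublists (λ α → ⟨ α , t ⟩ ℚₚ.≟ 0ℚ) (Φ⁺ n)) ((λ _ p → p) , (λ _ p → p)))

  ≤ₗ-flatAt : (t : V n) (y : Flat) → t ∈ₛ space y ⇔ (space y ≤ₗ space (proj₁ (flatAt t)))
  ≤ₗ-flatAt t y = mk⇔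
    (λ t∈ v v∈ → ⇒ (rootsAt-least (space-positive y) t) t∈ v (proj₁ (proj₂ (flatAt t)) v v∈))
    (λ sub → ⇐ (rootsAt-least (space-positive y) t) λ v v∈ → sub v (proj₂ (proj₂ (flatAt t)) v v∈))

  möbius-term-[]? : (X : Subspace n) (z y : Flat) (p? : Dec (X ≤ₗ space z × z ≺ y)) →
    möbius-term X {z} {y} (λ _ → möbius X z) p? ≡ [ p? ]? * möbius X z
  möbius-term-[]? X z y (yes _) = sym (*-identityˡ (möbius X z))
  möbius-term-[]? X z y (no _)  = sym (*-zeroˡ (möbius X z))

  -- The recursion for the Möbius function with its term z = y moved to the other side. If X does
  -- not lie below y, the interval is empty and both sides are 0.
  ∑-möbius : (X : Subspace n) (y : Flat) →
    ∑ (allFin _) (λ z → [ (X ≤ₗ? space z) ×-dec (space z ≤ₗ? space y) ]? * möbius X z) ≡ [ X ≐? space y ]?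
  ∑-möbius X y = begin
    ∑ (allFin _) (λ z → [ (X ≤ₗ? space z) ×-dec (space z ≤ₗ? space y) ]? * möbius X z)
      ≡⟨ ∑-cong (allFin _) (λ z → split z (z Finₚ.≟ y)) ⟩
    ∑ (allFin _) (λ z → [ (X ≤ₗ? space z) ×-dec (z ≺? y) ]? * möbius X z + [ z Finₚ.≟ y ]? * ([ X ≤ₗ? space z ]? * möbius X z))
      ≡⟨ ∑-+ (allFin (length (L n))) _ _ ⟩
    S + ∑ (allFin _) (λ z → [ z Finₚ.≟ y ]? * ([ X ≤ₗ? space z ]? * möbius X z))
      ≡⟨ cong (S +_) (∑-indicator (Finₚ._≟ y) _ (Uniqueₚ.allFin⁺ _) (∈-allFin y) refl (λ _ eq → eq)) ⟩
    S + [ X ≤ₗ? space y ]? * möbius X y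
      ≡⟨ cong (λ q → S + [ X ≤ₗ? space y ]? * q) (trans (möbius-rec n X y) (cong (λ s → [ X ≐? space y ]? - s)
           (∑-cong (allFin _) λ z → möbius-term-[]? X z y ((X ≤ₗ? space z) ×-dec (z ≺? y))))) ⟩
    S + [ X ≤ₗ? space y ]? * ([ X ≐? space y ]? - S)
      ≡⟨ finish (X ≤ₗ? space y) ⟩
    [ X ≐? space y ]? ∎
    where
    open ≡-Reasoning
    S : ℚ
    S = ∑ (allFin _) (λ z → [ (X ≤ₗ? space z) ×-dec (z ≺? y) ]? * möbius X z)
    split : ∀ z (d : Dec (z ≡ y)) → [ (X ≤ₗ? space z) ×-dec (space z ≤ₗ? space y) ]? * möbius X z ≡
      [ (X ≤ₗ? space z) ×-dec (z ≺? y) ]? * möbius X z + [ d ]? * ([ X ≤ₗ? space z ]? * möbius X z)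
    split z (yes refl) = trans (cong (_* möbius X z) ([]?-cong ((X ≤ₗ? space z) ×-dec (space z ≤ₗ? space z)) (X ≤ₗ? space z) proj₁ (λ p → p , λ _ q → q)))
      (sym (trans (cong (λ q → q * möbius X z + 1ℚ * ([ X ≤ₗ? space z ]? * möbius X z))
                    ([]?-no ((X ≤ₗ? space z) ×-dec (z ≺? z)) λ (_ , p , ¬p) → ¬p p))
        (solve 2 (λ p q → con 0ℚ :* q :+ con 1ℚ :* (p :* q) := p :* q) refl [ X ≤ₗ? space z ]? (möbius X z))))
    split z (no z≢y) = trans (cong (_* möbius X z) ([]?-cong ((X ≤ₗ? space z) ×-dec (space z ≤ₗ? space y)) ((X ≤ₗ? space z) ×-dec (z ≺? y))
        (λ (p , q) → p , q , λ q′ → z≢y (space-unique (q′ , q))) (λ (p , q , _) → p , q)))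
      (solve 3 (λ p q r → p :* q := p :* q :+ con 0ℚ :* (r :* q)) refl [ (X ≤ₗ? space z) ×-dec (z ≺? y) ]? (möbius X z) [ X ≤ₗ? space z ]?)
    finish : (d : Dec (X ≤ₗ space y)) → S + [ d ]? * ([ X ≐? space y ]? - S) ≡ [ X ≐? space y ]?
    finish (yes _)  = solve 2 (λ s q → s :+ con 1ℚ :* (q :- s) := q) refl S [ X ≐? space y ]?
    finish (no X≰y) = trans (solve 2 (λ s q → s :+ con 0ℚ :* (q :- s) := s) refl S [ X ≐? space y ]?)
      (trans (∑-zero (allFin _) _ λ {z} _ → trans (cong (_* möbius X z) ([]?-no ((X ≤ₗ? space z) ×-dec (z ≺? y))
          λ (p , q , _) → X≰y λ v v∈ → p v (q v v∈))) (*-zeroˡ (möbius X z)))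
        (sym ([]?-no (X ≐? space y) λ (p , q) → X≰y q)))

  -- Möbius inversion over the flats through a point: every flat U has k^dim U
  -- points in the cube, so χ counts the points whose flat is exactly X.
  χ-Fix : (m : ℕ) (K : Subset n) → χ (Fix K) (fromℕ (Cube.k m)) ≡ ∑ (Cube.cube m n) (λ t → [ stabilises? K t ]?)
  χ-Fix m K = begin
    ∑ (filter (λ y → X ≤ₗ? space y) (allFin _)) (λ y → möbius X y * fromℕ k ^ dim (space y))
      ≡⟨ ∑-filter (λ y → X ≤ₗ? space y) (allFin _) _ ⟩
    ∑ (allFin _) (λ y → [ X ≤ₗ? space y ]? * (möbius X y * fromℕ k ^ dim (space y)))
      ≡⟨ ∑-cong (allFin _) (λ y → trans (cong (λ q → [ X ≤ₗ? space y ]? * (möbius X y * q)) (sym (∑-∈ₛ m (space y) (space-positive y))))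
           (trans (sym (*-assoc [ X ≤ₗ? space y ]? (möbius X y) _)) (sym (∑-*ˡ ([ X ≤ₗ? space y ]? * möbius X y) (cube n) _)))) ⟩
    ∑ (allFin _) (λ y → ∑ (cube n) (λ t → [ X ≤ₗ? space y ]? * möbius X y * [ t ∈ₛ? space y ]?))
      ≡⟨ ∑-swap (allFin (length (L n))) (cube n) _ ⟩
    ∑ (cube n) (λ t → ∑ (allFin _) (λ y → [ X ≤ₗ? space y ]? * möbius X y * [ t ∈ₛ? space y ]?))
      ≡⟨ ∑-cong (cube n) (λ t → trans (∑-cong (allFin _) (rearrange t)) (trans (∑-möbius X (proj₁ (flatAt t))) (recognise t))) ⟩
    ∑ (cube n) (λ t → [ stabilises? K t ]?) ∎
    where
    open ≡-Reasoning
    open Cube m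
    X : Subspace n
    X = Fix K
    rearrange : ∀ t y → [ X ≤ₗ? space y ]? * möbius X y * [ t ∈ₛ? space y ]? ≡
      [ (X ≤ₗ? space y) ×-dec (space y ≤ₗ? space (proj₁ (flatAt t))) ]? * möbius X y
    rearrange t y = trans (solve 3 (λ p q r → p :* q :* r := p :* r :* q) refl [ X ≤ₗ? space y ]? (möbius X y) [ t ∈ₛ? space y ]?)
      (cong (_* möbius X y) (trans (cong ([ X ≤ₗ? space y ]? *_) ([]?-cong (t ∈ₛ? space y) (space y ≤ₗ? space (proj₁ (flatAt t)))
          (⇒ (≤ₗ-flatAt t y)) (⇐ (≤ₗ-flatAt t y))))
        (sym ([]?-× (X ≤ₗ? space y) (space y ≤ₗ? space (proj₁ (flatAt t)))))))
    recognise : ∀ t → [ X ≐? space (proj₁ (flatAt t)) ]? ≡ [ stabilises? K t ]?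
    recognise t = let y , y≐ = flatAt t in []?-cong (X ≐? space y) (stabilises? K t)
      (λ eq → ⇒ (Fix-≐ K t) (≐-trans {X} {space y} {rootsAt t} eq y≐))
      (λ stab → ≐-trans {X} {rootsAt t} {space y} (⇐ (Fix-≐ K t) stab) (≐-sym {space y} {rootsAt t} y≐))

-- Counting points by their stabilisers

simple-injective : (i j : Fin n) → simple i ≡ simple j → i ≡ j
simple-injective {suc zero}    zero    zero    eq = refl
simple-injective {suc (suc n)} zero    zero    eq = refl
simple-injective {suc (suc n)} zero    (suc j) eq = contradiction (cong head₀ eq) λ ()
simple-injective {suc (suc n)} (suc i) zero    eq = contradiction (cong head₀ eq) λ ()
simple-injective {suc (suc n)} (suc i) (suc j) eq = cong suc (simple-injective i j (Vecₚ.∷-injectiveʳ eq))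

∣∣+free : (K : Subset n) → ∣ K ∣ ℕ.+ free K ≡ n
∣∣+free []            = refl
∣∣+free (inside ∷ K)  = cong suc (∣∣+free K)
∣∣+free (outside ∷ K) = trans (ℕₚ.+-suc ∣ K ∣ (free K)) (cong suc (∣∣+free K))

∣∣-∑ : (K : Subset n) → fromℕ ∣ K ∣ ≡ ∑ (allFin n) (λ i → [ i Subsetₚ.∈? K ]?)
∣∣-∑ []      = refl
∣∣-∑ {suc n} (b ∷ K) = trans (head-term b) (sym (trans (∑-allFin-suc (λ i → [ i Subsetₚ.∈? (b ∷ K) ]?))
  (cong ([ zero Subsetₚ.∈? (b ∷ K) ]? +_) (∑-cong (allFin n) λ i →
    []?-cong (suc i Subsetₚ.∈? (b ∷ K)) (i Subsetₚ.∈? K) (λ { (Vec.there i∈) → i∈ }) Vec.there))))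
  where
  head-term : ∀ b → fromℕ ∣ b ∷ K ∣ ≡ [ zero Subsetₚ.∈? (b ∷ K) ]? + ∑ (allFin n) (λ i → [ i Subsetₚ.∈? K ]?)
  head-term inside  = trans (fromℕ-+ 1 ∣ K ∣) (cong (1ℚ +_) (∣∣-∑ K))
  head-term outside = trans (∣∣-∑ K) (sym (+-identityˡ _))

∼-∣∣ : {K L : Subset n} → K ∼ L → ∣ K ∣ ≡ ∣ L ∣
∼-∣∣ {n} {K} {L} (w , to , from) = fromℕ-injective (trans (members K) (trans (∑-match
    (Uniqueₚ.filter⁺ (Subsetₚ._∈? K) (Uniqueₚ.allFin⁺ n)) (Uniqueₚ.filter⁺ (Subsetₚ._∈? L) (Uniqueₚ.allFin⁺ n))
    (λ i j → act w (simple i) ≟ᵥ simple j)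
    (λ i∈ → let j , j∈ , eq = to _ (proj₂ (∈-filter⁻ (Subsetₚ._∈? K) {xs = allFin n} i∈)) in j , ∈-filter⁺ (Subsetₚ._∈? L) (∈-allFin j) j∈ , eq)
    (λ _ _ _ p q → simple-injective _ _ (trans (sym p) q))
    (λ j∈ → let i , i∈ , eq = from _ (proj₂ (∈-filter⁻ (Subsetₚ._∈? L) {xs = allFin n} j∈)) in i , ∈-filter⁺ (Subsetₚ._∈? K) (∈-allFin i) i∈ , eq)
    (λ _ _ _ p q → simple-injective _ _ (act-injective w (trans p (sym q))))
    (λ _ _ _ → refl)) (sym (members L))))
  where
  members : (K : Subset n) → fromℕ ∣ K ∣ ≡ ∑ (filter (Subsetₚ._∈? K) (allFin n)) (λ _ → 1ℚ)
  members K = trans (∣∣-∑ K) (trans (∑-cong (allFin n) λ i → sym (*-identityʳ [ i Subsetₚ.∈? K ]?))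
    (sym (∑-filter (Subsetₚ._∈? K) (allFin n) (λ _ → 1ℚ))))

∼-free : {K L : Subset n} → K ∼ L → free K ≡ free L
∼-free {n} {K} {L} K∼L = ℕₚ.+-cancelˡ-≡ ∣ K ∣ (free K) (free L)
  (trans (∣∣+free K) (trans (sym (∣∣+free L)) (cong (ℕ._+ free L) (sym (∼-∣∣ K∼L)))))

module _ {w u v : W n} (eq : v ∙ w ≡ w ∙ u) where
  fixed-conjugate : ∀ d → act u (act (w ⁻¹) d) ≡ act (w ⁻¹) d ⇔ act v d ≡ d
  fixed-conjugate d = mk⇔
    (λ p → trans (sym moved) (trans (cong (act w) p) (act-⁻¹ʳ w d)))
    (λ p → act-injective w (trans moved (trans p (sym (act-⁻¹ʳ w d)))))
    where
    moved : act w (act u (act (w ⁻¹) d)) ≡ act v d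
    moved = trans (sym (intertwine {w = w} {u} {v} eq (act (w ⁻¹) d))) (cong (act v) (act-⁻¹ʳ w d))

-- The stabiliser of d is the parabolic subgroup of L, and the stabiliser of w⁻¹d is its conjugate
-- by w⁻¹.
conjugates⇔stabilises : {K L : Subset n} {d : V n} → OnFace L d → (w : W n) →
                        Conjugates K L w ⇔ Stabilises K (act (w ⁻¹) d)
conjugates⇔stabilises {n} {K} {L} {d} face w = mk⇔ to from
  where
  stab : ∀ v → act v d ≡ d ⇔ v ∈W⟨ L ⟩
  stab = stabiliser (onFace-dominant face) (onFace-zeros face)
  to : Conjugates K L w → Stabilises K (act (w ⁻¹) d)
  to conj u = (λ p → proj₂ uv (⇒ (stab v) (⇒ moves p))) ,
              (λ u∈ → ⇐ moves (⇐ (stab v) (proj₁ uv u∈)))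
    where
    v : W n
    v = w ∙ u ∙ w ⁻¹
    uv = conj u v (∙⁻¹∙ʳ (w ∙ u) w)
    moves = fixed-conjugate {w = w} {u} {v} (∙⁻¹∙ʳ (w ∙ u) w) d
  from : Stabilises K (act (w ⁻¹) d) → Conjugates K L w
  from stabilises u v eq = (λ u∈ → ⇒ (stab v) (⇒ moves (proj₂ (stabilises u) u∈))) ,
                           (λ v∈ → proj₁ (stabilises u) (⇐ moves (⇐ (stab v) v∈)))
    where
    moves = fixed-conjugate {w = w} {u} {v} eq d

⁻¹∙∙ : (w x : W n) → w ⁻¹ ∙ (w ∙ x) ≡ x
⁻¹∙∙ w x = trans (sym (∙-assoc (w ⁻¹) w x)) (trans (cong (_∙ x) (∙-inverseˡ w)) (∙-identityˡ x))

∙⁻¹∙ : (w x : W n) → w ∙ (w ⁻¹ ∙ x) ≡ x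
∙⁻¹∙ w x = trans (sym (∙-assoc w (w ⁻¹) x)) (trans (cong (_∙ x) (∙-inverseʳ w)) (∙-identityˡ x))

conjugates-∙ : {J K L : Subset n} {w x : W n} → Conjugates K L w → Conjugates J K x → Conjugates J L (w ∙ x)
conjugates-∙ {n} {w = w} {x} conj conj′ u v eq =
  (λ u∈ → proj₁ (conj y v vw) (proj₁ (conj′ u y (∙⁻¹∙ʳ (x ∙ u) x)) u∈)) ,
  (λ v∈ → proj₂ (conj′ u y (∙⁻¹∙ʳ (x ∙ u) x)) (proj₂ (conj y v vw) v∈))
  where
  open ≡-Reasoning
  y : W n
  y = x ∙ u ∙ x ⁻¹
  vw : v ∙ w ≡ w ∙ y
  vw = begin
    v ∙ w  ≡⟨ sym (∙⁻¹∙ʳ (v ∙ w) (x ⁻¹)) ⟩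
    v ∙ w ∙ x ⁻¹ ⁻¹ ∙ x ⁻¹  ≡⟨ cong (λ z → v ∙ w ∙ z ∙ x ⁻¹) (⁻¹-involutive x) ⟩
    v ∙ w ∙ x ∙ x ⁻¹  ≡⟨ cong (_∙ x ⁻¹) (trans (∙-assoc v w x) (trans eq (∙-assoc w x u))) ⟩
    w ∙ (x ∙ u) ∙ x ⁻¹  ≡⟨ ∙-assoc w (x ∙ u) (x ⁻¹) ⟩
    w ∙ y  ∎

conjugates-⁻¹ : {K L : Subset n} {w : W n} → Conjugates K L w → Conjugates L K (w ⁻¹)
conjugates-⁻¹ {w = w} conj u v eq = proj₂ (conj v u uw) , proj₁ (conj v u uw)
  where
  open ≡-Reasoning
  uw : u ∙ w ≡ w ∙ v
  uw = begin
    u ∙ w  ≡⟨ cong (_∙ w) (sym (∙⁻¹∙ w u)) ⟩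
    w ∙ (w ⁻¹ ∙ u) ∙ w  ≡⟨ cong (λ x → w ∙ x ∙ w) (sym eq) ⟩
    w ∙ (v ∙ w ⁻¹) ∙ w  ≡⟨ ∙-assoc w (v ∙ w ⁻¹) w ⟩
    w ∙ (v ∙ w ⁻¹ ∙ w)  ≡⟨ cong (w ∙_) (∙⁻¹∙ʳ v w) ⟩
    w ∙ v  ∎

∑-coset : {P Q : Pred (W n) 0ℓ} (P? : Decidable P) (Q? : Decidable Q) (w : W n) →
  (∀ x → P x → Q (w ∙ x)) → (∀ x → Q x → P (w ⁻¹ ∙ x)) →
  fromℕ (length (filter P? (elements n))) ≡ ∑ (elements n) (λ x → [ Q? x ]?)
∑-coset {n} P? Q? w to from = begin
  fromℕ (length (filter P? (elements n)))  ≡⟨ fromℕ-length (filter P? (elements n)) ⟩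
  ∑ (filter P? (elements n)) (λ _ → 1ℚ)
    ≡⟨ ∑-reindex _≟w_ (w ∙_) (w ⁻¹ ∙_) (λ _ → 1ℚ) (Uniqueₚ.filter⁺ P? (unique-elements n)) (Uniqueₚ.filter⁺ Q? (unique-elements n))
         (λ {x} x∈ → ∈-filter⁺ Q? (∈-elements (w ∙ x)) (to x (proj₂ (∈-filter⁻ P? {xs = elements n} x∈))) , ⁻¹∙∙ w x)
         (λ {x} x∈ → ∈-filter⁺ P? (∈-elements (w ⁻¹ ∙ x)) (from x (proj₂ (∈-filter⁻ Q? {xs = elements n} x∈))) , ∙⁻¹∙ w x) ⟩
  ∑ (filter Q? (elements n)) (λ _ → 1ℚ)  ≡⟨ ∑-filter Q? (elements n) (λ _ → 1ℚ) ⟩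
  ∑ (elements n) (λ x → [ Q? x ]? * 1ℚ)  ≡⟨ ∑-cong (elements n) (λ x → *-identityʳ [ Q? x ]?) ⟩
  ∑ (elements n) (λ x → [ Q? x ]?)  ∎
  where open ≡-Reasoning

-- If some w conjugates one subgroup to the other, the elements which do so form the coset of the
-- normaliser of the first subgroup through w; such a w exists exactly if K ∼ L.
∑-conjugates : (K L : Subset n) →
  ∑ (elements n) (λ w → [ conjugates? K L w ]?) ≡ [ K ∼? L ]? * fromℕ (length (normaliser K))
∑-conjugates {n} K L = go (K ∼? L)
  where
  go : (d : Dec (K ∼ L)) → ∑ (elements n) (λ w → [ conjugates? K L w ]?) ≡ [ d ]? * fromℕ (length (normaliser K))
  go (yes (w , sends)) = trans (sym (∑-coset (normalises? K) (conjugates? K L) w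
    (λ x → conjugates-∙ {w = w} {x} conj) (λ x → conjugates-∙ {w = w ⁻¹} {x} (conjugates-⁻¹ {w = w} conj)))) (sym (*-identityˡ (fromℕ (length (normaliser K)))))
    where
    conj : Conjugates K L w
    conj = sendsTo⇒conjugates {w = w} sends
  go (no K≁L) = trans (∑-zero (elements n) _ λ {w} _ → []?-no (conjugates? K L w) (K≁L ∘ conjugates⇒∼ {w = w})) (sym (*-zeroˡ (fromℕ (length (normaliser K)))))

dominant? : Decidable (Dominant {n})
dominant? t = Finₚ.all? λ i → 0ℚ ℚₚ.≤? ⟨ simple i , t ⟩

∑-faces : (d : V n) → ∑ (subsets n) (λ L → [ onFace? L d ]?) ≡ [ dominant? d ]?
∑-faces {n} d = go (dominant? d)
  where
  go : (p? : Dec (Dominant d)) → ∑ (subsets n) (λ L → [ onFace? L d ]?) ≡ [ p? ]?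
  go (yes dom) = ∑-indicator₁ (λ L → onFace? L d) unique-subsets (∈-subsets (zeros d)) (dominant-onFace dom) (λ _ → onFace-unique)
  go (no ¬dom) = ∑-zero (subsets n) _ λ {L} _ → []?-no (onFace? L d) (¬dom ∘ onFace-dominant)

-- All elements making t dominant take it to the same point, so they form a left coset of the
-- stabiliser of t.
∑-dominant : {K : Subset n} {t : V n} → Stabilises K t →
  ∑ (elements n) (λ w → [ dominant? (act w t) ]?) ≡ fromℕ (length (parabolic K))
∑-dominant {n} {K} {t} stab = from-lex (lexDominant-exists t)
  where
  from-lex : (∃ λ w → LexDominant w t) → ∑ (elements n) (λ w → [ dominant? (act w t) ]?) ≡ fromℕ (length (parabolic K))
  from-lex (w , lex) = sym (∑-coset _∈W⟨ K ⟩? (λ x → dominant? (act x t)) w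
    (λ x x∈ → subst Dominant (sym (trans (act-∙ w x t) (cong (act w) (proj₂ (stab x) x∈)))) dom)
    (λ x domₓ → proj₁ (stab (w ⁻¹ ∙ x)) (trans (act-∙ (w ⁻¹) x t) (trans (cong (act (w ⁻¹)) (same x domₓ)) (act-⁻¹ˡ w t)))))
    where
    dom : Dominant (act w t)
    dom = lex-dominant {w = w} {t} lex
    same : ∀ x → Dominant (act x t) → act x t ≡ act w t
    same x domₓ = trans (sym moved) (dominant-unique {x = x ∙ w ⁻¹} dom (subst Dominant (sym moved) domₓ))
      where
      moved : act (x ∙ w ⁻¹) (act w t) ≡ act x t
      moved = trans (act-∙ x (w ⁻¹) (act w t)) (cong (act x) (act-⁻¹ˡ w t))

module _ (m : ℕ) where
  open Cube m

  -- Both sides count the pairs (t , w) with Stab t = W_K and w t dominant.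
  ∑-stabilises : (K : Subset n) → fromℕ (length (parabolic K)) * ∑ (cube n) (λ t → [ stabilises? K t ]?) ≡
    fromℕ (length (normaliser K)) * fromℕ (length (λ-class K)) * faceSize (free K)
  ∑-stabilises {n} K = begin
    P * ∑ (cube n) T
      ≡⟨ trans (sym (∑-*ˡ P (cube n) T)) (∑-cong (cube n) λ t → trans (*-comm P (T t))
           (trans ([]?-*-cong (stabilises? K t) (sym ∘ ∑-dominant)) (sym (∑-*ˡ (T t) (elements n) _)))) ⟩
    ∑ (cube n) (λ t → ∑ (elements n) (λ w → T t * D (act w t)))
      ≡⟨ ∑-swap (cube n) (elements n) _ ⟩
    ∑ (elements n) (λ w → ∑ (cube n) (λ t → T t * D (act w t)))
      -- Substitute t = w⁻¹d. Dominance becomes a condition on d alone, and for d on the face of L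
      -- the stabiliser condition becomes one on w alone, so the sum separates.
      ≡⟨ ∑-cong (elements n) (λ w → trans (∑-cong (cube n) λ t → cong (λ s → T s * D (act w t)) (sym (act-⁻¹ˡ w t)))
           (∑-act w (λ d → T (act (w ⁻¹) d) * D d))) ⟩
    ∑ (elements n) (λ w → ∑ (cube n) (λ d → T (act (w ⁻¹) d) * D d))
      ≡⟨ ∑-cong (elements n) (λ w → trans (∑-cong (cube n) (expand w)) (∑-swap (cube n) (subsets n) _)) ⟩
    ∑ (elements n) (λ w → ∑ (subsets n) (λ L → ∑ (cube n) (λ d → [ conjugates? K L w ]? * [ onFace? L d ]?)))
      ≡⟨ ∑-swap (elements n) (subsets n) _ ⟩
    ∑ (subsets n) (λ L → ∑ (elements n) (λ w → ∑ (cube n) (λ d → [ conjugates? K L w ]? * [ onFace? L d ]?)))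
      ≡⟨ ∑-cong (subsets n) (λ L → trans (∑-cong (elements n) λ w → trans (∑-*ˡ [ conjugates? K L w ]? (cube n) _)
             (cong ([ conjugates? K L w ]? *_) (∑-onFace L)))
           (trans (∑-*ʳ (faceSize (free L)) (elements n) _) (cong (_* faceSize (free L)) (∑-conjugates K L)))) ⟩
    ∑ (subsets n) (λ L → [ K ∼? L ]? * N * faceSize (free L))
      ≡⟨ ∑-cong (subsets n) (λ L → trans (*-assoc [ K ∼? L ]? N _)
           ([]?-*-cong (K ∼? L) λ K∼L → cong (λ p → N * faceSize p) (sym (∼-free {K = K} {L} K∼L)))) ⟩
    ∑ (subsets n) (λ L → [ K ∼? L ]? * (N * faceSize (free K)))
      ≡⟨ ∑-*ʳ (N * faceSize (free K)) (subsets n) _ ⟩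
    ∑ (subsets n) (λ L → [ K ∼? L ]?) * (N * faceSize (free K))
      ≡⟨ cong (_* (N * faceSize (free K))) (sym (count-∑ (K ∼?_) (subsets n))) ⟩
    fromℕ (length (λ-class K)) * (N * faceSize (free K))
      ≡⟨ solve 3 (λ l m f → l :* (m :* f) := m :* l :* f) refl (fromℕ (length (λ-class K))) N (faceSize (free K)) ⟩
    N * fromℕ (length (λ-class K)) * faceSize (free K) ∎
    where
    open ≡-Reasoning
    P N : ℚ
    P = fromℕ (length (parabolic K))
    N = fromℕ (length (normaliser K))
    T D : V n → ℚ
    T t = [ stabilises? K t ]?
    D t = [ dominant? t ]?
    expand : ∀ w d → T (act (w ⁻¹) d) * D d ≡ ∑ (subsets n) (λ L → [ conjugates? K L w ]? * [ onFace? L d ]?)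
    expand w d = trans (cong (T (act (w ⁻¹) d) *_) (sym (∑-faces d))) (trans (sym (∑-*ˡ (T (act (w ⁻¹) d)) (subsets n) _))
      (∑-cong (subsets n) λ L → trans (*-comm (T (act (w ⁻¹) d)) _) (trans ([]?-*-cong (onFace? L d) λ face →
        []?-cong (stabilises? K (act (w ⁻¹) d)) (conjugates? K L w)
          (⇐ (conjugates⇔stabilises face w)) (⇒ (conjugates⇔stabilises face w)))
        (*-comm [ onFace? L d ]? _))))

÷₀-unique : ∀ {p q x} → q ≢ 0ℚ → q * x ≡ p → p ÷₀ q ≡ x
÷₀-unique {p} {q} {x} q≢0 eq = [ (λ q≡0 → contradiction q≡0 q≢0) , p-q≡0⇒p≡q (p ÷₀ q) x ]′ (*-zero q (p ÷₀ q - x)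
  (trans (solve 3 (λ q a b → q :* (a :- b) := q :* a :- q :* b) refl q (p ÷₀ q) x)
    (trans (cong₂ _-_ (÷₀-* p q q≢0) eq) (+-inverseʳ p))))

*-≢0 : ∀ {p q} → p ≢ 0ℚ → q ≢ 0ℚ → p * q ≢ 0ℚ
*-≢0 {p} {q} p≢0 q≢0 eq = [ p≢0 , q≢0 ]′ (*-zero p q eq)

fromℕ-suc≢0 : ∀ m → fromℕ (suc m) ≢ 0ℚ
fromℕ-suc≢0 m eq = <⇒≢ (fromℕ-mono-< {0} {suc m} (ℕ.s≤s ℕ.z≤n)) (sym eq)

^-≢0 : ∀ {x} → x ≢ 0ℚ → ∀ n → x ^ n ≢ 0ℚ
^-≢0 x≢0 zero    = λ ()
^-≢0 x≢0 (suc n) = *-≢0 x≢0 (^-≢0 x≢0 n)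

class≢0 : (K : Subset n) → fromℕ (length (λ-class K)) ≢ 0ℚ
class≢0 K = fromℕ-length≢0 (∈-filter⁺ (K ∼?_) (∈-subsets K) (∼-refl K))

H-∑ : (m : ℕ) (w : W n) → let open Cube m in H (fromℕ k) w ≡
  (1ℚ ÷₀ fromℕ k ^ n) * (∑[ K ∈ subsets n ] [ K ⊆? ∁ (Des w) ]? * faceSize (free K))
H-∑ {n} m w = trans (∑-filter (_⊆? ∁ (Des w)) (subsets n) _) (trans (∑-cong (subsets n) (λ K → trans
    (cong ([ K ⊆? ∁ (Des w) ]? *_) (term K))
    (solve 3 (λ b c f → b :* (c :* f) := c :* (b :* f)) refl [ K ⊆? ∁ (Des w) ]? (1ℚ ÷₀ fromℕ k ^ n) (faceSize (free K)))))
  (∑-*ˡ (1ℚ ÷₀ fromℕ k ^ n) (subsets n) _))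
  where
  open Cube m
  open ≡-Reasoning
  kⁿ≢0 : fromℕ k ^ n ≢ 0ℚ
  kⁿ≢0 = ^-≢0 (fromℕ-suc≢0 (m ℕ.+ m)) n
  term : ∀ K → (fromℕ (length (parabolic K)) * Lattice.χ n (Fix K) (fromℕ k)) ÷₀
    (fromℕ k ^ n * fromℕ (length (normaliser K)) * fromℕ (length (λ-class K))) ≡ (1ℚ ÷₀ fromℕ k ^ n) * faceSize (free K)
  term K = ÷₀-unique (*-≢0 (*-≢0 kⁿ≢0 N≢0) (class≢0 K)) (begin
    fromℕ k ^ n * N * C * ((1ℚ ÷₀ fromℕ k ^ n) * faceSize (free K))
      ≡⟨ solve 5 (λ x a b y f → x :* a :* b :* (y :* f) := (x :* y) :* (a :* b :* f)) refl (fromℕ k ^ n) N C (1ℚ ÷₀ fromℕ k ^ n) (faceSize (free K)) ⟩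
    (fromℕ k ^ n * (1ℚ ÷₀ fromℕ k ^ n)) * (N * C * faceSize (free K))
      ≡⟨ cong (_* (N * C * faceSize (free K))) (÷₀-* 1ℚ (fromℕ k ^ n) kⁿ≢0) ⟩
    1ℚ * (N * C * faceSize (free K)) ≡⟨ *-identityˡ _ ⟩
    N * C * faceSize (free K)  ≡⟨ sym (∑-stabilises m K) ⟩
    P * ∑ (cube n) (λ t → [ stabilises? K t ]?) ≡⟨ cong (P *_) (sym (χ-Fix n m K)) ⟩
    P * Lattice.χ n (Fix K) (fromℕ k) ∎)
    where
    P N C : ℚ
    P = fromℕ (length (parabolic K))
    N = fromℕ (length (normaliser K))
    C = fromℕ (length (λ-class K))
    N≢0 : N ≢ 0ℚ
    N≢0 = fromℕ-length≢0 (∈-filter⁺ (normalises? K) (∈-elements ε) λ u v eq →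
      let u≡v = trans (sym (∙-identityˡ u)) (trans (sym eq) (∙-identityʳ v)) in
      subst (_∈W⟨ K ⟩) u≡v , subst (_∈W⟨ K ⟩) (sym u≡v))

-- Elements which map K into Π

module _ {w : W n} {t : V n} (dom : Dominant (act w t)) {α : V n} (α∈ : Root α) where

  -- When w t is dominant, the sign of a root at t decides whether w makes the root negative, except
  -- for roots which vanish at t. Hence the strict inequality here and the weak one in the converse.
  side⇒inversion : ⟨ α , t ⟩ < 0ℚ → ⟨ act w α , η ⟩ < 0ℚ
  side⇒inversion α<0 with root-sign (root-act w α∈)
  ... | inj₁ wα⁺ = contradiction α<0 (≤⇒≯ (subst (0ℚ ≤_) (act-⟨⟩ w α t) (positive-dominant dom wα⁺)))
  ... | inj₂ wα⁻ = neg⇒<0 (subst (0ℚ <_) (⟨neg⟩ˡ (act w α) η) (0<positive-η wα⁻))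

  inversion⇒side : ⟨ act w α , η ⟩ < 0ℚ → ⟨ α , t ⟩ ≤ 0ℚ
  inversion⇒side wα<0 = subst₂ _≤_ (neg-involutive ⟨ α , t ⟩) refl (neg-antimono-≤
    (subst (0ℚ ≤_) (trans (⟨neg⟩ˡ (act w α) (act w t)) (cong -_ (act-⟨⟩ w α t)))
      (positive-dominant dom (⟨,η⟩<0⇒negative (root-act w α∈) wα<0))))

blowUp-row : (K : Subset n) (i : Fin n) → SignedRow (λ z → lookup (blowUp K z) i)
blowUp-row (inside ∷ K)  zero    = head-row K
  where
  head-row : ∀ {n} (K : Subset n) → SignedRow (λ z → head₀ (blowUp K z))
  head-row []            = inj₁ λ _ → refl
  head-row (inside ∷ K)  = head-row K
  head-row (outside ∷ K) = inj₂ ((Sign.+ , zero) , λ { (x ∷ z) → refl })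
blowUp-row (inside ∷ K)  (suc i) = blowUp-row K i
blowUp-row (outside ∷ K) zero    = inj₂ ((Sign.+ , zero) , λ { (x ∷ z) → refl })
blowUp-row (outside ∷ K) (suc i) with blowUp-row K i
... | inj₁ eq             = inj₁ λ { (x ∷ z) → eq z }
... | inj₂ ((s , b) , eq) = inj₂ ((s , suc b) , λ { (x ∷ z) → eq z })

lookup-blowUp : (K : Subset n) (z : V (free K)) (b : Fin (free K)) → lookup (blowUp K z) (embed K b) ≡ lookup z b
lookup-blowUp (inside ∷ K)  z       b       = lookup-blowUp K z b
lookup-blowUp (outside ∷ K) (x ∷ z) zero    = refl
lookup-blowUp (outside ∷ K) (x ∷ z) (suc b) = lookup-blowUp K z b

Restriction : Subset n → V n → Set
Restriction K α = (∀ z → ⟨ α , blowUp K z ⟩ ≡ 0ℚ) ⊎ Multiple (λ z → ⟨ α , blowUp K z ⟩)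

restrict-root : (K : Subset n) {α : V n} → Root α → Restriction K α
restrict-root K ((s , i) , (t , j) , _ , refl) =
  row-difference (signedRow-signed s (blowUp-row K i)) (signedRow-signed t (blowUp-row K j))
    (λ z → ⟨se-se,⟩ (s , i) (t , j) (blowUp K z))

-- Reading the two indices in the free coordinates of the face lifts a root of the smaller system
-- with factor 1.
extend-root : (K : Subset n) {ᾱ : V (free K)} → Root ᾱ → ∃ λ α → Root α × ∀ z → ⟨ α , blowUp K z ⟩ ≡ ⟨ ᾱ , z ⟩
extend-root K ((s , b) , (t , c) , b≢c , refl) = se (s , embed K b) -ᵥ se (t , embed K c) ,
  ((s , embed K b) , (t , embed K c) , (λ eq → b≢c (cong₂ _,_ (cong proj₁ eq) (embed-injective K b c (cong proj₂ eq)))) , refl) ,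
  λ z → trans (⟨se-se,⟩ (s , embed K b) (t , embed K c) (blowUp K z)) (trans
    (cong₂ (λ p q → signed s p - signed t q) (lookup-blowUp K z b) (lookup-blowUp K z c)) (sym (⟨se-se,⟩ (s , b) (t , c) z)))
  where
  embed-injective : ∀ {n} (K : Subset n) b c → embed K b ≡ embed K c → b ≡ c
  embed-injective (inside ∷ K)  b       c       eq = embed-injective K b c (Finₚ.suc-injective eq)
  embed-injective (outside ∷ K) zero    zero    eq = refl
  embed-injective (outside ∷ K) (suc b) (suc c) eq = cong suc (embed-injective K b c (Finₚ.suc-injective eq))

-- All positive roots are nonnegative at `generic K`, so a sum vanishes there only if both summands
-- do. Such a root is thus built from simple roots in K, which w keeps simple.
intoΠ-positive : {K : Subset n} {w : W n} → IntoΠ K w → {α : V n} → Positive α →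
                 ⟨ α , generic K ⟩ ≡ 0ℚ → 0ℚ < ⟨ act w α , η ⟩
intoΠ-positive {n} {K} {w} into = positive-induction (λ α → ⟨ α , generic K ⟩ ≡ 0ℚ → 0ℚ < ⟨ act w α , η ⟩)
  (λ i on → let j , eq = into i (⇐ (generic-zeros K i) on) in
    subst (0ℚ <_) (sym (trans (cong ⟨_, η ⟩ eq) (simple-η j))) 0<2)
  λ {α} {γ} α⁺ γ⁺ p q on →
    let p0 , q0 = sum-zero (positive-dominant (generic-dominant K) α⁺) (positive-dominant (generic-dominant K) γ⁺)
                    (trans (sym (⟨+⟩ˡ α γ (generic K))) on)
    in subst (0ℚ <_) (sym (trans (cong ⟨_, η ⟩ (act-+ w α γ)) (⟨+⟩ˡ (act w α) (act w γ) η))) (ℚₚ.+-mono-< (p p0) (q q0))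

-- A bijection between {w ∈ Wₙ : w K ⊆ Π} and W_p, p = free K: u corresponds to w
-- if w takes the chamber u⁻¹(dominant) of the face of K into the dominant chamber.
module Collapse {n : ℕ} (K : Subset n) where

  p : ℕ
  p = free K

  -- A point of the span of the face inside the chamber of `u`. As `η` is regular, the roots
  -- vanishing at it are those which vanish on the whole span.
  point : W p → V n
  point u = blowUp K (act (u ⁻¹) η)

  Matches : W n → W p → Set
  Matches w u = Dominant (act w (point u))

  matches? : ∀ w u → Dec (Matches w u)
  matches? w u = dominant? (act w (point u))

  -- Pulling back the generic point of the image of K by w gives a point of the span of the face,
  -- with coordinates z. The required u is the element which is lexicographically dominant for z.
  match-exists : (w : W n) → IntoΠ K w → ∃ λ u → Matches w u
  match-exists w into = from-z (blowUp-surjective K t t-vanishes)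
    where
    hit? : ∀ j → Dec (∃ λ i → i Subset.∈ K × act w (simple i) ≡ simple j)
    hit? j = Finₚ.any? λ i → (i Subsetₚ.∈? K) ×-dec (act w (simple i) ≟ᵥ simple j)
    image : Subset n
    image = tabulate (does ∘ hit?)
    image⁺ : ∀ {j} → (∃ λ i → i Subset.∈ K × act w (simple i) ≡ simple j) → j Subset.∈ image
    image⁺ {j} hit = Vecₚ.lookup⇒[]= j image (trans (Vecₚ.lookup∘tabulate _ j) (Dec.dec-true (hit? j) hit))
    image⁻ : ∀ {j} → j Subset.∈ image → ∃ λ i → i Subset.∈ K × act w (simple i) ≡ simple j
    image⁻ {j} j∈ with hit? j | trans (sym (Vecₚ.lookup∘tabulate (does ∘ hit?) j)) (Vecₚ.[]=⇒lookup j∈)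
    ... | yes hit | _ = hit
    ... | no _    | ()
    t : V n
    t = act (w ⁻¹) (generic image)
    t-vanishes : Vanishes K t
    t-vanishes i i∈ = let j , eq = into i i∈ in
      trans (sym (act-adjoint w (simple i) (generic image))) (trans (cong ⟨_, generic image ⟩ eq)
        (blowUp-vanishes image η j (image⁺ (i , i∈ , eq))))
    from-z : (∃ λ z → blowUp K z ≡ t) → ∃ λ u → Matches w u
    from-z (z , φz) = from-lex (lexDominant-exists z)
      where
      from-lex : (∃ λ u → LexDominant u z) → ∃ λ u → Matches w u
      from-lex (u , lex) = u , dom
        where
        dom : Matches w u
        dom j = subst (0ℚ ≤_) (act-adjoint′ w (simple j) (point u)) (case (j Subsetₚ.∈? image) (restrict-root K (root-act (w ⁻¹) (root-simple j))))
          where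
          δ : V n
          δ = act (w ⁻¹) (simple j)
          at-z : ⟨ δ , blowUp K z ⟩ ≡ ⟨ simple j , generic image ⟩
          at-z = trans (cong ⟨ δ ,_⟩ φz) (act-⟨⟩ (w ⁻¹) (simple j) (generic image))
          -- If j is in the image, δ lies in K and vanishes on the span. Otherwise δ is positive at
          -- z, so its restriction is not made negative by u.
          case : Dec (j Subset.∈ image) → Restriction K δ → 0ℚ ≤ ⟨ δ , point u ⟩
          case (yes j∈) _ = let i , i∈ , eq = image⁻ j∈ in ≤-reflexive (sym (trans
            (cong (λ α → ⟨ α , point u ⟩) (trans (cong (act (w ⁻¹)) (sym eq)) (act-⁻¹ˡ w (simple i))))
            (blowUp-vanishes K (act (u ⁻¹) η) i i∈)))
          case (no j∉) (inj₁ flat) = ≤-reflexive (sym (flat (act (u ⁻¹) η)))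
          case (no j∉) (inj₂ (δ̄ , c , δ̄∈ , 0<c , eq)) = subst (0ℚ ≤_) (sym (eq (act (u ⁻¹) η))) (*-nonneg (<⇒≤ 0<c)
            (subst (0ℚ ≤_) (act-adjoint u δ̄ η) (≮⇒≥ λ neg →
              ≤⇒≯ (inversion⇒side {w = u} {z} (lex-dominant {w = u} {z} lex) δ̄∈ neg)
                (*-cancel-pos 0<c (subst (0ℚ <_) (trans (sym at-z) (eq z)) (generic-positive image j j∉))))))

  -- A root inverted by u lifts to a root negative at `point u`; w makes the lift negative, so it is
  -- at most 0 at `point u′`, and not 0 by regularity.
  match-unique : {w : W n} {u u′ : W p} → Matches w u → Matches w u′ → u ≡ u′
  match-unique {w} {u} {u′} dom dom′ = inversions-determine (carry {u} {u′} dom dom′) (carry {u′} {u} dom′ dom)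
    where
    carry : {u u′ : W p} → Matches w u → Matches w u′ → {α : V p} → Positive α →
            ⟨ act u α , η ⟩ < 0ℚ → ⟨ act u′ α , η ⟩ < 0ℚ
    carry {u} {u′} dom dom′ {ᾱ} ᾱ⁺ neg = let α , α∈ , eq = extend-root K (positive-root ᾱ⁺) in
      subst (_< 0ℚ) (sym (act-adjoint u′ ᾱ η)) (≤∧≢⇒< (subst (_≤ 0ℚ) (eq (act (u′ ⁻¹) η))
          (inversion⇒side {w = w} {point u′} dom′ α∈ (side⇒inversion {w = w} {point u} dom α∈
            (subst (_< 0ℚ) (trans (act-adjoint u ᾱ η) (sym (eq (act (u ⁻¹) η)))) neg))))
        (root-η≢0 u′ (positive-root ᾱ⁺)))

  match-exists′ : (u : W p) → ∃ λ w → IntoΠ K w × Matches w u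
  match-exists′ u = let w , lex = lexDominant-exists (point u) in
    w , (λ i i∈ → lex-simple {w = w} {point u} lex i (blowUp-vanishes K (act (u ⁻¹) η) i i∈)) , lex-dominant {w = w} {point u} lex

  -- A root inverted by w is at most 0 at `point u`. It cannot vanish there: it would vanish on the
  -- whole span, and by `intoΠ-positive` w would keep it positive.
  match-unique′ : {w w′ : W n} {u : W p} → IntoΠ K w → IntoΠ K w′ → Matches w u → Matches w′ u → w ≡ w′
  match-unique′ {w} {w′} {u} into into′ dom dom′ = inversions-determine (carry {w} {w′} into dom dom′) (carry {w′} {w} into′ dom′ dom)
    where
    carry : {w w′ : W n} → IntoΠ K w → Matches w u → Matches w′ u → {α : V n} → Positive α →
            ⟨ act w α , η ⟩ < 0ℚ → ⟨ act w′ α , η ⟩ < 0ℚ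
    carry {w} {w′} into dom dom′ {α} α⁺ neg = side⇒inversion {w = w′} {point u} dom′ (positive-root α⁺)
      (≤∧≢⇒< (inversion⇒side {w = w} {point u} dom (positive-root α⁺) neg) (nonzero (restrict-root K (positive-root α⁺))))
      where
      nonzero : Restriction K α → ⟨ α , point u ⟩ ≢ 0ℚ
      nonzero (inj₁ flat) _ = contradiction neg (<-asym (intoΠ-positive {w = w} into α⁺ (flat η)))
      nonzero (inj₂ (ᾱ , c , ᾱ∈ , 0<c , eq)) on = [ (λ c≡0 → <⇒≢ 0<c (sym c≡0)) , root-η≢0 u ᾱ∈ ]′
        (*-zero c _ (trans (sym (eq (act (u ⁻¹) η))) on))

  -- On the span a simple root outside K is a positive multiple of a simple root of the smaller
  -- system, so the two have the same sign at `point u`.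
  match-Des : {w : W n} {u : W p} → Matches w u → restrict K (Des w) ≡ Des u
  match-Des {w} {u} dom = Subsetₚ.⊆-antisym to from
    where
    ∈restrict : ∀ i → i Subset.∈ restrict K (Des w) ⇔ embed K i Subset.∈ Des w
    ∈restrict i = mk⇔
      (λ i∈ → Vecₚ.lookup⇒[]= (embed K i) (Des w) (trans (sym (lookup-restrict K (Des w) i)) (Vecₚ.[]=⇒lookup i∈)))
      (λ i∈ → Vecₚ.lookup⇒[]= i (restrict K (Des w)) (trans (lookup-restrict K (Des w) i) (Vecₚ.[]=⇒lookup i∈)))
    to : restrict K (Des w) ⊆ Des u
    to {i} i∈ = let c , 0<c , eq = blowUp-simple K i in ⇐ (∈Des⇔ u i)
      (subst (_< 0ℚ) (sym (act-adjoint u (simple i) η)) (≤∧≢⇒< (≮⇒≥ λ 0< → ≤⇒≯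
          (inversion⇒side {w = w} {point u} dom (root-simple (embed K i)) (⇒ (∈Des⇔ w (embed K i)) (⇒ (∈restrict i) i∈)))
          (subst (0ℚ <_) (sym (eq (act (u ⁻¹) η))) (*-pos 0<c 0<)))
        (root-η≢0 u (root-simple i))))
    from : Des u ⊆ restrict K (Des w)
    from {i} i∈ = let c , 0<c , eq = blowUp-simple K i in ⇐ (∈restrict i) (⇐ (∈Des⇔ w (embed K i))
      (side⇒inversion {w = w} {point u} dom (root-simple (embed K i)) (subst₂ _<_ (sym (eq (act (u ⁻¹) η))) (*-zeroʳ c)
        (ℚₚ.*-monoʳ-<-pos c {{positive 0<c}} (subst (_< 0ℚ) (act-adjoint u (simple i) η) (⇒ (∈Des⇔ u i) i∈))))))

  ∑-collapse : (h : Subset p → ℚ) →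
    ∑ (elements n) (λ w → [ intoΠ? K w ]? * h (restrict K (Des w))) ≡ ∑ (elements p) (h ∘ Des)
  ∑-collapse h = trans (sym (∑-filter (intoΠ? K) (elements n) (h ∘ restrict K ∘ Des)))
    (∑-match (Uniqueₚ.filter⁺ (intoΠ? K) (unique-elements n)) (unique-elements p) matches?
      (λ {w} w∈ → let u , dom = match-exists w (into w∈) in u , ∈-elements u , dom)
      (λ {w} {u} {u′} _ _ _ → match-unique {w} {u} {u′})
      (λ {u} _ → let w , w∈ , dom = match-exists′ u in w , ∈-filter⁺ (intoΠ? K) (∈-elements w) w∈ , dom)
      (λ {w} {w′} {u} w∈ w′∈ _ → match-unique′ {w} {w′} {u} (into w∈) (into w′∈))
      (λ {w} {u} _ _ dom → cong h (match-Des {w} {u} dom)))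
    where
    into : ∀ {w} → w ∈ filter (intoΠ? K) (elements n) → IntoΠ K w
    into w∈ = proj₂ (∈-filter⁻ (intoΠ? K) {xs = elements n} w∈)

∈X-⊆ : (w : W n) (L : Subset n) → [ w ∈X? L ]? ≡ [ L ⊆? ∁ (Des w) ]?
∈X-⊆ w L = []?-cong (w ∈X? L) (L ⊆? ∁ (Des w))
  (λ empty {i} i∈ → Subsetₚ.x∉p⇒x∈∁p λ i∈Des → empty (i , Subsetₚ.x∈p∩q⁺ (i∈Des , i∈)))
  (λ L⊆ (i , i∈) → let i∈Des , i∈L = Subsetₚ.x∈p∩q⁻ (Des w) L i∈ in Subsetₚ.x∈∁p⇒x∉p (L⊆ i∈L) i∈Des)

lexDominant? : (w : W n) (t : V n) → Dec (LexDominant w t)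
lexDominant? w t = Finₚ.all? λ i → (0ℚ ℚₚ.<? ⟨ simple i , act w t ⟩) ⊎-dec
  ((⟨ simple i , act w t ⟩ ℚₚ.≟ 0ℚ) ×-dec (0ℚ ℚₚ.<? ⟨ simple i , act w η ⟩))

-- Applied to u d + ϵη, the inverse of u gives d + ϵu⁻¹η. At this point a simple root has the sign
-- it has at d, or, if it vanishes at d, is positive exactly when it is no descent of u.
onFace-lexDominant : {d : V n} (u : W n) →
  (∃ λ L → OnFace L d × L ⊆ ∁ (Des u)) ⇔ LexDominant (u ⁻¹) (act u d)
onFace-lexDominant {n} {d} u = mk⇔ to from
  where
  side : ∀ i → ⟨ act u (simple i) , η ⟩ ≡ ⟨ simple i , act (u ⁻¹) η ⟩
  side i = act-adjoint u (simple i) η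
  to : (∃ λ L → OnFace L d × L ⊆ ∁ (Des u)) → LexDominant (u ⁻¹) (act u d)
  to (L , (on , off) , L⊆) i rewrite act-⁻¹ˡ u d with i Subsetₚ.∈? L
  ... | no i∉  = inj₁ (off i i∉)
  ... | yes i∈ = inj₂ (on i i∈ , ≤∧≢⇒< (≮⇒≥ λ neg → Subsetₚ.x∈∁p⇒x∉p (L⊆ i∈)
                   (⇐ (∈Des⇔ u i) (subst (_< 0ℚ) (sym (side i)) neg))) (root-η≢0 u (root-simple i) ∘ sym))
  from : LexDominant (u ⁻¹) (act u d) → ∃ λ L → OnFace L d × L ⊆ ∁ (Des u)
  from lex = zeros d , dominant-onFace (subst Dominant (act-⁻¹ˡ u d) (lex-dominant {w = u ⁻¹} {act u d} lex)) , λ {i} i∈ → Subsetₚ.x∉p⇒x∈∁p λ i∈Des →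
    case i (lex i) (⇒ (∈zeros d i) i∈) (subst (_< 0ℚ) (side i) (⇒ (∈Des⇔ u i) i∈Des))
    where
    case : ∀ i → 0ℚ < ⟨ simple i , act (u ⁻¹) (act u d) ⟩ ⊎ (⟨ simple i , act (u ⁻¹) (act u d) ⟩ ≡ 0ℚ × 0ℚ < ⟨ simple i , act (u ⁻¹) η ⟩) →
           ⟨ simple i , d ⟩ ≡ 0ℚ → ¬ ⟨ simple i , act (u ⁻¹) η ⟩ < 0ℚ
    case i (inj₁ p) on _ = <⇒≢ p (sym (trans (cong ⟨ simple i ,_⟩ (act-⁻¹ˡ u d)) on))
    case i (inj₂ (_ , p)) _ neg = <-asym p neg

-- A set L between K and the complement of D consists of K and some of the indices outside K;
-- dropping the entries of K leaves `free L` unchanged.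
∑-restrict : (K D : Subset n) → K ⊆ ∁ D → (f : ℕ → ℚ) →
  ∑ (subsets n) (λ L → [ K ⊆? L ]? * ([ L ⊆? ∁ D ]? * f (free L))) ≡
  ∑ (subsets (free K)) (λ L → [ L ⊆? ∁ (restrict K D) ]? * f (free L))
∑-restrict [] [] _ f = cong (_+ 0ℚ) (*-identityˡ (1ℚ * f 0))
∑-restrict {suc n} (b ∷ K) (d ∷ D) K⊆ f = trans (∑-× _∷_ (inside ∷ outside ∷ []) (subsets n) _) (go b d K⊆)
  where
  K⊆D : K ⊆ ∁ D
  K⊆D = Subsetₚ.drop-∷-⊆ K⊆
  term : (b d c : Bool.Bool) → Subset n → ℚ
  term b d c L = [ (b ∷ K) ⊆? (c ∷ L) ]? * ([ (c ∷ L) ⊆? ∁ (d ∷ D) ]? * f (free (c ∷ L)))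
  reduced : (d c : Bool.Bool) → Subset (free K) → ℚ
  reduced d c L = [ (c ∷ L) ⊆? ∁ (d ∷ restrict K D) ]? * f (free (c ∷ L))
  kill₁ : ∀ {p} x y → p ≡ 0ℚ → p * (x * y) ≡ 0ℚ
  kill₁ x y eq = trans (cong (_* (x * y)) eq) (*-zeroˡ (x * y))
  kill₂ : ∀ p {x} y → x ≡ 0ℚ → p * (x * y) ≡ 0ℚ
  kill₂ p {x} y eq = 0c p (x * y) (trans (cong (_* y) eq) (*-zeroˡ y))
  inside-part : ∀ d → ∑ (subsets n) (term outside d inside) ≡ ∑ (subsets (free K)) (reduced d inside)
  inside-part inside = trans
    (∑-zero (subsets n) _ λ {L} _ → kill₂ [ (outside ∷ K) ⊆? (inside ∷ L) ]? (f (free L)) (⊆?-inside L (∁ D)))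
    (sym (∑-zero (subsets (free K)) _ λ {L} _ → trans (cong (_* f (free L)) (⊆?-inside L (∁ (restrict K D)))) (*-zeroˡ (f (free L)))))
  inside-part outside = trans
    (∑-cong (subsets n) λ L → cong₂ (λ x y → x * (y * f (free L))) (⊆?-outside inside K L) (⊆?-same inside L (∁ D)))
    (trans (∑-restrict K D K⊆D f) (∑-cong (subsets (free K)) λ L → cong (_* f (free L)) (sym (⊆?-same inside L (∁ (restrict K D))))))
  outside-part : ∀ d → ∑ (subsets n) (term outside d outside) ≡ ∑ (subsets (free K)) (reduced d outside)
  outside-part d = trans
    (∑-cong (subsets n) λ L → cong₂ (λ x y → x * (y * f (suc (free L)))) (⊆?-outside outside K L) (⊆?-outside (Bool.not d) L (∁ D)))
    (trans (∑-restrict K D K⊆D (f ∘ suc)) (∑-cong (subsets (free K)) λ L →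
      cong (_* f (suc (free L))) (sym (⊆?-outside (Bool.not d) L (∁ (restrict K D))))))
  go : ∀ b d → (zero Subset.∈ b ∷ K → zero Subset.∈ ∁ (d ∷ D)) →
    ∑ (subsets n) (term b d inside) + (∑ (subsets n) (term b d outside) + 0ℚ) ≡
    ∑ (subsets (free (b ∷ K))) (λ L → [ L ⊆? ∁ (restrict (b ∷ K) (d ∷ D)) ]? * f (free L))
  go inside inside zero∈ = contradiction (zero∈ Vec.here) λ ()
  go inside outside _ = trans (cong₂ (λ x y → x + (y + 0ℚ))
      (trans (∑-cong (subsets n) λ L → cong₂ (λ x y → x * (y * f (free L))) (⊆?-same inside K L) (⊆?-same inside L (∁ D)))
        (∑-restrict K D K⊆D f))
      (∑-zero (subsets n) _ λ {L} _ → kill₁ [ (outside ∷ L) ⊆? ∁ (outside ∷ D) ]? (f (suc (free L))) (⊆?-inside K L)))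
    (+-identityʳ _)
  go outside d _ = trans (cong₂ (λ x y → x + (y + 0ℚ)) (inside-part d) (outside-part d))
    (sym (∑-× _∷_ (inside ∷ outside ∷ []) (subsets (free K)) (λ L → [ L ⊆? ∁ (d ∷ restrict K D) ]? * f (free L))))

module _ (m : ℕ) where
  open Cube m

  -- Every point t of the cube is u d for exactly one dominant d and one u having
  -- no descent among the simple roots which vanish at d.
  ∑-descents : ∀ p → ∑ (elements p) (λ u → ∑ (subsets p) (λ L → [ L ⊆? ∁ (Des u) ]? * faceSize (free L))) ≡ fromℕ k ^ p
  ∑-descents p = begin
    ∑ (elements p) (λ u → ∑ (subsets p) (λ L → [ L ⊆? ∁ (Des u) ]? * faceSize (free L)))
      ≡⟨ ∑-cong (elements p) (λ u → trans (∑-cong (subsets p) λ L → trans (cong ([ L ⊆? ∁ (Des u) ]? *_) (sym (∑-onFace L)))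
           (sym (∑-*ˡ [ L ⊆? ∁ (Des u) ]? (cube p) _))) (trans (∑-swap (subsets p) (cube p) _)
           (trans (∑-cong (cube p) (faces u)) (∑-act u (λ t → [ lexDominant? (u ⁻¹) t ]?))))) ⟩
    ∑ (elements p) (λ u → ∑ (cube p) (λ t → [ lexDominant? (u ⁻¹) t ]?))
      ≡⟨ ∑-swap (elements p) (cube p) _ ⟩
    ∑ (cube p) (λ t → ∑ (elements p) (λ u → [ lexDominant? (u ⁻¹) t ]?))
      ≡⟨ ∑-cong (cube p) (λ t → unique t (lexDominant-exists t)) ⟩
    ∑ (cube p) (λ _ → 1ℚ)
      ≡⟨ ∑-cube-1 p ⟩
    fromℕ k ^ p ∎
    where
    open ≡-Reasoning
    faces : ∀ u d → ∑ (subsets p) (λ L → [ L ⊆? ∁ (Des u) ]? * [ onFace? L d ]?) ≡ [ lexDominant? (u ⁻¹) (act u d) ]?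
    faces u d = trans (∑-cong (subsets p) λ L → trans (*-comm [ L ⊆? ∁ (Des u) ]? _) (sym ([]?-× (onFace? L d) (L ⊆? ∁ (Des u)))))
      (go (lexDominant? (u ⁻¹) (act u d)))
      where
      go : (lex? : Dec (LexDominant (u ⁻¹) (act u d))) → ∑ (subsets p) (λ L → [ onFace? L d ×-dec (L ⊆? ∁ (Des u)) ]?) ≡ [ lex? ]?
      go (yes lex) = let L , face , L⊆ = ⇐ (onFace-lexDominant u) lex in
        ∑-indicator₁ (λ L → onFace? L d ×-dec (L ⊆? ∁ (Des u))) unique-subsets (∈-subsets L) (face , (λ {x} → L⊆ {x}))
          (λ _ (face′ , _) → trans (onFace-unique face′) (sym (onFace-unique face)))
      go (no ¬lex) = ∑-zero (subsets p) _ λ {L} _ → []?-no (onFace? L d ×-dec (L ⊆? ∁ (Des u)))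
        λ (face , L⊆) → ¬lex (⇒ (onFace-lexDominant u) (L , face , λ {x} → L⊆ {x}))
    unique : ∀ t → (∃ λ v → LexDominant v t) → ∑ (elements p) (λ u → [ lexDominant? (u ⁻¹) t ]?) ≡ 1ℚ
    unique t (v , lex) = ∑-indicator₁ (λ u → lexDominant? (u ⁻¹) t) (unique-elements p) (∈-elements (v ⁻¹))
      (subst (λ x → LexDominant x t) (sym (⁻¹-involutive v)) lex)
      (λ {u} _ lex′ → trans (sym (⁻¹-involutive u)) (cong _⁻¹ (lexDominant-unique {w = u ⁻¹} {v} {t} lex′ lex)))

  -- For w(K) ⊆ Π no index in K is a descent, so for fixed w the sets L run between K and the
  -- complement of `Des w`. `∑-restrict` and `∑-collapse` then remove K.
  ∑-intoΠ : (K : Subset n) → ∑ (subsets n) (λ L → [ K ⊆? L ]? * (faceSize (free L) *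
    ∑ (elements n) (λ w → [ (w ∈X? L) ×-dec intoΠ? K w ]?))) ≡ fromℕ k ^ free K
  ∑-intoΠ {n} K = begin
    ∑ (subsets n) (λ L → [ K ⊆? L ]? * (faceSize (free L) * ∑ (elements n) (λ w → [ (w ∈X? L) ×-dec intoΠ? K w ]?)))
      ≡⟨ ∑-cong (subsets n) (λ L → trans (sym (*-assoc [ K ⊆? L ]? (faceSize (free L)) _))
           (trans (sym (∑-*ˡ ([ K ⊆? L ]? * faceSize (free L)) (elements n) _)) (∑-cong (elements n) (rearrange L)))) ⟩
    ∑ (subsets n) (λ L → ∑ (elements n) (λ w → [ intoΠ? K w ]? * ([ K ⊆? L ]? * ([ L ⊆? ∁ (Des w) ]? * faceSize (free L)))))
      ≡⟨ ∑-swap (subsets n) (elements n) _ ⟩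
    ∑ (elements n) (λ w → ∑ (subsets n) (λ L → [ intoΠ? K w ]? * ([ K ⊆? L ]? * ([ L ⊆? ∁ (Des w) ]? * faceSize (free L)))))
      ≡⟨ ∑-cong (elements n) (λ w → trans (∑-*ˡ [ intoΠ? K w ]? (subsets n) _)
           ([]?-*-cong (intoΠ? K w) λ into → ∑-restrict K (Des w) (no-descent w into) faceSize)) ⟩
    ∑ (elements n) (λ w → [ intoΠ? K w ]? * h (restrict K (Des w)))
      ≡⟨ Collapse.∑-collapse K h ⟩
    ∑ (elements (free K)) (h ∘ Des)
      ≡⟨ ∑-descents (free K) ⟩
    fromℕ k ^ free K ∎
    where
    open ≡-Reasoning
    h : Subset (free K) → ℚ
    h D = ∑ (subsets (free K)) (λ L → [ L ⊆? ∁ D ]? * faceSize (free L))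
    no-descent : ∀ w → IntoΠ K w → K ⊆ ∁ (Des w)
    no-descent w into {i} i∈ = let j , eq = into i i∈ in Subsetₚ.x∉p⇒x∈∁p λ i∈Des → <-asym 0<2
      (subst (_< 0ℚ) (trans (cong ⟨_, η ⟩ eq) (simple-η j)) (⇒ (∈Des⇔ w i) i∈Des))
    rearrange : ∀ L w → [ K ⊆? L ]? * faceSize (free L) * [ (w ∈X? L) ×-dec intoΠ? K w ]? ≡
      [ intoΠ? K w ]? * ([ K ⊆? L ]? * ([ L ⊆? ∁ (Des w) ]? * faceSize (free L)))
    rearrange L w = trans (cong ([ K ⊆? L ]? * faceSize (free L) *_) (trans ([]?-× (w ∈X? L) (intoΠ? K w)) (cong (_* [ intoΠ? K w ]?) (∈X-⊆ w L))))
      (solve 4 (λ a f b c → a :* f :* (b :* c) := c :* (a :* (b :* f))) refl [ K ⊆? L ]? (faceSize (free L)) [ L ⊆? ∁ (Des w) ]? [ intoΠ? K w ]?)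

-- The idempotents

∼-sym : {J K : Subset n} → J ∼ K → K ∼ J
∼-sym (w , to , from) = w ⁻¹ ,
  (λ k k∈ → let j , j∈ , eq = from k k∈ in j , j∈ , trans (cong (act (w ⁻¹)) (sym eq)) (act-⁻¹ˡ w (simple j))) ,
  (λ j j∈ → let k , k∈ , eq = to j j∈ in k , k∈ , trans (cong (act (w ⁻¹)) (sym eq)) (act-⁻¹ˡ w (simple j)))

∼-trans : {J K L : Subset n} → J ∼ K → K ∼ L → J ∼ L
∼-trans (w , to , from) (w′ , to′ , from′) = w′ ∙ w ,
  (λ j j∈ → let k , k∈ , eq = to j j∈ ; l , l∈ , eq′ = to′ k k∈ in
     l , l∈ , trans (act-∙ w′ w (simple j)) (trans (cong (act w′) eq) eq′)) ,
  (λ l l∈ → let k , k∈ , eq′ = from′ l l∈ ; j , j∈ , eq = from k k∈ in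
     j , j∈ , trans (act-∙ w′ w (simple j)) (trans (cong (act w′) eq) eq′))

∼-class : {J K : Subset n} → J ∼ K → fromℕ (length (λ-class J)) ≡ fromℕ (length (λ-class K))
∼-class {n} {J} {K} J∼K = trans (count-∑ (J ∼?_) (subsets n)) (trans
  (∑-cong (subsets n) λ L → []?-cong (J ∼? L) (K ∼? L) (∼-trans (∼-sym J∼K)) (∼-trans J∼K))
  (sym (count-∑ (K ∼?_) (subsets n))))

allPairs-∈ : {R : A → A → Set} {as : List A} → AllPairs R as → ∀ {a b} → a ∈ as → b ∈ as → a ≡ b ⊎ (R a b ⊎ R b a)
allPairs-∈ {R = R} {as} pairs a∈ b∈ with Any.index a∈ Finₚ.≟ Any.index b∈
... | yes eq = inj₁ (trans (Anyₚ.lookup-index a∈) (trans (cong (List.lookup as) eq) (sym (Anyₚ.lookup-index b∈))))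
... | no neq = inj₂ (subst₂ (λ x y → R x y ⊎ R y x) (sym (Anyₚ.lookup-index a∈)) (sym (Anyₚ.lookup-index b∈))
                 (allPairs-lookup pairs neq))

∑-classes : (J : Subset n) → ∑ (classes n) (λ J₀ → [ J₀ ∼? J ]?) ≡ 1ℚ
∑-classes {n} J = let J₀ , J₀∈ , J₀∼J = find found in
  ∑-indicator₁ (_∼? J) distinct J₀∈ J₀∼J λ J₁∈ J₁∼J → unique J₁∈ J₀∈ (∼-trans J₁∼J (∼-sym J₀∼J))
  where
  inequivalent : AllPairs (λ J K → ¬ J ∼ K) (classes n)
  inequivalent = deduplicate-allPairs _∼?_ (subsets n)
  distinct : Unique (classes n)
  distinct = AllPairs.map (λ { J≁K refl → J≁K (∼-refl _) }) inequivalent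
  found : Any.Any (_∼ J) (classes n)
  found = Anyₚ.deduplicate⁺ _∼?_ (λ K∼L L∼J → ∼-trans K∼L L∼J) (lose (∈-subsets J) (∼-refl J))
  unique : ∀ {J₁ J₂} → J₁ ∈ classes n → J₂ ∈ classes n → J₁ ∼ J₂ → J₁ ≡ J₂
  unique J₁∈ J₂∈ J₁∼J₂ with allPairs-∈ inequivalent J₁∈ J₂∈
  ... | inj₁ eq        = eq
  ... | inj₂ (inj₁ ¬∼) = contradiction J₁∼J₂ ¬∼
  ... | inj₂ (inj₂ ¬∼) = contradiction (∼-sym J₁∼J₂) ¬∼

0÷₀ : ∀ q → 0ℚ ÷₀ q ≡ 0ℚ
0÷₀ q with q ℚₚ.≟ 0ℚ
... | yes _  = refl
... | no q≢0 = *-zeroˡ ((1/ q) {{≢-nonZero q≢0}})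

÷₀-1 : ∀ p q → p ÷₀ q ≡ p * (1ℚ ÷₀ q)
÷₀-1 p q with q ℚₚ.≟ 0ℚ
... | yes _  = sym (*-zeroʳ p)
... | no q≢0 = cong (p *_) (sym (*-identityˡ ((1/ q) {{≢-nonZero q≢0}})))

-- The inverse of a triangular matrix is triangular. This lets the sum over K ⊆ J in the idempotents
-- be extended to all K.
β-⊈ : (J K : Subset n) → ¬ (K ⊆ J) → β J K ≡ 0ℚ
β-⊈ {n} J K = go (⊂-wellFounded J)
  where
  go : ∀ {J} → Acc _⊂_ J → ¬ (K ⊆ J) → β J K ≡ 0ℚ
  go {J} (acc smaller) K⊈J = trans (β-rec J K) (trans
    (cong (_÷₀ μ J J) (cong₂ _-_ ([]?-no (Vecₚ.≡-dec Bool._≟_ J K) λ { refl → K⊈J λ {x} x∈ → x∈ })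
      (∑-zero (subsets n) _ λ {L} _ → term L (L ⊂? J))))
    (0÷₀ (μ J J)))
    where
    term : ∀ L (L⊂J : Dec (L ⊂ J)) → β-term J L (λ _ → β L K) L⊂J ≡ 0ℚ
    term L (yes L⊂J@(L⊆J , _)) = 0c (μ J L) (β L K) (go (smaller L⊂J) λ K⊆L → K⊈J λ {x} x∈ → L⊆J (K⊆L x∈))
    term L (no _)              = refl

-- The index keeps the quotient out of the goal which the with in μ-ratio would
-- otherwise normalise.
data Ratio (L J : Subset n) : ℚ → Set where
  ratio : Ratio L J (fromℕ (count (λ w → (w ∈X? L) ×-dec intoΠ? J w) (elements n)) ÷₀ fromℕ (length (λ-class J)))

μ-ratio : {L J : Subset n} {q : ℚ} → J ⊆ L → Ratio L J q → μ L J ≡ q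
μ-ratio {n} {L} {J} {q} J⊆L r with J ⊆? L
... | no J⊈L = contradiction (λ {x} → J⊆L {x}) J⊈L
... | yes _  = value r
  where
  value : Ratio L J q → fromℕ (count (λ w → (w ∈X? L) ×-dec intoΠ? J w) (elements n)) ÷₀ fromℕ (length (λ-class J)) ≡ q
  value ratio = refl

μ-⊆ : (L J : Subset n) → J ⊆ L → μ L J ≡
  fromℕ (count (λ w → (w ∈X? L) ×-dec intoΠ? J w) (elements n)) * (1ℚ ÷₀ fromℕ (length (λ-class J)))
μ-⊆ {n} L J J⊆L = trans (μ-ratio J⊆L ratio)
  (÷₀-1 (fromℕ (count (λ w → (w ∈X? L) ×-dec intoΠ? J w) (elements n))) (fromℕ (length (λ-class J))))

^-+ : ∀ x a b → x ^ (a ℕ.+ b) ≡ x ^ a * x ^ b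
^-+ x zero    b = sym (*-identityˡ (x ^ b))
^-+ x (suc a) b = trans (cong (x *_) (^-+ x a b)) (sym (*-assoc x (x ^ a) (x ^ b)))

module _ (m : ℕ) {n : ℕ} where
  open Cube m

  private
    κ c : ℚ
    κ = fromℕ k
    c = 1ℚ ÷₀ κ ^ n

    κ^≢0 : ∀ p → κ ^ p ≢ 0ℚ
    κ^≢0 = ^-≢0 (fromℕ-suc≢0 (m ℕ.+ m))

  -- The coefficient with which row J of β enters the definition of `M`; it is constant on classes.
  weight : Subset n → ℚ
  weight J = (1ℚ ÷₀ fromℕ (length (λ-class J))) * (1ℚ ÷₀ κ ^ ∣ J ∣)

  weight-∼ : {J K : Subset n} → J ∼ K → weight J ≡ weight K
  weight-∼ J∼K = cong₂ (λ p q → (1ℚ ÷₀ p) * (1ℚ ÷₀ κ ^ q)) (∼-class J∼K) (∼-∣∣ J∼K)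

  -- This is `∑-intoΠ` divided by |λ(J)| and by the n-th power of k, since n minus `free J` is |J|.
  weight-μ : (J : Subset n) → ∑ (subsets n) (λ L → (c * faceSize (free L)) * μ L J) ≡ weight J
  weight-μ J = begin
    ∑ (subsets n) (λ L → (c * faceSize (free L)) * μ L J)
      ≡⟨ ∑-cong (subsets n) (λ L → trans (cong ((c * faceSize (free L)) *_) (μ-≡ L))
           (solve 5 (λ c f a d s → (c :* f) :* (a :* (s :* d)) := (d :* c) :* (a :* (f :* s))) refl c (faceSize (free L)) [ J ⊆? L ]? d (S L))) ⟩
    ∑ (subsets n) (λ L → (d * c) * ([ J ⊆? L ]? * (faceSize (free L) * S L)))
      ≡⟨ ∑-*ˡ (d * c) (subsets n) _ ⟩
    (d * c) * ∑ (subsets n) (λ L → [ J ⊆? L ]? * (faceSize (free L) * S L))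
      ≡⟨ cong ((d * c) *_) (∑-intoΠ m J) ⟩
    (d * c) * κ ^ free J
      ≡⟨ trans (*-assoc d c (κ ^ free J)) (cong (d *_) scaled) ⟩
    weight J ∎
    where
    open ≡-Reasoning
    d : ℚ
    d = 1ℚ ÷₀ fromℕ (length (λ-class J))
    S : Subset n → ℚ
    S L = ∑ (elements n) (λ w → [ (w ∈X? L) ×-dec intoΠ? J w ]?)
    μ-≡ : ∀ L → μ L J ≡ [ J ⊆? L ]? * (S L * d)
    μ-≡ L = go (J ⊆? L)
      where
      go : (p? : Dec (J ⊆ L)) → μ L J ≡ [ p? ]? * (S L * d)
      go (yes J⊆L) = trans (μ-⊆ L J J⊆L) (trans (cong (_* d) (count-∑ (λ w → (w ∈X? L) ×-dec intoΠ? J w) (elements n))) (sym (*-identityˡ (S L * d))))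
      go (no J⊈L)  = trans (μ-⊈ L J J⊈L) (sym (*-zeroˡ (S L * d)))
    scaled : c * κ ^ free J ≡ 1ℚ ÷₀ κ ^ ∣ J ∣
    scaled = sym (÷₀-unique (κ^≢0 ∣ J ∣) (begin
      κ ^ ∣ J ∣ * (c * κ ^ free J)  ≡⟨ solve 3 (λ x c y → x :* (c :* y) := (x :* y) :* c) refl (κ ^ ∣ J ∣) c (κ ^ free J) ⟩
      (κ ^ ∣ J ∣ * κ ^ free J) * c  ≡⟨ cong (_* c) (trans (sym (^-+ κ ∣ J ∣ (free J))) (cong (κ ^_) (∣∣+free J))) ⟩
      κ ^ n * c  ≡⟨ ÷₀-* 1ℚ (κ ^ n) (κ^≢0 n) ⟩
      1ℚ  ∎))

  -- As row vectors, `weight` is r μ for r L = c * `faceSize (free L)`; multiplying by β on the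
  -- right and using μ β = 1 returns r.
  weight-β : (K : Subset n) → ∑ (subsets n) (λ J → weight J * β J K) ≡ c * faceSize (free K)
  weight-β K = begin
    ∑ (subsets n) (λ J → weight J * β J K)
      ≡⟨ ∑-cong (subsets n) (λ J → trans (cong (_* β J K) (sym (weight-μ J)))
           (trans (sym (∑-*ʳ (β J K) (subsets n) _)) (∑-cong (subsets n) λ L → *-assoc (r L) (μ L J) (β J K)))) ⟩
    ∑ (subsets n) (λ J → ∑ (subsets n) (λ L → r L * (μ L J * β J K)))
      ≡⟨ ∑-swap (subsets n) (subsets n) _ ⟩
    ∑ (subsets n) (λ L → ∑ (subsets n) (λ J → r L * (μ L J * β J K)))
      ≡⟨ ∑-cong (subsets n) (λ L → trans (∑-*ˡ (r L) (subsets n) _) (trans (cong (r L *_) (μ-β L K))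
           (*-comm (r L) _))) ⟩
    ∑ (subsets n) (λ L → [ Vecₚ.≡-dec Bool._≟_ L K ]? * r L)
      ≡⟨ ∑-indicator (λ L → Vecₚ.≡-dec Bool._≟_ L K) r unique-subsets (∈-subsets K) refl (λ _ eq → eq) ⟩
    r K ∎
    where
    open ≡-Reasoning
    r : Subset n → ℚ
    r L = c * faceSize (free L)

  -- Since weights are constant on classes, summing over representatives and then over their classes
  -- is summing over all subsets J; `weight-β` then carries out the sum over J.
  M-∑ : (w : W n) → M κ w ≡ c * (∑[ K ∈ subsets n ] [ K ⊆? ∁ (Des w) ]? * faceSize (free K))
  M-∑ w = begin
    ∑ (classes n) (λ J₀ → idempotent J₀ w ÷₀ κ ^ ∣ J₀ ∣)
      ≡⟨ ∑-cong (classes n) summand ⟩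
    ∑ (classes n) (λ J₀ → ∑ (subsets n) (λ J → [ J₀ ∼? J ]? * (weight J * g J)))
      ≡⟨ ∑-swap (classes n) (subsets n) _ ⟩
    ∑ (subsets n) (λ J → ∑ (classes n) (λ J₀ → [ J₀ ∼? J ]? * (weight J * g J)))
      ≡⟨ ∑-cong (subsets n) (λ J → trans (∑-*ʳ (weight J * g J) (classes n) _)
           (trans (cong (_* (weight J * g J)) (∑-classes J)) (*-identityˡ (weight J * g J)))) ⟩
    ∑ (subsets n) (λ J → weight J * g J)
      ≡⟨ ∑-cong (subsets n) (λ J → trans (sym (∑-*ˡ (weight J) (subsets n) _))
           (∑-cong (subsets n) λ K → solve 3 (λ p q s → p :* (q :* s) := s :* (p :* q)) refl (weight J) (β J K) (x⟨ K ⟩ w))) ⟩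
    ∑ (subsets n) (λ J → ∑ (subsets n) (λ K → x⟨ K ⟩ w * (weight J * β J K)))
      ≡⟨ ∑-swap (subsets n) (subsets n) _ ⟩
    ∑ (subsets n) (λ K → ∑ (subsets n) (λ J → x⟨ K ⟩ w * (weight J * β J K)))
      ≡⟨ ∑-cong (subsets n) (λ K → trans (∑-*ˡ (x⟨ K ⟩ w) (subsets n) _) (trans (cong₂ _*_ (∈X-⊆ w K) (weight-β K))
           (solve 3 (λ p q s → p :* (q :* s) := q :* (p :* s)) refl [ K ⊆? ∁ (Des w) ]? c (faceSize (free K))))) ⟩
    ∑ (subsets n) (λ K → c * ([ K ⊆? ∁ (Des w) ]? * faceSize (free K)))
      ≡⟨ ∑-*ˡ c (subsets n) _ ⟩
    c * ∑ (subsets n) (λ K → [ K ⊆? ∁ (Des w) ]? * faceSize (free K)) ∎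
    where
    open ≡-Reasoning
    g : Subset n → ℚ
    g J = ∑ (subsets n) (λ K → β J K * x⟨ K ⟩ w)
    supported : ∀ J → ∑ (filter (_⊆? J) (subsets n)) (λ K → β J K * x⟨ K ⟩ w) ≡ g J
    supported J = trans (∑-filter (_⊆? J) (subsets n) _) (∑-cong (subsets n) λ K → go K (K ⊆? J))
      where
      go : ∀ K (d : Dec (K ⊆ J)) → [ d ]? * (β J K * x⟨ K ⟩ w) ≡ β J K * x⟨ K ⟩ w
      go K (yes _)  = *-identityˡ _
      go K (no K⊈J) = trans (*-zeroˡ (β J K * x⟨ K ⟩ w)) (sym (trans (cong (_* x⟨ K ⟩ w) (β-⊈ J K K⊈J)) (*-zeroˡ (x⟨ K ⟩ w))))
    summand : ∀ J₀ → idempotent J₀ w ÷₀ κ ^ ∣ J₀ ∣ ≡ ∑ (subsets n) (λ J → [ J₀ ∼? J ]? * (weight J * g J))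
    summand J₀ = begin
      idempotent J₀ w ÷₀ κ ^ ∣ J₀ ∣
        ≡⟨ ÷₀-1 (idempotent J₀ w) (κ ^ ∣ J₀ ∣) ⟩
      d * ∑ (λ-class J₀) (λ J → ∑ (filter (_⊆? J) (subsets n)) (λ K → β J K * x⟨ K ⟩ w)) * (1ℚ ÷₀ κ ^ ∣ J₀ ∣)
        ≡⟨ cong (λ q → d * q * (1ℚ ÷₀ κ ^ ∣ J₀ ∣)) (trans (∑-cong (λ-class J₀) supported) (∑-filter (J₀ ∼?_) (subsets n) g)) ⟩
      d * ∑ (subsets n) (λ J → [ J₀ ∼? J ]? * g J) * (1ℚ ÷₀ κ ^ ∣ J₀ ∣)
        ≡⟨ solve 3 (λ d s q → d :* s :* q := (d :* q) :* s) refl d (∑ (subsets n) (λ J → [ J₀ ∼? J ]? * g J)) (1ℚ ÷₀ κ ^ ∣ J₀ ∣) ⟩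
      weight J₀ * ∑ (subsets n) (λ J → [ J₀ ∼? J ]? * g J)
        ≡⟨ sym (∑-*ˡ (weight J₀) (subsets n) _) ⟩
      ∑ (subsets n) (λ J → weight J₀ * ([ J₀ ∼? J ]? * g J))
        ≡⟨ ∑-cong (subsets n) (λ J → trans (solve 3 (λ p q s → p :* (q :* s) := q :* (p :* s)) refl (weight J₀) [ J₀ ∼? J ]? (g J))
             ([]?-*-cong (J₀ ∼? J) λ J₀∼J → cong (_* g J) (weight-∼ J₀∼J))) ⟩
      ∑ (subsets n) (λ J → [ J₀ ∼? J ]? * (weight J * g J)) ∎
      where
      d : ℚ
      d = 1ℚ ÷₀ fromℕ (length (λ-class J₀))

-- Conclusion

coefficients-agree : ∀ m {k} → k ≡ suc (m ℕ.+ m) → (w : W (suc n)) →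
  (x[ k ] w ≡ M (fromℕ k) w) × (x[ k ] w ≡ H (fromℕ k) w)
coefficients-agree m refl w = trans (Cube.x-∑ m w) (sym (M-∑ m w)) , trans (Cube.x-∑ m w) (sym (H-∑ m w))

proposition6 : (n : ℕ) .{{_ : NonZero n}} (k : ℕ) .{{_ : NonZero k}} → ¬ (2 ∣ k) →
    (w : W n) → (x[ k ] w ≡ M (fromℕ k) w) × (x[ k ] w ≡ H (fromℕ k) w)
proposition6 (suc n) k 2∤k w = let m , k≡ = 2∤⇒odd k 2∤k in coefficients-agree m k≡ w
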